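{- For any prime $p\ge 5$, we have both $$\sum_{k=0}^{p-1}(-1)^kf_kH_k^{(2)}\equiv \frac{1}{2}B_{p-2}\left(\frac{1}{3}\right)\pmod{p}$$ and $$\sum_{k=0}^{p-1}(-1)^kf_kH_k\equiv -2\left(\frac{p}{3}\right)q_p(3) \pmod{p}.$$
   Context: The Franel numbers are $f_n=\sum_{k=0}^n\binom{n}{k}^3$ for $n\ge 0$. The generalized harmonic numbers are $H_k^{(r)}=\sum_{j=1}^k\frac{1}{j^r}$ (with $H_0^{(r)}=0$), and $H_k=H_k^{(1)}$. The Bernoulli polynomials $B_k(t)$ are defined by $\frac{xe^{tx}}{e^x-1}=\sum_{k=0}^{\infty}B_k(t)\frac{x^k}{k!}$. $\left(\frac{\cdot}{3}\right)$ denotes the Legendre symbol modulo $3$ (so $\left(\frac{a}{3}\right)=0,1,-1$ according as $a\equiv 0,1,2\pmod 3$). $q_p(3)=(3^{p-1}-1)/p$ is the Fermat quotient. A congruence modulo $p$ between rational numbers is understood in the ring of rational numbers whose denominators are coprime to $p$ (i.e. the difference is $p$ times a rational number with denominator coprime to $p$). -}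

module Defs where

open import Algebra.Bundles using (CommutativeRing)
open import Data.Fin.Base using (Fin; zero; suc; toℕ)
open import Data.Integer.Base as ℤ using (ℤ; +_; 0ℤ; 1ℤ; -1ℤ)
open import Data.Nat.Base as ℕ using (ℕ; zero; suc; NonZero; _∸_; _%_; _!)
open import Data.Nat.Combinatorics using (_C_)
open import Data.Nat.Coprimality using (Coprime)
import Data.Nat.Properties as ℕ
open import Data.Product.Base using (∃-syntax; _×_)
open import Data.Rational.Base using (ℚ; 0ℚ; 1ℚ; ↧ₙ_; toℚᵘ; _/_; _+_; _*_; _-_; -_)
import Data.Rational.Properties as ℚ
import Data.Rational.Unnormalised.Base as ℚᵘ
import Data.Rational.Unnormalised.Properties as ℚᵘ
open import Data.Vec.Functional using (Vector; _∷_)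
open import Relation.Binary.PropositionalEquality

module _ where
  open import Algebra.Properties.Semiring.Sum ℕ.+-*-semiring using (sum⁺-syntax)

  franel : ℕ → ℕ
  franel n = ∑[ k ≤ n ] ((n C toℕ k) ℕ.^ 3)

open import Algebra.Properties.Semiring.Sum (CommutativeRing.semiring ℚ.+-*-commutativeRing) public
  using (sum-syntax; sum⁺-syntax; sum-cong-≗)
open import Algebra.Properties.Semiring.Exp (CommutativeRing.semiring ℚ.+-*-commutativeRing) public
  using (_^_)

-- H k r = Σ_{j=1}^k 1/jʳ; the summation index is j − 1.
H : ℕ → ℕ → ℚ
H k r = ∑[ i < k ] recip (toℕ i)
  where
  recip : ℕ → ℚ
  recip i = + 1 / (suc i ℕ.^ r)
    where instance _ = ℕ.m^n≢0 (suc i) r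

legendre₃ : ℕ → ℤ
legendre₃ a with a % 3
... | 0 = 0ℤ
... | 1 = 1ℤ
... | _ = -1ℤ

fermatQuotient : (p : ℕ) .{{_ : NonZero p}} → ℕ → ℚ
fermatQuotient p a = (+ (a ℕ.^ (p ∸ 1)) ℤ.- 1ℤ) / p

infix 4 _≈_[mod_]

_≈_[mod_] : ℚ → ℚ → ℕ → Set
a ≈ b [mod p ] = ∃[ c ] Coprime (↧ₙ c) p × a - b ≡ (+ p / 1) * c

-- Formal power series in x over ℚ, as coefficient sequences.
Series : Set
Series = ℕ → ℚ

infixl 7 _⊛_

_⊛_ : Series → Series → Series
(f ⊛ g) n = ∑[ i ≤ n ] (f (n ∸ toℕ i) * g (toℕ i))

x·_ : Series → Series
(x· f) zero    = 0ℚ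
(x· f) (suc n) = f n

1/_! : ℕ → ℚ
1/ n ! = + 1 / (n !)
  where instance _ = n ℕ.!≢0

-- e^{tx}
exp : ℚ → Series
exp t n = t ^ n * 1/ n !

-- eˣ − 1
expm1 : Series
expm1 zero    = 0ℚ
expm1 (suc n) = exp 1ℚ (suc n)

-- (eˣ − 1)/x, which has constant coefficient 1
[expm1]/x : Series
[expm1]/x n = expm1 (suc n)

-- The quotient f/g for a series g with constant coefficient 1:
-- qₙ = fₙ − Σ_{i<n} q_{n−1−i} g_{i+1}.  The vector of the first n
-- coefficients is built in reverse order: its entry i is q_{n−1−i}.
quotients : Series → Series → (n : ℕ) → Vector ℚ n
quotients f g zero    = λ ()
quotients f g (suc n) =
  (f n - ∑[ i < n ] (quotients f g n i * g (suc (toℕ i)))) ∷ quotients f g n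

quotient : Series → Series → Series
quotient f g n = quotients f g (suc n) zero

-- Bₖ(t) is k! times the coefficient of xᵏ in
-- x e^{tx} / (eˣ − 1) = e^{tx} / ((eˣ − 1)/x); see bernoulli-gf.
bernoulli : ℕ → ℚ → ℚ
bernoulli k t = (+ (k !) / 1) * quotient (exp t) [expm1]/x k

quotients-lookup : ∀ f g n (i : Fin n) →
  quotients f g n i ≡ quotient f g (n ∸ suc (toℕ i))
quotients-lookup f g (suc n) zero    = refl
quotients-lookup f g (suc n) (suc i) = quotients-lookup f g n i

quotient-⊛ : ∀ f g → g 0 ≡ 1ℚ → ∀ n → (quotient f g ⊛ g) n ≡ f n
quotient-⊛ f g g₀≡1 n = begin
  q n * g 0 + ∑[ i < n ] (q (n ∸ suc (toℕ i)) * g (suc (toℕ i)))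
    ≡⟨ cong₂ _+_ (trans (cong (q n *_) g₀≡1) (ℚ.*-identityʳ (q n)))
                 (sum-cong-≗ (λ i → cong (_* g (suc (toℕ i))) (sym (quotients-lookup f g n i)))) ⟩
  (f n - s) + s   ≡⟨ ℚ.+-assoc (f n) (- s) s ⟩
  f n + (- s + s) ≡⟨ cong (λ x → f n + x) (ℚ.+-inverseˡ s) ⟩
  f n + 0ℚ        ≡⟨ ℚ.+-identityʳ (f n) ⟩
  f n             ∎
  where
  open ≡-Reasoning
  q = quotient f g
  s = ∑[ i < n ] (quotients f g n i * g (suc (toℕ i)))

m*1/m≡1 : ∀ m .{{_ : NonZero m}} → (+ m / 1) * (+ 1 / m) ≡ 1ℚ
m*1/m≡1 m@(suc _) = ℚ.toℚᵘ-injective (begin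
  toℚᵘ ((+ m / 1) * (+ 1 / m))          ≈⟨ ℚ.toℚᵘ-homo-* (+ m / 1) (+ 1 / m) ⟩
  toℚᵘ (+ m / 1) ℚᵘ.* toℚᵘ (+ 1 / m)    ≈⟨ ℚᵘ.*-cong (ℚ.toℚᵘ-fromℚᵘ (+ m ℚᵘ./ 1)) (ℚ.toℚᵘ-fromℚᵘ (+ 1 ℚᵘ./ m)) ⟩
  (+ m ℚᵘ./ 1) ℚᵘ.* (+ 1 ℚᵘ./ m)        ≈⟨ ℚᵘ.*-inverseʳ (+ m ℚᵘ./ 1) ⟩
  ℚᵘ.1ℚᵘ                                ∎)
  where open ℚᵘ.≃-Reasoning

n!*1/n!≡1 : ∀ n → (+ (n !) / 1) * 1/ n ! ≡ 1ℚ
n!*1/n!≡1 n = m*1/m≡1 (n !)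
  where instance _ = n ℕ.!≢0

bernoulli-/! : ∀ k t → bernoulli k t * 1/ k ! ≡ quotient (exp t) [expm1]/x k
bernoulli-/! k t = begin
  (k! * q) * 1/ k ! ≡⟨ cong (_* 1/ k !) (ℚ.*-comm k! q) ⟩
  (q * k!) * 1/ k ! ≡⟨ ℚ.*-assoc q k! (1/ k !) ⟩
  q * (k! * 1/ k !) ≡⟨ cong (q *_) (n!*1/n!≡1 k) ⟩
  q * 1ℚ            ≡⟨ ℚ.*-identityʳ q ⟩
  q                 ∎
  where
  open ≡-Reasoning
  k! = + (k !) / 1
  q  = quotient (exp t) [expm1]/x k

-- (Σₖ Bₖ(t) xᵏ/k!) · (eˣ − 1) = x e^{tx}
bernoulli-gf : ∀ t n → ((λ k → bernoulli k t * 1/ k !) ⊛ expm1) n ≡ (x· exp t) n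
bernoulli-gf t zero    = trans (ℚ.+-identityʳ _) (ℚ.*-zeroʳ (bernoulli 0 t * 1/ 0 !))
bernoulli-gf t (suc n) = begin
  b (suc n) * 0ℚ + (b ⊛ [expm1]/x) n ≡⟨ cong (_+ (b ⊛ [expm1]/x) n) (ℚ.*-zeroʳ (b (suc n))) ⟩
  0ℚ + (b ⊛ [expm1]/x) n             ≡⟨ ℚ.+-identityˡ _ ⟩
  (b ⊛ [expm1]/x) n
    ≡⟨ sum-cong-≗ {suc n} (λ i → cong (_* [expm1]/x (toℕ i)) (bernoulli-/! (n ∸ toℕ i) t)) ⟩
  (quotient (exp t) [expm1]/x ⊛ [expm1]/x) n ≡⟨ quotient-⊛ (exp t) [expm1]/x refl n ⟩
  exp t n                            ∎
  where
  open ≡-Reasoning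
  b : Series
  b k = bernoulli k t * 1/ k !

module Submission where

-- Write h = (p − 1)/2 and ε = (p/3).  Two applications of Vandermonde give
-- f_k = Σ_m C(2m,m) C(m,k−m) C(k,m), and p divides C(2m,m) for h < m < p.  So the
-- sum with weights a_k becomes Σ_{m≤h} C(2m,m) U_m, where U_m is up to sign the m-th
-- difference of C(k,m) a_k.  The Leibniz rule evaluates it: U_m = 2 H_m for a = H,
-- and U_m − U_{m−1} = 3 / (m² C(2m,m)) for a = H^(2).
--
-- For H, C(2m,m) ≡ C(h,m)(−4)^m turns the sum into 2 Σ_{i<h} (y^h − y^i)/(h − i) with
-- y = −3.  Since 1/(h − i) ≡ −2 C(p,2i+1)/p, it is read off the exact odd parts
-- of (1 + √1)^p and (1 + √−3)^p, which are 2^{p−1} and ε 2^{p−1}.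
--
-- For H^(2), summation by parts leaves the tails Σ_{m≤j≤h} C(2j,j), which expand in
-- the C(2m,m+d) with coefficients of period 3 in d; the sum over m then telescopes
-- to Σ_{d≤h} ±1/d² over residue classes mod 3.  Reflections d ↦ p − d and the even–odd
-- split reduce this to ε Σ_{k<p/3} 1/k², which is ½ B_{p−2}(1/3): replace 1/3 by
-- a natural number m ≡ 1/3, sum B(t + 1) − B(t), and use that odd Bernoulli numbers vanish.

import Algebra.Properties.Semiring.Sum
open import Data.Fin.Base as Fin using (Fin; toℕ)
import Data.Fin.Properties as Fin
open import Data.Integer.Base as ℤ using (ℤ; +_; -[1+_]; 0ℤ; 1ℤ; -1ℤ; ∣_∣)
open import Data.Integer.DivMod using (a≡a%ℕn+[a/ℕn]*n; _%ℕ_; _/ℕ_)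
import Data.Integer.Divisibility.Signed as Signed
import Data.Integer.Properties as ℤ
open import Data.Integer.Tactic.RingSolver using (solve-∀)
open import Data.Nat.Base as ℕ using (ℕ; zero; suc; _∸_; _≤_; _<_; z≤n; s≤s; _!; NonZero; _%_)
open import Data.Nat.Combinatorics using (_C_; nCk+nC[k+1]≡[n+1]C[k+1]; nCn≡1; nCk≡nC[n∸k])
open import Data.Nat.Combinatorics.Specification using (k>n⇒nCk≡0)
open import Data.Nat.Coprimality as Coprimality using (Coprime; coprime-divisor)
open import Data.Nat.DivMod using (m≡m%n+[m/n]*n; m%n<n; [m+kn]%n≡m%n)
open import Data.Nat.Divisibility using (_∣_; divides; ∣⇒≤; ∣-trans)
open import Data.Nat.Primality using (Prime; euclidsLemma; prime⇒irreducible; prime⇒nonZero)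
import Data.Nat.Properties as ℕ
open import Data.Nat.Tactic.RingSolver using () renaming (solve-∀ to ℕ-solve-∀)
open import Data.Product.Base using (∃-syntax; _×_; _,_; proj₁; proj₂)
import Data.Rational.Properties as ℚ
open import Data.Rational.Solver using (module +-*-Solver)
import Data.Rational.Unnormalised.Base as ℚᵘ
import Data.Rational.Unnormalised.Properties as ℚᵘ
open import Data.Sum.Base using (inj₁; inj₂)
open import Function.Base using (_∘_)
open import Relation.Binary.PropositionalEquality using (_≡_; refl; sym; trans; cong; cong₂; subst; module ≡-Reasoning)
open import Relation.Nullary.Decidable.Core using (yes; no)
open import Relation.Nullary.Negation using (¬_; contradiction)

-- The Fermat quotient is invisible modulo p, since it depends on 3^{p-1} modulo p². The sum for H
-- must therefore be divided by p exactly before it is reduced. Writing (-3)^h = ε + pN gives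
-- 3^{p-1} - 1 = (-3)^{2h} - ε² = pN((-3)^h + ε), hence q_p(3) ≡ 2εN. The combination of the two odd
-- parts that matches the sum equals pN 2^{p-1} as an identity of integers, so N is the common
-- source of both sides. Apart from this, all work takes place among integers modulo p, with z^{p-2}
-- in the role of 1/z. Division by a central binomial is justified by an explicit inverse, a value
-- of Euler's beta integral. Rationals enter only at the end, when a residue class is attached to
-- each p-integral rational. The Bernoulli polynomial fits in because its generating function has
-- p-integral coefficients up to degree p - 2, so that its value at 1/3 modulo p depends only on 1/3
-- modulo p.

module IntegerSums where
  open import Data.Integer.Base using (_+_; _*_; _-_; -_; _^_)

  -- Finite sums of integers

  ∑ : ℕ → (ℕ → ℤ) → ℤ
  ∑ zero    f = 0ℤ
  ∑ (suc n) f = ∑ n f + f n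

  ∑-cong : ∀ n {f g : ℕ → ℤ} → (∀ k → k < n → f k ≡ g k) → ∑ n f ≡ ∑ n g
  ∑-cong zero    f≡g = refl
  ∑-cong (suc n) f≡g = cong₂ _+_ (∑-cong n (λ k k<n → f≡g k (ℕ.m<n⇒m<1+n k<n))) (f≡g n ℕ.≤-refl)

  ∑-zero : ∀ n {f : ℕ → ℤ} → (∀ k → k < n → f k ≡ 0ℤ) → ∑ n f ≡ 0ℤ
  ∑-zero zero    f≡0 = refl
  ∑-zero (suc n) f≡0 = cong₂ _+_ (∑-zero n (λ k k<n → f≡0 k (ℕ.m<n⇒m<1+n k<n))) (f≡0 n ℕ.≤-refl)

  ∑-distrib-+ : ∀ n (f g : ℕ → ℤ) → ∑ n (λ k → f k + g k) ≡ ∑ n f + ∑ n g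
  ∑-distrib-+ zero    f g = refl
  ∑-distrib-+ (suc n) f g =
    trans (cong (_+ (f n + g n)) (∑-distrib-+ n f g)) (interchange (∑ n f) (∑ n g) (f n) (g n))
    where
    interchange : ∀ a b c d → (a + b) + (c + d) ≡ (a + c) + (b + d)
    interchange = solve-∀

  *-distribˡ-∑ : ∀ n c (f : ℕ → ℤ) → c * ∑ n f ≡ ∑ n (λ k → c * f k)
  *-distribˡ-∑ zero    c f = ℤ.*-zeroʳ c
  *-distribˡ-∑ (suc n) c f =
    trans (ℤ.*-distribˡ-+ c (∑ n f) (f n)) (cong (_+ c * f n) (*-distribˡ-∑ n c f))

  ∑-front : ∀ n (f : ℕ → ℤ) → ∑ (suc n) f ≡ f 0 + ∑ n (f ∘ suc)
  ∑-front zero    f = ℤ.+-comm 0ℤ (f 0)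
  ∑-front (suc n) f =
    trans (cong (_+ f (suc n)) (∑-front n f)) (ℤ.+-assoc (f 0) (∑ n (f ∘ suc)) (f (suc n)))

  ∑-++ : ∀ m n (f : ℕ → ℤ) → ∑ (m ℕ.+ n) f ≡ ∑ m f + ∑ n (λ k → f (m ℕ.+ k))
  ∑-++ m zero    f = trans (cong (λ x → ∑ x f) (ℕ.+-identityʳ m)) (sym (ℤ.+-identityʳ (∑ m f)))
  ∑-++ m (suc n) f = begin
    ∑ (m ℕ.+ suc n) f            ≡⟨ cong (λ x → ∑ x f) (ℕ.+-suc m n) ⟩
    ∑ (m ℕ.+ n) f + f (m ℕ.+ n)  ≡⟨ cong (_+ f (m ℕ.+ n)) (∑-++ m n f) ⟩
    ∑ m f + ∑ n (λ k → f (m ℕ.+ k)) + f (m ℕ.+ n)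
      ≡⟨ ℤ.+-assoc (∑ m f) _ (f (m ℕ.+ n)) ⟩
    ∑ m f + ∑ (suc n) (λ k → f (m ℕ.+ k)) ∎
    where open ≡-Reasoning

  ∑-extend : ∀ m n (f : ℕ → ℤ) → m ≤ n → (∀ k → m ≤ k → f k ≡ 0ℤ) → ∑ n f ≡ ∑ m f
  ∑-extend m n f m≤n f≡0 = begin
    ∑ n f                 ≡⟨ cong (λ x → ∑ x f) (ℕ.m+[n∸m]≡n m≤n) ⟨
    ∑ (m ℕ.+ (n ∸ m)) f   ≡⟨ ∑-++ m (n ∸ m) f ⟩
    ∑ m f + ∑ (n ∸ m) (λ k → f (m ℕ.+ k))
      ≡⟨ cong (λ x → ∑ m f + x) (∑-zero (n ∸ m) (λ k _ → f≡0 (m ℕ.+ k) (ℕ.m≤m+n m k))) ⟩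
    ∑ m f + 0ℤ            ≡⟨ ℤ.+-identityʳ (∑ m f) ⟩
    ∑ m f                 ∎
    where open ≡-Reasoning

  ∑-reverse : ∀ n (f : ℕ → ℤ) → ∑ n f ≡ ∑ n (λ k → f (n ∸ suc k))
  ∑-reverse zero    f = refl
  ∑-reverse (suc n) f = begin
    ∑ n f + f n                        ≡⟨ cong (_+ f n) (∑-reverse n f) ⟩
    ∑ n (λ k → f (n ∸ suc k)) + f n    ≡⟨ ℤ.+-comm _ (f n) ⟩
    f n + ∑ n (λ k → f (n ∸ suc k))    ≡⟨ ∑-front n (λ k → f (n ∸ k)) ⟨
    ∑ (suc n) (λ k → f (n ∸ k))        ∎
    where open ≡-Reasoning

  ∑-swap : ∀ m n (f : ℕ → ℕ → ℤ) → ∑ m (λ i → ∑ n (f i)) ≡ ∑ n (λ j → ∑ m (λ i → f i j))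
  ∑-swap zero    n f = sym (∑-zero n (λ _ _ → refl))
  ∑-swap (suc m) n f =
    trans (cong (_+ ∑ n (f m)) (∑-swap m n f)) (sym (∑-distrib-+ n (λ j → ∑ m (λ i → f i j)) (f m)))

  ∑-triangle : ∀ n (f : ℕ → ℕ → ℤ) →
    ∑ n (λ k → ∑ (suc k) (λ i → f i (k ∸ i))) ≡ ∑ n (λ i → ∑ (n ∸ i) (f i))
  ∑-triangle zero    f = refl
  ∑-triangle (suc n) f = begin
    ∑ n (λ k → ∑ (suc k) (λ i → f i (k ∸ i))) + ∑ (suc n) (λ i → f i (n ∸ i))
      ≡⟨ cong (_+ ∑ (suc n) (λ i → f i (n ∸ i))) (∑-triangle n f) ⟩
    ∑ n (λ i → ∑ (n ∸ i) (f i)) + ∑ (suc n) (λ i → f i (n ∸ i))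
      -- An empty inner sum for i = n is appended, so that both outer sums have the range i ≤ n and
      -- can be merged.
      ≡⟨ cong (_+ ∑ (suc n) (λ i → f i (n ∸ i))) (ℤ.+-identityʳ (∑ n (λ i → ∑ (n ∸ i) (f i)))) ⟨
    ∑ n (λ i → ∑ (n ∸ i) (f i)) + 0ℤ + ∑ (suc n) (λ i → f i (n ∸ i))
      ≡⟨ cong (λ x → ∑ n (λ i → ∑ (n ∸ i) (f i)) + ∑ x (f n) + ∑ (suc n) (λ i → f i (n ∸ i))) (ℕ.n∸n≡0 n) ⟨
    ∑ (suc n) (λ i → ∑ (n ∸ i) (f i)) + ∑ (suc n) (λ i → f i (n ∸ i))
      ≡⟨ ∑-distrib-+ (suc n) (λ i → ∑ (n ∸ i) (f i)) (λ i → f i (n ∸ i)) ⟨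
    ∑ (suc n) (λ i → ∑ (suc (n ∸ i)) (f i))
      ≡⟨ ∑-cong (suc n) (λ { i (s≤s i≤n) → cong (λ x → ∑ x (f i)) (sym (ℕ.+-∸-assoc 1 i≤n)) }) ⟩
    ∑ (suc n) (λ i → ∑ (suc n ∸ i) (f i)) ∎
    where open ≡-Reasoning

  ∑-pairs : ∀ n (f : ℕ → ℤ) → ∑ (n ℕ.+ n) f ≡ ∑ n (λ i → f (i ℕ.+ i) + f (suc (i ℕ.+ i)))
  ∑-pairs zero    f = refl
  ∑-pairs (suc n) f rewrite ℕ.+-suc n n =
    trans (ℤ.+-assoc (∑ (n ℕ.+ n) f) _ _) (cong (_+ (f (n ℕ.+ n) + f (suc (n ℕ.+ n)))) (∑-pairs n f))

  ∑-triples : ∀ n (f : ℕ → ℤ) →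
    ∑ (n ℕ.* 3) f ≡ ∑ n (λ i → f (i ℕ.* 3) + f (1 ℕ.+ i ℕ.* 3) + f (2 ℕ.+ i ℕ.* 3))
  ∑-triples zero    f = refl
  ∑-triples (suc n) f =
    trans (regroup (∑ (n ℕ.* 3) f) _ _ _)
          (cong (_+ (f (n ℕ.* 3) + f (1 ℕ.+ n ℕ.* 3) + f (2 ℕ.+ n ℕ.* 3))) (∑-triples n f))
    where
    regroup : ∀ a b c d → a + b + c + d ≡ a + (b + c + d)
    regroup = solve-∀

  -- Binomial coefficients and weighted binomial sums

  opaque
    -- Opaque, so that conversion checking never unfolds `_C_`; all later arguments use only the
    -- rules of this block.
    binom : ℕ → ℕ → ℤ
    binom n k = + (n C k)

    binom≡ : ∀ n k → + (n C k) ≡ binom n k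
    binom≡ n k = refl

    pascal : ∀ n k → binom (suc n) (suc k) ≡ binom n k + binom n (suc k)
    pascal n k = cong +_ (sym (nCk+nC[k+1]≡[n+1]C[k+1] n k))

    binom-0 : ∀ n → binom n 0 ≡ 1ℤ
    binom-0 n = refl

    binom-> : ∀ {n k} → n < k → binom n k ≡ 0ℤ
    binom-> n<k = cong +_ (k>n⇒nCk≡0 n<k)

    binom-n : ∀ n → binom n n ≡ 1ℤ
    binom-n n = cong +_ (nCn≡1 n)

    binom-sym : ∀ {n k} → k ≤ n → binom n k ≡ binom n (n ∸ k)
    binom-sym k≤n = cong +_ (nCk≡nC[n∸k] k≤n)

  absorption : ∀ n k → + suc k * binom (suc n) (suc k) ≡ + suc n * binom n k
  absorption zero zero =
    cong (1ℤ *_) (trans (binom-n 1) (sym (binom-0 0)))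
  absorption zero (suc k) = begin
    + suc (suc k) * binom 1 (suc (suc k))  ≡⟨ cong (+ suc (suc k) *_) (binom-> (s≤s (s≤s z≤n))) ⟩
    + suc (suc k) * 0ℤ                     ≡⟨ ℤ.*-zeroʳ (+ suc (suc k)) ⟩
    1ℤ * 0ℤ                                ≡⟨ cong (1ℤ *_) (binom-> (s≤s z≤n)) ⟨
    1ℤ * binom 0 (suc k)                   ∎
    where open ≡-Reasoning
  absorption (suc n) zero = begin
    1ℤ * binom (suc (suc n)) 1               ≡⟨ cong (1ℤ *_) (pascal (suc n) 0) ⟩
    1ℤ * (binom (suc n) 0 + binom (suc n) 1) ≡⟨ ℤ.*-distribˡ-+ 1ℤ (binom (suc n) 0) _ ⟩
    1ℤ * binom (suc n) 0 + 1ℤ * binom (suc n) 1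
      ≡⟨ cong₂ (λ x y → 1ℤ * x + y) (trans (binom-0 (suc n)) (sym (binom-0 n))) (absorption n 0) ⟩
    1ℤ * binom n 0 + + suc n * binom n 0     ≡⟨ ℤ.*-distribʳ-+ (binom n 0) 1ℤ (+ suc n) ⟨
    + suc (suc n) * binom n 0                ≡⟨ cong (+ suc (suc n) *_) (trans (binom-0 n) (sym (binom-0 (suc n)))) ⟩
    + suc (suc n) * binom (suc n) 0          ∎
    where open ≡-Reasoning
  absorption (suc n) (suc k) = begin
    + suc (suc k) * binom (suc (suc n)) (suc (suc k)) ≡⟨ cong (+ suc (suc k) *_) (pascal (suc n) (suc k)) ⟩
    + suc (suc k) * (a + b)                           ≡⟨ expand (+ suc k) a b ⟩
    + suc k * a + (a + + suc (suc k) * b)             ≡⟨ cong₂ (λ x y → x + (a + y)) (absorption n k) (absorption n (suc k)) ⟩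
    + suc n * c + (a + + suc n * d)                   ≡⟨ collect (+ suc n) a c d ⟩
    + suc n * (c + d) + a                             ≡⟨ cong (λ x → + suc n * x + a) (pascal n k) ⟨
    + suc n * a + a                                   ≡⟨ plus-one (+ suc n) a ⟩
    + suc (suc n) * a                                 ∎
    where
    open ≡-Reasoning
    a = binom (suc n) (suc k)
    b = binom (suc n) (suc (suc k))
    c = binom n k
    d = binom n (suc k)
    expand : ∀ k a b → (1ℤ + k) * (a + b) ≡ k * a + (a + (1ℤ + k) * b)
    expand = solve-∀
    collect : ∀ n a c d → n * c + (a + n * d) ≡ n * (c + d) + a
    collect = solve-∀
    plus-one : ∀ n a → n * a + a ≡ (1ℤ + n) * a
    plus-one = solve-∀

  absorption′ : ∀ n k → (+ suc n - + k) * binom (suc n) k ≡ + suc n * binom n k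
  absorption′ n zero =
    cong₂ _*_ (ℤ.+-identityʳ (+ suc n)) (trans (binom-0 (suc n)) (sym (binom-0 n)))
  absorption′ n (suc k) = begin
    (+ suc n - + suc k) * b              ≡⟨ split (+ suc n) (+ suc k) b ⟩
    + suc n * b - + suc k * b            ≡⟨ cong₂ (λ x y → + suc n * x - y) (pascal n k) (absorption n k) ⟩
    + suc n * (c + d) - + suc n * c      ≡⟨ cancel (+ suc n) c d ⟩
    + suc n * d                          ∎
    where
    open ≡-Reasoning
    b = binom (suc n) (suc k)
    c = binom n k
    d = binom n (suc k)
    split : ∀ n k b → (n - k) * b ≡ n * b - k * b
    split = solve-∀
    cancel : ∀ n c d → n * (c + d) - n * c ≡ n * d
    cancel = solve-∀

  -- Factorials are avoided: after multiplication by `suc i`, absorption lowers `i` twice on the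
  -- left and once on the right.
  trinomial-revision : ∀ i m l →
    binom (i ℕ.+ m) (i ℕ.+ l) * binom (i ℕ.+ l) i ≡ binom (i ℕ.+ m) i * binom m l
  trinomial-revision zero m l =
    trans (cong (binom m l *_) (trans (binom-0 l) (sym (binom-0 m)))) (ℤ.*-comm (binom m l) (binom m 0))
  trinomial-revision (suc i) m l = ℤ.*-cancelˡ-≡ (+ suc i) _ _ (begin
    + suc i * (A * B)        ≡⟨ swap₁ (+ suc i) A B ⟩
    A * (+ suc i * B)        ≡⟨ cong (A *_) (absorption il i) ⟩
    A * (+ suc il * b)       ≡⟨ swap₂ (+ suc il) A b ⟩
    (+ suc il * A) * b       ≡⟨ cong (_* b) (absorption im il) ⟩
    (+ suc im * a) * b       ≡⟨ ℤ.*-assoc (+ suc im) a b ⟩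
    + suc im * (a * b)       ≡⟨ cong (+ suc im *_) (trinomial-revision i m l) ⟩
    + suc im * (c * d)       ≡⟨ ℤ.*-assoc (+ suc im) c d ⟨
    (+ suc im * c) * d       ≡⟨ cong (_* d) (absorption im i) ⟨
    (+ suc i * E) * d        ≡⟨ ℤ.*-assoc (+ suc i) E d ⟩
    + suc i * (E * d)        ∎)
    where
    open ≡-Reasoning
    im = i ℕ.+ m
    il = i ℕ.+ l
    A = binom (suc im) (suc il)
    B = binom (suc il) (suc i)
    E = binom (suc im) (suc i)
    a = binom im il
    b = binom il i
    c = binom im i
    d = binom m l
    swap₁ : ∀ a b c → a * (b * c) ≡ b * (a * c)
    swap₁ = solve-∀
    swap₂ : ∀ a b c → b * (a * c) ≡ (a * b) * c
    swap₂ = solve-∀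

  -- T x n f = Σ_{k≤n} C(n,k) xᵏ f(k), by T-∑; this recursion makes T -1 n the n-th difference.
  T : ℤ → ℕ → (ℕ → ℤ) → ℤ
  T x zero    f = f 0
  T x (suc n) f = T x n f + x * T x n (f ∘ suc)

  T-cong : ∀ x n {f g : ℕ → ℤ} → (∀ k → k ≤ n → f k ≡ g k) → T x n f ≡ T x n g
  T-cong x zero    f≡g = f≡g 0 z≤n
  T-cong x (suc n) f≡g = cong₂ (λ a b → a + x * b)
    (T-cong x n (λ k k≤n → f≡g k (ℕ.m≤n⇒m≤1+n k≤n)))
    (T-cong x n (λ k k≤n → f≡g (suc k) (s≤s k≤n)))

  T-linear : ∀ x n a b (f g : ℕ → ℤ) → T x n (λ k → a * f k + b * g k) ≡ a * T x n f + b * T x n g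
  T-linear x zero    a b f g = refl
  T-linear x (suc n) a b f g =
    trans (cong₂ (λ u v → u + x * v) (T-linear x n a b f g) (T-linear x n a b (f ∘ suc) (g ∘ suc)))
          (regroup a b x _ _ _ _)
    where
    regroup : ∀ a b x u v u′ v′ →
      a * u + b * v + x * (a * u′ + b * v′) ≡ a * (u + x * u′) + b * (v + x * v′)
    regroup = solve-∀

  T-∑ : ∀ x n (f : ℕ → ℤ) → T x n f ≡ ∑ (suc n) (λ k → binom n k * x ^ k * f k)
  T-∑ x zero f = sym (trans (ℤ.+-identityˡ _) (trans (cong (λ b → b * 1ℤ * f 0) (binom-0 0)) (ℤ.*-identityˡ (f 0))))
  T-∑ x (suc n) f = begin
    T x n f + x * T x n (f ∘ suc)
      ≡⟨ cong₂ (λ u v → u + x * v) (T-∑ x n f) (T-∑ x n (f ∘ suc)) ⟩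
    ∑ (suc n) g + x * ∑ (suc n) g′
      ≡⟨ cong₂ (λ u v → u + v) (sym (∑-extend (suc n) (suc (suc n)) g (ℕ.n≤1+n (suc n)) g≡0)) (*-distribˡ-∑ (suc n) x g′) ⟩
    ∑ (suc (suc n)) g + ∑ (suc n) (λ k → x * g′ k)
      ≡⟨ cong (_+ ∑ (suc n) (λ k → x * g′ k)) (∑-front (suc n) g) ⟩
    g 0 + ∑ (suc n) (g ∘ suc) + ∑ (suc n) (λ k → x * g′ k)
      ≡⟨ ℤ.+-assoc (g 0) _ _ ⟩
    g 0 + (∑ (suc n) (g ∘ suc) + ∑ (suc n) (λ k → x * g′ k))
      ≡⟨ cong (λ v → g 0 + v) (∑-distrib-+ (suc n) (g ∘ suc) (λ k → x * g′ k)) ⟨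
    g 0 + ∑ (suc n) (λ k → g (suc k) + x * g′ k)
      ≡⟨ cong₂ _+_ (cong (λ b → b * 1ℤ * f 0) (trans (binom-0 n) (sym (binom-0 (suc n))))) (∑-cong (suc n) (λ k _ → step k)) ⟩
    G 0 + ∑ (suc n) (G ∘ suc)
      ≡⟨ ∑-front (suc n) G ⟨
    ∑ (suc (suc n)) G ∎
    where
    open ≡-Reasoning
    g g′ G : ℕ → ℤ
    g  k = binom n k * x ^ k * f k
    g′ k = binom n k * x ^ k * f (suc k)
    G  k = binom (suc n) k * x ^ k * f k
    g≡0 : ∀ k → suc n ≤ k → g k ≡ 0ℤ
    g≡0 k n<k = cong (λ b → b * x ^ k * f k) (binom-> n<k)
    regroup : ∀ a b x y z → a * (x * y) * z + x * (b * y * z) ≡ (b + a) * (x * y) * z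
    regroup = solve-∀
    step : ∀ k → g (suc k) + x * g′ k ≡ G (suc k)
    step k = trans (regroup (binom n (suc k)) (binom n k) x (x ^ k) (f (suc k)))
                   (cong (λ b → b * (x * x ^ k) * f (suc k)) (sym (pascal n k)))

  T-one : ∀ x n → T x n (λ _ → 1ℤ) ≡ (1ℤ + x) ^ n
  T-one x zero    = refl
  T-one x (suc n) = trans (cong (λ t → t + x * t) (T-one x n)) (factor x ((1ℤ + x) ^ n))
    where
    factor : ∀ x t → t + x * t ≡ (1ℤ + x) * t
    factor = solve-∀

  -- With an offset c in place of a subtraction, the induction on `a` is exactly Pascal's rule for
  -- C(a + b, a + c).
  vandermonde : ∀ a b c → T 1ℤ a (λ l → binom b (c ℕ.+ l)) ≡ binom (a ℕ.+ b) (a ℕ.+ c)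
  vandermonde zero    b c = cong (binom b) (ℕ.+-identityʳ c)
  vandermonde (suc a) b c = begin
    T 1ℤ a (λ l → binom b (c ℕ.+ l)) + 1ℤ * T 1ℤ a (λ l → binom b (c ℕ.+ suc l))
      ≡⟨ cong₂ (λ u v → u + 1ℤ * v) (vandermonde a b c)
           (trans (T-cong 1ℤ a (λ l _ → cong (binom b) (ℕ.+-suc c l))) (vandermonde a b (suc c))) ⟩
    binom (a ℕ.+ b) (a ℕ.+ c) + 1ℤ * binom (a ℕ.+ b) (a ℕ.+ suc c)
      ≡⟨ cong (λ v → binom (a ℕ.+ b) (a ℕ.+ c) + v)
           (trans (ℤ.*-identityˡ _) (cong (binom (a ℕ.+ b)) (ℕ.+-suc a c))) ⟩
    binom (a ℕ.+ b) (a ℕ.+ c) + binom (a ℕ.+ b) (suc (a ℕ.+ c))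
      ≡⟨ pascal (a ℕ.+ b) (a ℕ.+ c) ⟨
    binom (suc a ℕ.+ b) (suc a ℕ.+ c) ∎
    where open ≡-Reasoning

  open ≡-Reasoning

  -- Franel numbers through central binomial coefficients

  central : ℕ → ℤ
  central m = binom (m ℕ.+ m) m

  binom-sym-+ : ∀ a b → binom (a ℕ.+ b) a ≡ binom (a ℕ.+ b) b
  binom-sym-+ a b = trans (binom-sym (ℕ.m≤m+n a b)) (cong (binom (a ℕ.+ b)) (ℕ.m+n∸m≡n a b))

  -- Both products count the disjoint pairs of an l-subset and an i-subset of an m-set.
  binom-binom-comm : ∀ m l i → l ≤ m →
    binom m l * binom (m ∸ l) i ≡ binom m i * binom (m ∸ i) l
  binom-binom-comm m l i l≤m with i ℕ.≤? m
  ... | no i≰m = trans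
    (cong (binom m l *_) (binom-> (ℕ.≤-<-trans (ℕ.m∸n≤m m l) (ℕ.≰⇒> i≰m))))
    (trans (ℤ.*-zeroʳ (binom m l)) (sym (cong (_* binom (m ∸ i) l) (binom-> (ℕ.≰⇒> i≰m)))))
  ... | yes i≤m = begin
    binom m l * binom (m ∸ l) i             ≡⟨ revise l≤m i ⟩
    binom m (l ℕ.+ i) * binom (l ℕ.+ i) l   ≡⟨ cong (binom m (l ℕ.+ i) *_) (binom-sym-+ l i) ⟩
    binom m (l ℕ.+ i) * binom (l ℕ.+ i) i   ≡⟨ cong (λ x → binom m x * binom x i) (ℕ.+-comm l i) ⟩
    binom m (i ℕ.+ l) * binom (i ℕ.+ l) i   ≡⟨ revise i≤m l ⟨
    binom m i * binom (m ∸ i) l             ∎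
    where
    revise : ∀ {k} → k ≤ m → ∀ j → binom m k * binom (m ∸ k) j ≡ binom m (k ℕ.+ j) * binom (k ℕ.+ j) k
    revise {k} k≤m j = begin
      binom m k * binom (m ∸ k) j
        ≡⟨ cong (λ x → binom x k * binom (m ∸ k) j) (ℕ.m+[n∸m]≡n k≤m) ⟨
      binom (k ℕ.+ (m ∸ k)) k * binom (m ∸ k) j
        ≡⟨ trinomial-revision k (m ∸ k) j ⟨
      binom (k ℕ.+ (m ∸ k)) (k ℕ.+ j) * binom (k ℕ.+ j) k
        ≡⟨ cong (λ x → binom x (k ℕ.+ j) * binom (k ℕ.+ j) k) (ℕ.m+[n∸m]≡n k≤m) ⟩
      binom m (k ℕ.+ j) * binom (k ℕ.+ j) k ∎

  T-1 : ∀ n (f : ℕ → ℤ) → T 1ℤ n f ≡ ∑ (suc n) (λ k → binom n k * f k)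
  T-1 n f = trans (T-∑ 1ℤ n f) (∑-cong (suc n) (λ k _ →
    cong (_* f k) (trans (cong (binom n k *_) (ℤ.^-zeroˡ k)) (ℤ.*-identityʳ (binom n k)))))

  binom-as-∑ : ∀ n k → k ≤ n → binom n k ≡ ∑ (suc k) (λ i → binom k i * binom (n ∸ k) i)
  binom-as-∑ n k k≤n = begin
    binom n k                               ≡⟨ cong₂ binom (ℕ.m+[n∸m]≡n k≤n) (ℕ.+-identityʳ k) ⟨
    binom (k ℕ.+ (n ∸ k)) (k ℕ.+ 0)         ≡⟨ vandermonde k (n ∸ k) 0 ⟨
    T 1ℤ k (binom (n ∸ k))                  ≡⟨ T-1 k (binom (n ∸ k)) ⟩
    ∑ (suc k) (λ i → binom k i * binom (n ∸ k) i) ∎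

  cube : ℤ → ℤ
  cube x = x * (x * x)

  -- The first Vandermonde splits one factor of the cube; put k = i + l. Trinomial revision then
  -- confines l to C(n - 2i, l) C(n, i + l), which the second Vandermonde sums to C(2n - 2i, n - i).
  -- Finally m = n - i.
  ∑-cube-binom : ∀ n →
    ∑ (suc n) (λ k → cube (binom n k)) ≡ ∑ (suc n) (λ m → binom n m * binom m (n ∸ m) * central m)
  ∑-cube-binom n = begin
    ∑ (suc n) (λ k → cube (binom n k))
      ≡⟨ ∑-cong (suc n) (λ { k (s≤s k≤n) → expand k k≤n }) ⟩
    ∑ (suc n) (λ k → ∑ (suc k) (λ i → g i (k ∸ i)))
      ≡⟨ ∑-triangle (suc n) g ⟩
    ∑ (suc n) (λ i → ∑ (suc n ∸ i) (g i))
      ≡⟨ ∑-cong (suc n) (λ { i (s≤s i≤n) → collapse i i≤n }) ⟩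
    ∑ (suc n) (λ i → binom n i * binom (n ∸ i) i * central (n ∸ i))
      ≡⟨ ∑-reverse (suc n) (λ i → binom n i * binom (n ∸ i) i * central (n ∸ i)) ⟩
    ∑ (suc n) (λ m → binom n (n ∸ m) * binom (n ∸ (n ∸ m)) (n ∸ m) * central (n ∸ (n ∸ m)))
      ≡⟨ ∑-cong (suc n) (λ { m (s≤s m≤n) →
           cong₂ (λ b x → b * binom x (n ∸ m) * central x) (sym (binom-sym m≤n)) (ℕ.m∸[m∸n]≡n m≤n) }) ⟩
    ∑ (suc n) (λ m → binom n m * binom m (n ∸ m) * central m) ∎
    where
    g : ℕ → ℕ → ℤ
    g i l = binom n i * binom (n ∸ i) i * (binom (n ∸ i ∸ i) l * binom n (i ℕ.+ l))

    term : ∀ i l → i ℕ.+ l ≤ n →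
      binom n (i ℕ.+ l) * (binom (i ℕ.+ l) i * binom (n ∸ (i ℕ.+ l)) i)
        ≡ binom n i * (binom (n ∸ i) i * binom (n ∸ i ∸ i) l)
    term i l i+l≤n = begin
      binom n (i ℕ.+ l) * (binom (i ℕ.+ l) i * c)     ≡⟨ ℤ.*-assoc (binom n (i ℕ.+ l)) (binom (i ℕ.+ l) i) c ⟨
      binom n (i ℕ.+ l) * binom (i ℕ.+ l) i * c       ≡⟨ cong (λ x → binom x (i ℕ.+ l) * binom (i ℕ.+ l) i * c) i+m≡n ⟨
      binom (i ℕ.+ m) (i ℕ.+ l) * binom (i ℕ.+ l) i * c
        ≡⟨ cong (_* c) (trinomial-revision i m l) ⟩
      binom (i ℕ.+ m) i * binom m l * c
        ≡⟨ cong₂ (λ x y → binom x i * binom m l * binom y i) i+m≡n (sym (ℕ.∸-+-assoc n i l)) ⟩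
      binom n i * binom m l * binom (m ∸ l) i         ≡⟨ ℤ.*-assoc (binom n i) (binom m l) (binom (m ∸ l) i) ⟩
      binom n i * (binom m l * binom (m ∸ l) i)       ≡⟨ cong (binom n i *_) (binom-binom-comm m l i l≤m) ⟩
      binom n i * (binom m i * binom (m ∸ i) l)       ∎
      where
      m = n ∸ i
      c = binom (n ∸ (i ℕ.+ l)) i
      i+m≡n : i ℕ.+ m ≡ n
      i+m≡n = ℕ.m+[n∸m]≡n (ℕ.≤-trans (ℕ.m≤m+n i l) i+l≤n)
      l≤m : l ≤ m
      l≤m = subst (_≤ m) (ℕ.m+n∸m≡n i l) (ℕ.∸-monoˡ-≤ i i+l≤n)

    expand : ∀ k → k ≤ n → cube (binom n k) ≡ ∑ (suc k) (λ i → g i (k ∸ i))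
    expand k k≤n = begin
      b * (b * b)
        ≡⟨ cong (λ x → b * (b * x)) (binom-as-∑ n k k≤n) ⟩
      b * (b * ∑ (suc k) (λ i → binom k i * binom (n ∸ k) i))
        ≡⟨ cong (b *_) (*-distribˡ-∑ (suc k) b (λ i → binom k i * binom (n ∸ k) i)) ⟩
      b * ∑ (suc k) (λ i → b * (binom k i * binom (n ∸ k) i))
        ≡⟨ *-distribˡ-∑ (suc k) b (λ i → b * (binom k i * binom (n ∸ k) i)) ⟩
      ∑ (suc k) (λ i → b * (b * (binom k i * binom (n ∸ k) i)))
        ≡⟨ ∑-cong (suc k) (λ { i (s≤s i≤k) → step i (k ∸ i) (ℕ.m+[n∸m]≡n i≤k) }) ⟩
      ∑ (suc k) (λ i → g i (k ∸ i)) ∎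
      where
      b = binom n k
      regroup : ∀ b x y z → b * (x * (y * z)) ≡ x * y * (z * b)
      regroup = solve-∀
      step : ∀ i l → i ℕ.+ l ≡ k → b * (b * (binom k i * binom (n ∸ k) i)) ≡ g i l
      step i l refl = trans (cong (b *_) (term i l k≤n))
        (regroup b (binom n i) (binom (n ∸ i) i) (binom (n ∸ i ∸ i) l))

    collapse : ∀ i → i ≤ n → ∑ (suc n ∸ i) (g i) ≡ binom n i * binom (n ∸ i) i * central (n ∸ i)
    collapse i i≤n with i ℕ.≤? n ∸ i
    -- Subtraction is truncated here, so Vandermonde does not apply; both sides vanish because of
    -- the factor C(n - i, i).
    ... | no i≰m = begin
      ∑ (suc n ∸ i) (g i)
        ≡⟨ ∑-zero (suc n ∸ i) (λ l _ → cong (_* (binom (n ∸ i ∸ i) l * binom n (i ℕ.+ l))) vanish) ⟩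
      0ℤ                                                ≡⟨ cong (_* central (n ∸ i)) vanish ⟨
      binom n i * binom (n ∸ i) i * central (n ∸ i)     ∎
      where
      vanish : binom n i * binom (n ∸ i) i ≡ 0ℤ
      vanish = trans (cong (binom n i *_) (binom-> (ℕ.≰⇒> i≰m))) (ℤ.*-zeroʳ (binom n i))
    ... | yes i≤m = begin
      ∑ (suc n ∸ i) (g i)
        ≡⟨ *-distribˡ-∑ (suc n ∸ i) (binom n i * binom m i) (λ l → binom (m ∸ i) l * binom n (i ℕ.+ l)) ⟨
      binom n i * binom m i * ∑ (suc n ∸ i) (λ l → binom (m ∸ i) l * binom n (i ℕ.+ l))
        ≡⟨ cong (binom n i * binom m i *_) inner ⟩
      binom n i * binom m i * central m ∎
      where
      m = n ∸ i
      r = m ∸ i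
      r+i≡m : r ℕ.+ i ≡ m
      r+i≡m = ℕ.m∸n+n≡m i≤m
      r+n≡2m : r ℕ.+ n ≡ m ℕ.+ m
      r+n≡2m = trans (cong (r ℕ.+_) (sym (ℕ.m+[n∸m]≡n i≤n)))
                     (trans (sym (ℕ.+-assoc r i m)) (cong (ℕ._+ m) r+i≡m))
      inner : ∑ (suc n ∸ i) (λ l → binom r l * binom n (i ℕ.+ l)) ≡ central m
      inner = begin
        ∑ (suc n ∸ i) (λ l → binom r l * binom n (i ℕ.+ l))
          ≡⟨ ∑-extend (suc r) (suc n ∸ i) (λ l → binom r l * binom n (i ℕ.+ l))
               (subst (suc r ≤_) (sym (ℕ.+-∸-assoc 1 i≤n)) (s≤s (ℕ.m∸n≤m m i)))
               (λ l r<l → cong (_* binom n (i ℕ.+ l)) (binom-> r<l)) ⟩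
        ∑ (suc r) (λ l → binom r l * binom n (i ℕ.+ l))   ≡⟨ T-1 r (λ l → binom n (i ℕ.+ l)) ⟨
        T 1ℤ r (λ l → binom n (i ℕ.+ l))                  ≡⟨ vandermonde r n i ⟩
        binom (r ℕ.+ n) (r ℕ.+ i)                         ≡⟨ cong₂ binom r+n≡2m r+i≡m ⟩
        central m                                         ∎

  ∑-franel : ∀ N (s : ℕ → ℤ) →
    ∑ N (λ k → s k * ∑ (suc k) (λ i → cube (binom k i)))
      ≡ ∑ N (λ m → central m * ∑ (N ∸ m) (λ l → binom m l * (binom (m ℕ.+ l) m * s (m ℕ.+ l))))
  ∑-franel N s = begin
    ∑ N (λ k → s k * ∑ (suc k) (λ i → cube (binom k i)))
      ≡⟨ ∑-cong N (λ k _ → expand k) ⟩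
    ∑ N (λ k → ∑ (suc k) (λ m → g m (k ∸ m)))
      ≡⟨ ∑-triangle N g ⟩
    ∑ N (λ m → ∑ (N ∸ m) (g m))
      ≡⟨ ∑-cong N (λ m _ → sym (*-distribˡ-∑ (N ∸ m) (central m) (λ l → binom m l * (binom (m ℕ.+ l) m * s (m ℕ.+ l))))) ⟩
    ∑ N (λ m → central m * ∑ (N ∸ m) (λ l → binom m l * (binom (m ℕ.+ l) m * s (m ℕ.+ l)))) ∎
    where
    g : ℕ → ℕ → ℤ
    g m l = central m * (binom m l * (binom (m ℕ.+ l) m * s (m ℕ.+ l)))
    regroup : ∀ s a b c → s * (a * b * c) ≡ c * (b * (a * s))
    regroup = solve-∀
    step : ∀ k m l → m ℕ.+ l ≡ k → s k * (binom k m * binom m l * central m) ≡ g m l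
    step k m l refl = regroup (s k) (binom k m) (binom m l) (central m)
    expand : ∀ k → s k * ∑ (suc k) (λ i → cube (binom k i)) ≡ ∑ (suc k) (λ m → g m (k ∸ m))
    expand k = begin
      s k * ∑ (suc k) (λ i → cube (binom k i))
        ≡⟨ cong (s k *_) (∑-cube-binom k) ⟩
      s k * ∑ (suc k) (λ m → binom k m * binom m (k ∸ m) * central m)
        ≡⟨ *-distribˡ-∑ (suc k) (s k) (λ m → binom k m * binom m (k ∸ m) * central m) ⟩
      ∑ (suc k) (λ m → s k * (binom k m * binom m (k ∸ m) * central m))
        ≡⟨ ∑-cong (suc k) (λ { m (s≤s m≤k) → step k m (k ∸ m) (ℕ.m+[n∸m]≡n m≤k) }) ⟩
      ∑ (suc k) (λ m → g m (k ∸ m)) ∎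

-- Power series and identities for Bernoulli polynomials

module PowerSeries where
  open import Defs
  open import Data.Rational.Base using (ℚ; mkℚ; 0ℚ; 1ℚ; ½; _/_; _+_; _*_; _-_; -_; toℚᵘ; ↥_; ↧_; ↧ₙ_)
  open ≡-Reasoning
  open +-*-Solver using (solve; _:+_; _:*_; _:=_; _:-_; con)

  -1ℚ : ℚ
  -1ℚ = - 1ℚ

  toℚᵘ-/1 : ∀ z → toℚᵘ (z / 1) ℚᵘ.≃ z ℚᵘ./ 1
  toℚᵘ-/1 z = ℚ.toℚᵘ-fromℚᵘ (z ℚᵘ./ 1)

  /1-+ : ∀ a b → (a ℤ.+ b) / 1 ≡ a / 1 + b / 1
  /1-+ a b = ℚ.toℚᵘ-injective (ℚᵘ.≃-trans (toℚᵘ-/1 (a ℤ.+ b)) (ℚᵘ.≃-sym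
    (ℚᵘ.≃-trans (ℚ.toℚᵘ-homo-+ (a / 1) (b / 1)) (ℚᵘ.≃-trans
      (ℚᵘ.+-cong (toℚᵘ-/1 a) (toℚᵘ-/1 b))
      (ℚᵘ.*≡* (cong (ℤ._* + 1) (cong₂ ℤ._+_ (ℤ.*-identityʳ a) (ℤ.*-identityʳ b))))))))

  /1-* : ∀ a b → (a ℤ.* b) / 1 ≡ a / 1 * (b / 1)
  /1-* a b = ℚ.toℚᵘ-injective (ℚᵘ.≃-trans (toℚᵘ-/1 (a ℤ.* b)) (ℚᵘ.≃-sym
    (ℚᵘ.≃-trans (ℚ.toℚᵘ-homo-* (a / 1) (b / 1)) (ℚᵘ.*-cong (toℚᵘ-/1 a) (toℚᵘ-/1 b)))))

  suc*1/suc! : ∀ n → (+ suc n / 1) * 1/ suc n ! ≡ 1/ n !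
  suc*1/suc! n = begin
    s * x                      ≡⟨ ℚ.*-identityʳ (s * x) ⟨
    s * x * 1ℚ                 ≡⟨ cong (s * x *_) (n!*1/n!≡1 n) ⟨
    s * x * (n! * y)           ≡⟨ regroup s x n! y ⟩
    s * n! * x * y             ≡⟨ cong (λ t → t * x * y) (trans (sym (/1-* (+ suc n) (+ (n !)))) (cong (_/ 1) (sym (ℤ.pos-* (suc n) (n !))))) ⟩
    (+ (suc n !) / 1) * x * y  ≡⟨ cong (_* y) (n!*1/n!≡1 (suc n)) ⟩
    1ℚ * y                     ≡⟨ ℚ.*-identityˡ y ⟩
    y                          ∎
    where
    s  = + suc n / 1
    n! = + (n !) / 1
    x  = 1/ suc n !
    y  = 1/ n !
    regroup : ∀ s x n y → s * x * (n * y) ≡ s * n * x * y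
    regroup = solve 4 (λ s x n y → s :* x :* (n :* y) := s :* n :* x :* y) refl

  ⊛-congʳ : ∀ f {g g′} → (∀ k → g k ≡ g′ k) → ∀ n → (f ⊛ g) n ≡ (f ⊛ g′) n
  ⊛-congʳ f g≡ n = sum-cong-≗ {suc n} (λ i → cong (f (n ∸ toℕ i) *_) (g≡ (toℕ i)))

  -- The definition of `_⊛_` peels off `g 0`; this mirror image peels off `f 0` and is the content
  -- of commutativity.
  ⊛-sucˡ : ∀ f g n → (f ⊛ g) (suc n) ≡ f 0 * g (suc n) + (f ∘ suc ⊛ g) n
  ⊛-sucˡ f g zero    = swap (f 1 * g 0) (f 0 * g 1)
    where
    swap : ∀ a b → a + (b + 0ℚ) ≡ b + (a + 0ℚ)
    swap = solve 2 (λ a b → a :+ (b :+ con 0ℚ) := b :+ (a :+ con 0ℚ)) refl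
  ⊛-sucˡ f g (suc n) = trans (cong (λ t → f (2 ℕ.+ n) * g 0 + t) (⊛-sucˡ f (g ∘ suc) n))
    (swap (f (2 ℕ.+ n) * g 0) (f 0 * g (2 ℕ.+ n)) _)
    where
    swap : ∀ a b c → a + (b + c) ≡ b + (a + c)
    swap = solve 3 (λ a b c → a :+ (b :+ c) := b :+ (a :+ c)) refl

  ⊛-comm : ∀ f g n → (f ⊛ g) n ≡ (g ⊛ f) n
  ⊛-comm f g zero    = cong (_+ 0ℚ) (ℚ.*-comm (f 0) (g 0))
  ⊛-comm f g (suc n) = trans (cong₂ _+_ (ℚ.*-comm (f (suc n)) (g 0)) (⊛-comm f (g ∘ suc) n)) (sym (⊛-sucˡ g f n))

  ⊛-linearʳ : ∀ a b f g h n → (f ⊛ (λ k → a * g k + b * h k)) n ≡ a * (f ⊛ g) n + b * (f ⊛ h) n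
  ⊛-linearʳ a b f g h zero    = distribute a b (f 0) (g 0) (h 0)
    where
    distribute : ∀ a b f g h → f * (a * g + b * h) + 0ℚ ≡ a * (f * g + 0ℚ) + b * (f * h + 0ℚ)
    distribute = solve 5 (λ a b f g h → f :* (a :* g :+ b :* h) :+ con 0ℚ
      := a :* (f :* g :+ con 0ℚ) :+ b :* (f :* h :+ con 0ℚ)) refl
  ⊛-linearʳ a b f g h (suc n) = trans
    (cong (λ t → f (suc n) * (a * g 0 + b * h 0) + t) (⊛-linearʳ a b f (g ∘ suc) (h ∘ suc) n))
    (distribute a b (f (suc n)) (g 0) (h 0) _ _)
    where
    distribute : ∀ a b f g h x y → f * (a * g + b * h) + (a * x + b * y) ≡ a * (f * g + x) + b * (f * h + y)
    distribute = solve 7 (λ a b f g h x y → f :* (a :* g :+ b :* h) :+ (a :* x :+ b :* y)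
      := a :* (f :* g :+ x) :+ b :* (f :* h :+ y)) refl

  ⊛-linearˡ : ∀ a b f g h n → ((λ k → a * f k + b * g k) ⊛ h) n ≡ a * (f ⊛ h) n + b * (g ⊛ h) n
  ⊛-linearˡ a b f g h n = trans (⊛-comm (λ k → a * f k + b * g k) h n) (trans (⊛-linearʳ a b h f g n)
    (cong₂ (λ x y → a * x + b * y) (⊛-comm h f n) (⊛-comm h g n)))

  ⊛-assoc : ∀ f g h n → ((f ⊛ g) ⊛ h) n ≡ (f ⊛ (g ⊛ h)) n
  ⊛-assoc f g h zero    = assoc (f 0) (g 0) (h 0)
    where
    assoc : ∀ f g h → (f * g + 0ℚ) * h + 0ℚ ≡ f * (g * h + 0ℚ) + 0ℚ
    assoc = solve 3 (λ f g h → (f :* g :+ con 0ℚ) :* h :+ con 0ℚ := f :* (g :* h :+ con 0ℚ) :+ con 0ℚ) refl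
  ⊛-assoc f g h (suc n) = begin
    (f (suc n) * g 0 + (f ⊛ g ∘ suc) n) * h 0 + ((f ⊛ g) ⊛ h ∘ suc) n
      ≡⟨ cong (λ t → (f (suc n) * g 0 + (f ⊛ g ∘ suc) n) * h 0 + t) (⊛-assoc f g (h ∘ suc) n) ⟩
    (f (suc n) * g 0 + (f ⊛ g ∘ suc) n) * h 0 + (f ⊛ (g ⊛ h ∘ suc)) n
      ≡⟨ regroup (f (suc n)) (g 0) (h 0) ((f ⊛ g ∘ suc) n) ((f ⊛ (g ⊛ h ∘ suc)) n) ⟩
    f (suc n) * (g 0 * h 0 + 0ℚ) + (h 0 * (f ⊛ g ∘ suc) n + 1ℚ * (f ⊛ (g ⊛ h ∘ suc)) n)
      ≡⟨ cong (λ t → f (suc n) * (g 0 * h 0 + 0ℚ) + t) (⊛-linearʳ (h 0) 1ℚ f (g ∘ suc) (g ⊛ h ∘ suc) n) ⟨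
    f (suc n) * (g 0 * h 0 + 0ℚ) + (f ⊛ (λ k → h 0 * g (suc k) + 1ℚ * (g ⊛ h ∘ suc) k)) n
      ≡⟨ cong (λ t → f (suc n) * (g 0 * h 0 + 0ℚ) + t) (⊛-congʳ f shifted n) ⟩
    f (suc n) * (g 0 * h 0 + 0ℚ) + (f ⊛ (g ⊛ h) ∘ suc) n ∎
    where
    regroup : ∀ f g h x y → (f * g + x) * h + y ≡ f * (g * h + 0ℚ) + (h * x + 1ℚ * y)
    regroup = solve 5 (λ f g h x y → (f :* g :+ x) :* h :+ y := f :* (g :* h :+ con 0ℚ) :+ (h :* x :+ con 1ℚ :* y)) refl
    shifted : ∀ k → h 0 * g (suc k) + 1ℚ * (g ⊛ h ∘ suc) k ≡ (g ⊛ h) (suc k)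
    shifted k = cong₂ _+_ (ℚ.*-comm (h 0) (g (suc k))) (ℚ.*-identityˡ ((g ⊛ h ∘ suc) k))

  -- The formal derivative d/dx, used to identify products of exponentials by a differential
  -- equation.
  D : Series → Series
  D f n = (+ suc n / 1) * f (suc n)

  suc/1 : ∀ n → + suc n / 1 ≡ 1ℚ + + n / 1
  suc/1 n = /1-+ (+ 1) (+ n)

  leibniz : ∀ f g n → D (f ⊛ g) n ≡ (D f ⊛ g) n + (f ⊛ D g) n
  leibniz f g zero    = identity (f 0) (f 1) (g 0) (g 1)
    where
    identity : ∀ f₀ f₁ g₀ g₁ → 1ℚ * (f₁ * g₀ + (f₀ * g₁ + 0ℚ)) ≡ (1ℚ * f₁ * g₀ + 0ℚ) + (f₀ * (1ℚ * g₁) + 0ℚ)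
    identity = solve 4 (λ f₀ f₁ g₀ g₁ → con 1ℚ :* (f₁ :* g₀ :+ (f₀ :* g₁ :+ con 0ℚ))
      := (con 1ℚ :* f₁ :* g₀ :+ con 0ℚ) :+ (f₀ :* (con 1ℚ :* g₁) :+ con 0ℚ)) refl
  leibniz f g (suc n) = begin
    s * (f (2 ℕ.+ n) * g 0 + x)
      ≡⟨ trans (ℚ.*-distribˡ-+ s (f (2 ℕ.+ n) * g 0) x) (cong₂ _+_ (sym (ℚ.*-assoc s (f (2 ℕ.+ n)) (g 0))) (trans (cong (_* x) (suc/1 (suc n))) (unfold x (+ suc n / 1)))) ⟩
    s * f (2 ℕ.+ n) * g 0 + (x + D (f ⊛ g ∘ suc) n)
      ≡⟨ cong (λ t → s * f (2 ℕ.+ n) * g 0 + (x + t)) (leibniz f (g ∘ suc) n) ⟩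
    s * f (2 ℕ.+ n) * g 0 + (f (suc n) * g 1 + (f ⊛ g ∘ suc ∘ suc) n + ((D f ⊛ g ∘ suc) n + (f ⊛ D (g ∘ suc)) n))
      ≡⟨ regroup (s * f (2 ℕ.+ n) * g 0) (f (suc n)) (g 1) ((f ⊛ g ∘ suc ∘ suc) n) ((D f ⊛ g ∘ suc) n) ((f ⊛ D (g ∘ suc)) n) ⟩
    (D f ⊛ g) (suc n) + (f (suc n) * (1ℚ * g 1) + (1ℚ * (f ⊛ g ∘ suc ∘ suc) n + 1ℚ * (f ⊛ D (g ∘ suc)) n))
      ≡⟨ cong (λ t → (D f ⊛ g) (suc n) + (f (suc n) * (1ℚ * g 1) + t))
           (trans (sym (⊛-linearʳ 1ℚ 1ℚ f (g ∘ suc ∘ suc) (D (g ∘ suc)) n)) (⊛-congʳ f shifted n)) ⟩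
    (D f ⊛ g) (suc n) + (f ⊛ D g) (suc n) ∎
    where
    s = + (2 ℕ.+ n) / 1
    x = (f ⊛ g ∘ suc) (suc n)
    unfold : ∀ x s → (1ℚ + s) * x ≡ x + s * x
    unfold = solve 2 (λ x s → (con 1ℚ :+ s) :* x := x :+ s :* x) refl
    regroup : ∀ a f g x y z → a + (f * g + x + (y + z)) ≡ (a + y) + (f * (1ℚ * g) + (1ℚ * x + 1ℚ * z))
    regroup = solve 6 (λ a f g x y z → a :+ (f :* g :+ x :+ (y :+ z))
      := (a :+ y) :+ (f :* (con 1ℚ :* g) :+ (con 1ℚ :* x :+ con 1ℚ :* z))) refl
    shifted : ∀ k → 1ℚ * g (2 ℕ.+ k) + 1ℚ * D (g ∘ suc) k ≡ D g (suc k)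
    shifted k = trans (factor (g (2 ℕ.+ k)) (+ suc k / 1)) (cong (_* g (2 ℕ.+ k)) (sym (suc/1 (suc k))))
      where
      factor : ∀ g s → 1ℚ * g + 1ℚ * (s * g) ≡ (1ℚ + s) * g
      factor = solve 2 (λ g s → con 1ℚ :* g :+ con 1ℚ :* (s :* g) := (con 1ℚ :+ s) :* g) refl

  suc/1-cancel : ∀ n {x y} → (+ suc n / 1) * x ≡ (+ suc n / 1) * y → x ≡ y
  suc/1-cancel n {x} {y} sx≡sy = trans (sym (undo x)) (trans (cong ((+ 1 / suc n) *_) sx≡sy) (undo y))
    where
    undo : ∀ z → (+ 1 / suc n) * ((+ suc n / 1) * z) ≡ z
    undo z = trans (sym (ℚ.*-assoc (+ 1 / suc n) (+ suc n / 1) z)) (trans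
      (cong (_* z) (trans (ℚ.*-comm (+ 1 / suc n) (+ suc n / 1)) (m*1/m≡1 (suc n)))) (ℚ.*-identityˡ z))

  D-exp : ∀ t n → D (exp t) n ≡ t * exp t n
  D-exp t n = trans (regroup (+ suc n / 1) t (t ^ n) (1/ suc n !)) (cong (λ x → t * (t ^ n * x)) (suc*1/suc! n))
    where
    regroup : ∀ s t x y → s * (t * x * y) ≡ t * (x * (s * y))
    regroup = solve 4 (λ s t x y → s :* (t :* x :* y) := t :* (x :* (s :* y))) refl

  ⊛-scaleʳ : ∀ c f g n → (f ⊛ (λ k → c * g k)) n ≡ c * (f ⊛ g) n
  ⊛-scaleʳ c f g n = trans (⊛-congʳ f (λ k → pad c (g k)) n)
    (trans (⊛-linearʳ c 0ℚ f g g n) (sym (pad c ((f ⊛ g) n))))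
    where
    pad : ∀ c x → c * x ≡ c * x + 0ℚ * x
    pad = solve 2 (λ c x → c :* x := c :* x :+ con 0ℚ :* x) refl

  ⊛-congˡ : ∀ {f f′} g → (∀ k → f k ≡ f′ k) → ∀ n → (f ⊛ g) n ≡ (f′ ⊛ g) n
  ⊛-congˡ g f≡ n = sum-cong-≗ {suc n} (λ i → cong (_* g (toℕ i)) (f≡ (n ∸ toℕ i)))

  -- Both sides have constant term 1 and satisfy y' = (s + t) y, which determines every further
  -- coefficient over ℚ.
  exp-⊛ : ∀ s t n → (exp s ⊛ exp t) n ≡ exp (s + t) n
  exp-⊛ s t zero    = refl
  exp-⊛ s t (suc n) = suc/1-cancel n (begin
    D (exp s ⊛ exp t) n
      ≡⟨ leibniz (exp s) (exp t) n ⟩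
    (D (exp s) ⊛ exp t) n + (exp s ⊛ D (exp t)) n
      ≡⟨ cong₂ _+_ (trans (⊛-congˡ (exp t) (D-exp s) n) (trans (⊛-comm (λ k → s * exp s k) (exp t) n)
           (trans (⊛-scaleʳ s (exp t) (exp s) n) (cong (s *_) (⊛-comm (exp t) (exp s) n)))))
         (trans (⊛-congʳ (exp s) (D-exp t) n) (⊛-scaleʳ t (exp s) (exp t) n)) ⟩
    s * (exp s ⊛ exp t) n + t * (exp s ⊛ exp t) n
      ≡⟨ ℚ.*-distribʳ-+ ((exp s ⊛ exp t) n) s t ⟨
    (s + t) * (exp s ⊛ exp t) n
      ≡⟨ cong ((s + t) *_) (exp-⊛ s t n) ⟩
    (s + t) * exp (s + t) n
      ≡⟨ D-exp (s + t) n ⟨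
    D (exp (s + t)) n ∎)

  exp0-suc : ∀ n → exp 0ℚ (suc n) ≡ 0ℚ
  exp0-suc n = trans (cong (_* 1/ suc n !) (ℚ.*-zeroˡ (0ℚ ^ n))) (ℚ.*-zeroˡ (1/ suc n !))

  -- `exp 0ℚ` is the constant series 1, so eˣ - 1 becomes a combination of exponentials to which
  -- `exp-⊛` applies.
  expm1≡ : ∀ n → expm1 n ≡ 1ℚ * exp 1ℚ n + -1ℚ * exp 0ℚ n
  expm1≡ zero    = refl
  expm1≡ (suc n) = trans (pad (exp 1ℚ (suc n))) (cong (λ t → 1ℚ * exp 1ℚ (suc n) + -1ℚ * t) (sym (exp0-suc n)))
    where
    pad : ∀ x → x ≡ 1ℚ * x + -1ℚ * 0ℚ
    pad = solve 1 (λ x → x := con 1ℚ :* x :+ con -1ℚ :* con 0ℚ) refl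

  x·-⊛ : ∀ f g n → (x· f ⊛ g) n ≡ (f ⊛ x· g) n
  x·-⊛ f g zero    = cong (_+ 0ℚ) (trans (ℚ.*-zeroˡ (g 0)) (sym (ℚ.*-zeroʳ (f 0))))
  x·-⊛ f g (suc n) = trans (⊛-sucˡ (x· f) g n)
    (cong (_+ (f ⊛ g) n) (trans (ℚ.*-zeroˡ (g (suc n))) (sym (ℚ.*-zeroʳ (f (suc n))))))

  x·[expm1]/x : ∀ n → (x· [expm1]/x) n ≡ expm1 n
  x·[expm1]/x zero    = refl
  x·[expm1]/x (suc n) = refl

  -- Reduces every identity between Bernoulli series to a check after multiplication by (eˣ - 1)/x.
  quotient-unique : ∀ f g r → g 0 ≡ 1ℚ → (∀ n → (r ⊛ g) n ≡ f n) → ∀ n → quotient f g n ≡ r n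
  quotient-unique f g r g₀≡1 r⊛g≡f n = entry (suc n) Fin.zero
    where
    entry : ∀ n (i : Fin n) → quotients f g n i ≡ r (n ∸ suc (toℕ i))
    entry (suc n) Fin.zero    = begin
      f n - ∑[ i < n ] (quotients f g n i * g (suc (toℕ i)))
        ≡⟨ cong (λ s → f n - s) (sum-cong-≗ {n} (λ i → cong (_* g (suc (toℕ i))) (entry n i))) ⟩
      f n - s
        ≡⟨ cong (_- s) (r⊛g≡f n) ⟨
      r n * g 0 + s - s
        ≡⟨ cong (λ t → r n * t + s - s) g₀≡1 ⟩
      r n * 1ℚ + s - s
        ≡⟨ cancel (r n) s ⟩
      r n ∎
      where
      s = ∑[ i < n ] (r (n ∸ suc (toℕ i)) * g (suc (toℕ i)))
      cancel : ∀ r s → r * 1ℚ + s - s ≡ r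
      cancel = solve 2 (λ r s → r :* con 1ℚ :+ s :- s := r) refl
    entry (suc n) (Fin.suc i) = entry n i

  -- q t n = Bₙ(t)/n!
  q : ℚ → Series
  q t = quotient (exp t) [expm1]/x

  -- After multiplication by (eˣ - 1)/x, the added x e^{tx} contributes e^{tx}(eˣ - 1), which turns
  -- e^{tx} into e^{(t+1)x}.
  q-suc : ∀ t n → q (t + 1ℚ) n ≡ q t n + (x· exp t) n
  q-suc t n = trans (quotient-unique (exp (t + 1ℚ)) [expm1]/x (λ k → 1ℚ * q t k + 1ℚ * (x· exp t) k) refl solves n)
    (cong₂ _+_ (ℚ.*-identityˡ (q t n)) (ℚ.*-identityˡ ((x· exp t) n)))
    where
    regroup : ∀ a b → 1ℚ * a + 1ℚ * (1ℚ * b + -1ℚ * a) ≡ b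
    regroup = solve 2 (λ a b → con 1ℚ :* a :+ con 1ℚ :* (con 1ℚ :* b :+ con -1ℚ :* a) := b) refl
    solves : ∀ m → ((λ k → 1ℚ * q t k + 1ℚ * (x· exp t) k) ⊛ [expm1]/x) m ≡ exp (t + 1ℚ) m
    solves m = begin
      ((λ k → 1ℚ * q t k + 1ℚ * (x· exp t) k) ⊛ [expm1]/x) m
        ≡⟨ ⊛-linearˡ 1ℚ 1ℚ (q t) (x· exp t) [expm1]/x m ⟩
      1ℚ * (q t ⊛ [expm1]/x) m + 1ℚ * (x· exp t ⊛ [expm1]/x) m
        ≡⟨ cong₂ (λ u v → 1ℚ * u + 1ℚ * v) (quotient-⊛ (exp t) [expm1]/x refl m)
             (trans (x·-⊛ (exp t) [expm1]/x m) (⊛-congʳ (exp t) (λ k → trans (x·[expm1]/x k) (expm1≡ k)) m)) ⟩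
      1ℚ * exp t m + 1ℚ * (exp t ⊛ (λ k → 1ℚ * exp 1ℚ k + -1ℚ * exp 0ℚ k)) m
        ≡⟨ cong (λ u → 1ℚ * exp t m + 1ℚ * u) (trans (⊛-linearʳ 1ℚ -1ℚ (exp t) (exp 1ℚ) (exp 0ℚ) m)
             (cong₂ (λ u v → 1ℚ * u + -1ℚ * v) (exp-⊛ t 1ℚ m)
               (trans (exp-⊛ t 0ℚ m) (cong (λ z → exp z m) (ℚ.+-identityʳ t))))) ⟩
      1ℚ * exp t m + 1ℚ * (1ℚ * exp (t + 1ℚ) m + -1ℚ * exp t m)
        ≡⟨ regroup (exp t m) (exp (t + 1ℚ) m) ⟩
      exp (t + 1ℚ) m ∎

  -- The substitution x ↦ -x.
  σ : Series → Series
  σ f n = -1ℚ ^ n * f n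

  σ-⊛ : ∀ f g n → (σ f ⊛ σ g) n ≡ σ (f ⊛ g) n
  σ-⊛ f g zero    = identity (f 0) (g 0)
    where
    identity : ∀ a b → 1ℚ * a * (1ℚ * b) + 0ℚ ≡ 1ℚ * (a * b + 0ℚ)
    identity = solve 2 (λ a b → con 1ℚ :* a :* (con 1ℚ :* b) :+ con 0ℚ := con 1ℚ :* (a :* b :+ con 0ℚ)) refl
  σ-⊛ f g (suc n) = begin
    σ f (suc n) * (1ℚ * g 0) + (σ f ⊛ σ g ∘ suc) n
      ≡⟨ cong (λ t → σ f (suc n) * (1ℚ * g 0) + t) (trans
           (⊛-congʳ (σ f) (λ k → ℚ.*-assoc -1ℚ (-1ℚ ^ k) (g (suc k))) n)
           (trans (⊛-scaleʳ -1ℚ (σ f) (σ (g ∘ suc)) n) (cong (-1ℚ *_) (σ-⊛ f (g ∘ suc) n)))) ⟩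
    -1ℚ * -1ℚ ^ n * f (suc n) * (1ℚ * g 0) + -1ℚ * (-1ℚ ^ n * (f ⊛ g ∘ suc) n)
      ≡⟨ factor -1ℚ (-1ℚ ^ n) (f (suc n)) (g 0) ((f ⊛ g ∘ suc) n) ⟩
    σ (f ⊛ g) (suc n) ∎
    where
    factor : ∀ m s f g x → m * s * f * (1ℚ * g) + m * (s * x) ≡ m * s * (f * g + x)
    factor = solve 5 (λ m s f g x → m :* s :* f :* (con 1ℚ :* g) :+ m :* (s :* x) := m :* s :* (f :* g :+ x)) refl

  ^-distrib-*ℚ : ∀ a b n → (a * b) ^ n ≡ a ^ n * b ^ n
  ^-distrib-*ℚ a b zero    = refl
  ^-distrib-*ℚ a b (suc n) = trans (cong (a * b *_) (^-distrib-*ℚ a b n)) (interchange a b (a ^ n) (b ^ n))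
    where
    interchange : ∀ a b c d → a * b * (c * d) ≡ a * c * (b * d)
    interchange = solve 4 (λ a b c d → a :* b :* (c :* d) := a :* c :* (b :* d)) refl

  σ-exp : ∀ t n → σ (exp t) n ≡ exp (-1ℚ * t) n
  σ-exp t n = trans (sym (ℚ.*-assoc (-1ℚ ^ n) (t ^ n) (1/ n !))) (cong (_* 1/ n !) (sym (^-distrib-*ℚ -1ℚ t n)))

  [expm1]/x-σ : ∀ n → (exp 1ℚ ⊛ σ [expm1]/x) n ≡ [expm1]/x n
  [expm1]/x-σ n = begin
    (exp 1ℚ ⊛ σ [expm1]/x) n
      ≡⟨ pad (exp 1ℚ (suc n)) ((exp 1ℚ ⊛ σ [expm1]/x) n) ⟩
    (exp 1ℚ ⊛ x· σ [expm1]/x) (suc n)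
      ≡⟨ ⊛-congʳ (exp 1ℚ) x·σ (suc n) ⟩
    (exp 1ℚ ⊛ (λ k → 1ℚ * exp 0ℚ k + -1ℚ * exp -1ℚ k)) (suc n)
      ≡⟨ ⊛-linearʳ 1ℚ -1ℚ (exp 1ℚ) (exp 0ℚ) (exp -1ℚ) (suc n) ⟩
    1ℚ * (exp 1ℚ ⊛ exp 0ℚ) (suc n) + -1ℚ * (exp 1ℚ ⊛ exp -1ℚ) (suc n)
      ≡⟨ cong₂ (λ u v → 1ℚ * u + -1ℚ * v) (exp-⊛ 1ℚ 0ℚ (suc n)) (trans (exp-⊛ 1ℚ -1ℚ (suc n)) (exp0-suc n)) ⟩
    1ℚ * exp 1ℚ (suc n) + -1ℚ * 0ℚ
      ≡⟨ unpad (exp 1ℚ (suc n)) ⟩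
    exp 1ℚ (suc n) ∎
    where
    pad : ∀ a b → b ≡ a * 0ℚ + b
    pad = solve 2 (λ a b → b := a :* con 0ℚ :+ b) refl
    unpad : ∀ a → 1ℚ * a + -1ℚ * 0ℚ ≡ a
    unpad = solve 1 (λ a → con 1ℚ :* a :+ con -1ℚ :* con 0ℚ := a) refl
    negate : ∀ s e → s * e ≡ 1ℚ * 0ℚ + -1ℚ * (-1ℚ * s * e)
    negate = solve 2 (λ s e → s :* e := con 1ℚ :* con 0ℚ :+ con -1ℚ :* (con -1ℚ :* s :* e)) refl
    x·σ : ∀ k → (x· σ [expm1]/x) k ≡ 1ℚ * exp 0ℚ k + -1ℚ * exp -1ℚ k
    x·σ zero    = refl
    x·σ (suc k) = trans (negate (-1ℚ ^ k) (exp 1ℚ (suc k)))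
      (cong₂ (λ u v → 1ℚ * u + -1ℚ * v) (sym (exp0-suc k)) (σ-exp 1ℚ (suc k)))

  -- With E = (eˣ - 1)/x one has E(x) = E(-x) eˣ, so the reflected series times E is (q(0) E)(-x) eˣ
  -- = eˣ.
  q-reflect : ∀ n → q 1ℚ n ≡ σ (q 0ℚ) n
  q-reflect = quotient-unique (exp 1ℚ) [expm1]/x (σ (q 0ℚ)) refl solves
    where
    solves : ∀ m → (σ (q 0ℚ) ⊛ [expm1]/x) m ≡ exp 1ℚ m
    solves m = begin
      (σ (q 0ℚ) ⊛ [expm1]/x) m
        ≡⟨ ⊛-congʳ (σ (q 0ℚ)) (λ k → trans (sym ([expm1]/x-σ k)) (⊛-comm (exp 1ℚ) (σ [expm1]/x) k)) m ⟩
      (σ (q 0ℚ) ⊛ (σ [expm1]/x ⊛ exp 1ℚ)) m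
        ≡⟨ ⊛-assoc (σ (q 0ℚ)) (σ [expm1]/x) (exp 1ℚ) m ⟨
      ((σ (q 0ℚ) ⊛ σ [expm1]/x) ⊛ exp 1ℚ) m
        ≡⟨ ⊛-congˡ (exp 1ℚ) (λ k → trans (σ-⊛ (q 0ℚ) [expm1]/x k)
             (trans (cong (-1ℚ ^ k *_) (quotient-⊛ (exp 0ℚ) [expm1]/x refl k)) (σ-exp 0ℚ k))) m ⟩
      (exp 0ℚ ⊛ exp 1ℚ) m
        ≡⟨ exp-⊛ 0ℚ 1ℚ m ⟩
      exp 1ℚ m ∎

  -1ℚ^2k : ∀ k → -1ℚ ^ (k ℕ.+ k) ≡ 1ℚ
  -1ℚ^2k zero    = refl
  -1ℚ^2k (suc k) = trans (cong (λ e → -1ℚ * -1ℚ ^ e) (ℕ.+-suc k k))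
    (trans (identity (-1ℚ ^ (k ℕ.+ k))) (-1ℚ^2k k))
    where
    identity : ∀ x → -1ℚ * (-1ℚ * x) ≡ x
    identity = solve 1 (λ x → con -1ℚ :* (con -1ℚ :* x) := x) refl

  -- The value at 1 equals the value at 0 by `q-suc` and its negative by reflection. The index
  -- starts at 3: for index 1 the increment `exp 0ℚ 0` is 1 and not 0.
  q-odd : ∀ k → q 0ℚ (3 ℕ.+ (k ℕ.+ k)) ≡ 0ℚ
  q-odd k = halve (trans (sym (q-suc′ (2 ℕ.+ (k ℕ.+ k)))) (trans (q-reflect n) (cong (λ s → -1ℚ * (-1ℚ * (-1ℚ * s)) * q 0ℚ n) (-1ℚ^2k k))))
    where
    n = 3 ℕ.+ (k ℕ.+ k)
    q-suc′ : ∀ j → q 1ℚ (suc j) ≡ q 0ℚ (suc j) + exp 0ℚ j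
    q-suc′ j = q-suc 0ℚ (suc j)
    halve : ∀ {x} → x + exp 0ℚ (2 ℕ.+ (k ℕ.+ k)) ≡ -1ℚ * (-1ℚ * (-1ℚ * 1ℚ)) * x → x ≡ 0ℚ
    halve {x} e = trans (split x (exp 0ℚ (2 ℕ.+ (k ℕ.+ k)))) (trans
      (cong (λ t → ½ * (t + x - exp 0ℚ (2 ℕ.+ (k ℕ.+ k)))) e)
      (trans (cong (λ t → ½ * (-1ℚ * (-1ℚ * (-1ℚ * 1ℚ)) * x + x - t)) (exp0-suc (1 ℕ.+ (k ℕ.+ k)))) (vanish x)))
      where
      split : ∀ x e → x ≡ ½ * (x + e + x - e)
      split = solve 2 (λ x e → x := con ½ :* (x :+ e :+ x :- e)) refl
      vanish : ∀ x → ½ * (-1ℚ * (-1ℚ * (-1ℚ * 1ℚ)) * x + x - 0ℚ) ≡ 0ℚ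
      vanish = solve 1 (λ x → con ½ :* (con -1ℚ :* (con -1ℚ :* (con -1ℚ :* con 1ℚ)) :* x :+ x :- con 0ℚ) := con 0ℚ) refl

-- Congruences of integers modulo p = 2h + 1

module Residues (h : ℕ) (prime : Prime (suc (h ℕ.+ h))) (2≤h : 2 ≤ h) where
  open import Data.Integer.Base using (_+_; _*_; _-_; -_; _^_)
  open IntegerSums

  p : ℕ
  p = suc (h ℕ.+ h)

  infix 4 _≋_

  -- A record, so that both sides can be inferred from a proof. The quotient is kept as data because
  -- the Fermat quotient is later assembled from such witnesses.
  record _≋_ (a b : ℤ) : Set where
    constructor mk≋
    field
      quotient : ℤ
      difference : a - b ≡ + p * quotient

  -- The last argument is an identity of commutative rings, left to the solver.
  linear₁ : ∀ {a b l r} c → l ≋ r → a - b ≡ c * (l - r) → a ≋ b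
  linear₁ c (mk≋ q e) a-b = mk≋ (c * q) (trans a-b (trans (cong (c *_) e) (swap c (+ p) q)))
    where
    swap : ∀ c p q → c * (p * q) ≡ p * (c * q)
    swap = solve-∀

  linear₂ : ∀ {a b l₁ r₁ l₂ r₂} c₁ c₂ → l₁ ≋ r₁ → l₂ ≋ r₂ →
    a - b ≡ c₁ * (l₁ - r₁) + c₂ * (l₂ - r₂) → a ≋ b
  linear₂ c₁ c₂ (mk≋ q₁ e₁) (mk≋ q₂ e₂) a-b = mk≋ (c₁ * q₁ + c₂ * q₂)
    (trans a-b (trans (cong₂ (λ u v → c₁ * u + c₂ * v) e₁ e₂) (factor c₁ c₂ (+ p) q₁ q₂)))
    where
    factor : ∀ c₁ c₂ p q₁ q₂ → c₁ * (p * q₁) + c₂ * (p * q₂) ≡ p * (c₁ * q₁ + c₂ * q₂)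
    factor = solve-∀

  linear₃ : ∀ {a b l₁ r₁ l₂ r₂ l₃ r₃} c₁ c₂ c₃ → l₁ ≋ r₁ → l₂ ≋ r₂ → l₃ ≋ r₃ →
    a - b ≡ c₁ * (l₁ - r₁) + c₂ * (l₂ - r₂) + c₃ * (l₃ - r₃) → a ≋ b
  linear₃ c₁ c₂ c₃ (mk≋ q₁ e₁) (mk≋ q₂ e₂) (mk≋ q₃ e₃) a-b = mk≋ (c₁ * q₁ + c₂ * q₂ + c₃ * q₃)
    (trans a-b (trans (cong₂ _+_ (cong₂ (λ u v → c₁ * u + c₂ * v) e₁ e₂) (cong (c₃ *_) e₃))
                      (factor c₁ c₂ c₃ (+ p) q₁ q₂ q₃)))
    where
    factor : ∀ c₁ c₂ c₃ p q₁ q₂ q₃ →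
      c₁ * (p * q₁) + c₂ * (p * q₂) + c₃ * (p * q₃) ≡ p * (c₁ * q₁ + c₂ * q₂ + c₃ * q₃)
    factor = solve-∀

  ≡⇒≋ : ∀ {a b} → a ≡ b → a ≋ b
  ≡⇒≋ {a} refl = mk≋ 0ℤ (trans (ℤ.+-inverseʳ a) (sym (ℤ.*-zeroʳ (+ p))))

  ≋-refl : ∀ {a} → a ≋ a
  ≋-refl = ≡⇒≋ refl

  ≋-sym : ∀ {a b} → a ≋ b → b ≋ a
  ≋-sym {a} {b} a≋b = linear₁ -1ℤ a≋b (identity a b)
    where
    identity : ∀ a b → b - a ≡ -1ℤ * (a - b)
    identity = solve-∀

  ≋-trans : ∀ {a b c} → a ≋ b → b ≋ c → a ≋ c
  ≋-trans {a} {b} {c} a≋b b≋c = linear₂ 1ℤ 1ℤ a≋b b≋c (identity a b c)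
    where
    identity : ∀ a b c → a - c ≡ 1ℤ * (a - b) + 1ℤ * (b - c)
    identity = solve-∀

  infix  1 begin_
  infixr 2 step-≡ step-≡˘ step-≋ step-≋˘
  infix  3 _∎

  begin_ : ∀ {a b} → a ≋ b → a ≋ b
  begin a≋b = a≋b

  step-≡ : ∀ a {b c} → b ≋ c → a ≡ b → a ≋ c
  step-≡ a b≋c refl = b≋c

  step-≡˘ : ∀ a {b c} → b ≋ c → b ≡ a → a ≋ c
  step-≡˘ a b≋c refl = b≋c

  step-≋ : ∀ a {b c} → b ≋ c → a ≋ b → a ≋ c
  step-≋ a b≋c a≋b = ≋-trans a≋b b≋c

  step-≋˘ : ∀ a {b c} → b ≋ c → b ≋ a → a ≋ c
  step-≋˘ a b≋c b≋a = ≋-trans (≋-sym b≋a) b≋c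

  _∎ : ∀ a → a ≋ a
  a ∎ = ≋-refl

  syntax step-≡  a b≋c a≡b = a ≡⟨ a≡b ⟩ b≋c
  syntax step-≡˘ a b≋c b≡a = a ≡⟨ b≡a ⟨ b≋c
  syntax step-≋  a b≋c a≋b = a ≋⟨ a≋b ⟩ b≋c
  syntax step-≋˘ a b≋c b≋a = a ≋⟨ b≋a ⟨ b≋c

  +-cong : ∀ {a b c d} → a ≋ b → c ≋ d → a + c ≋ b + d
  +-cong {a} {b} {c} {d} a≋b c≋d = linear₂ 1ℤ 1ℤ a≋b c≋d (identity a b c d)
    where
    identity : ∀ a b c d → a + c - (b + d) ≡ 1ℤ * (a - b) + 1ℤ * (c - d)
    identity = solve-∀

  *-cong : ∀ {a b c d} → a ≋ b → c ≋ d → a * c ≋ b * d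
  *-cong {a} {b} {c} {d} a≋b c≋d = linear₂ c b a≋b c≋d (identity a b c d)
    where
    identity : ∀ a b c d → a * c - b * d ≡ c * (a - b) + b * (c - d)
    identity = solve-∀

  +-congˡ : ∀ c {a b} → a ≋ b → c + a ≋ c + b
  +-congˡ c = +-cong (≋-refl {c})

  +-congʳ : ∀ c {a b} → a ≋ b → a + c ≋ b + c
  +-congʳ c a≋b = +-cong a≋b (≋-refl {c})

  *-congˡ : ∀ c {a b} → a ≋ b → c * a ≋ c * b
  *-congˡ c = *-cong (≋-refl {c})

  *-congʳ : ∀ c {a b} → a ≋ b → a * c ≋ b * c
  *-congʳ c a≋b = *-cong a≋b (≋-refl {c})

  ^-cong : ∀ n {a b} → a ≋ b → a ^ n ≋ b ^ n
  ^-cong zero    a≋b = ≋-refl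
  ^-cong (suc n) a≋b = *-cong a≋b (^-cong n a≋b)

  p≋0 : + p ≋ 0ℤ
  p≋0 = mk≋ 1ℤ (trans (ℤ.+-identityʳ (+ p)) (sym (ℤ.*-identityʳ (+ p))))

  ∑-cong≋ : ∀ n {f g : ℕ → ℤ} → (∀ k → k < n → f k ≋ g k) → ∑ n f ≋ ∑ n g
  ∑-cong≋ zero    f≋g = ≋-refl
  ∑-cong≋ (suc n) f≋g = +-cong (∑-cong≋ n (λ k k<n → f≋g k (ℕ.m<n⇒m<1+n k<n))) (f≋g n ℕ.≤-refl)

  ∑-zero≋ : ∀ n {f : ℕ → ℤ} → (∀ k → k < n → f k ≋ 0ℤ) → ∑ n f ≋ 0ℤ
  ∑-zero≋ n f≋0 = ≋-trans (∑-cong≋ n f≋0) (≡⇒≋ (∑-zero n (λ _ _ → refl)))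

  T-cong≋ : ∀ x n {f g : ℕ → ℤ} → (∀ k → k ≤ n → f k ≋ g k) → T x n f ≋ T x n g
  T-cong≋ x zero    f≋g = f≋g 0 z≤n
  T-cong≋ x (suc n) f≋g = +-cong
    (T-cong≋ x n (λ k k≤n → f≋g k (ℕ.m≤n⇒m≤1+n k≤n)))
    (*-congˡ x (T-cong≋ x n (λ k k≤n → f≋g (suc k) (s≤s k≤n))))

  ≋0⇒∣ : ∀ {z} → z ≋ 0ℤ → p ∣ ∣ z ∣
  ≋0⇒∣ {z} (mk≋ q e) = divides ∣ q ∣
    (trans (cong ∣_∣ (trans (trans (sym (ℤ.+-identityʳ z)) e) (ℤ.*-comm (+ p) q))) (ℤ.abs-* q (+ p)))

  ∣⇒≋ : ∀ {a b} → p ∣ ∣ a - b ∣ → a ≋ b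
  ∣⇒≋ {a} {b} p∣ with Signed.∣ᵤ⇒∣ {+ p} {a - b} p∣
  ... | Signed.divides q e = mk≋ q (trans e (ℤ.*-comm q (+ p)))

  +k≉0 : ∀ {k} → 0 < k → k < p → ¬ (+ k ≋ 0ℤ)
  +k≉0 {suc k} _ k<p k≋0 = ℕ.<⇒≱ k<p (∣⇒≤ (≋0⇒∣ k≋0))

  *-cancelˡ-≉0 : ∀ c {a b} → ¬ (c ≋ 0ℤ) → c * a ≋ c * b → a ≋ b
  *-cancelˡ-≉0 c {a} {b} c≉0 (mk≋ q e)
    with euclidsLemma ∣ c ∣ ∣ a - b ∣ prime
           (subst (p ∣_) (ℤ.abs-* c (a - b)) (≋0⇒∣ {c * (a - b)} (mk≋ q (trans (identity c a b) e))))
    where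
    identity : ∀ c a b → c * (a - b) - 0ℤ ≡ c * a - c * b
    identity = solve-∀
  ... | inj₁ p∣c   = contradiction (∣⇒≋ (subst (λ x → p ∣ ∣ x ∣) (sym (ℤ.+-identityʳ c)) p∣c)) c≉0
  ... | inj₂ p∣a-b = ∣⇒≋ p∣a-b

  *-cancelˡ-< : ∀ {k a b} → 0 < k → k < p → + k * a ≋ + k * b → a ≋ b
  *-cancelˡ-< {k} 0<k k<p = *-cancelˡ-≉0 (+ k) (+k≉0 0<k k<p)

  -- Fermat's little theorem and inverses

  binom-p≋0 : ∀ k → suc k < p → binom p (suc k) ≋ 0ℤ
  binom-p≋0 k k<p = *-cancelˡ-< (s≤s z≤n) k<p (begin
    + suc k * binom p (suc k)    ≡⟨ absorption (h ℕ.+ h) k ⟩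
    + p * binom (h ℕ.+ h) k      ≋⟨ *-congʳ (binom (h ℕ.+ h) k) p≋0 ⟩
    0ℤ * binom (h ℕ.+ h) k       ≡⟨ ℤ.*-zeroʳ (+ suc k) ⟨
    + suc k * 0ℤ                 ∎)

  binom-pred-p : ∀ k → k < p → binom (h ℕ.+ h) k ≋ -1ℤ ^ k
  binom-pred-p zero    _   = ≡⇒≋ (binom-0 (h ℕ.+ h))
  binom-pred-p (suc k) k<p = linear₂ 1ℤ -1ℤ
    (≋-trans (≡⇒≋ (sym (pascal (h ℕ.+ h) k))) (binom-p≋0 k k<p))
    (binom-pred-p k (ℕ.<-trans (ℕ.n<1+n k) k<p))
    (identity (binom (h ℕ.+ h) k) (binom (h ℕ.+ h) (suc k)) (-1ℤ ^ k))
    where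
    identity : ∀ a b s → b - -1ℤ * s ≡ 1ℤ * (a + b - 0ℤ) + -1ℤ * (a - s)
    identity = solve-∀

  fermat-ℕ : ∀ a → (+ a) ^ p ≋ + a
  fermat-ℕ zero    = ≋-refl
  fermat-ℕ (suc a) = begin
    (1ℤ + + a) ^ p
      ≡⟨ T-one (+ a) p ⟨
    T (+ a) p (λ _ → 1ℤ)
      ≡⟨ T-∑ (+ a) p (λ _ → 1ℤ) ⟩
    ∑ p g + g p
      ≡⟨ cong (_+ g p) (∑-front (h ℕ.+ h) g) ⟩
    g 0 + ∑ (h ℕ.+ h) (g ∘ suc) + g p
      ≋⟨ +-congʳ (g p) (+-congˡ (g 0) (∑-zero≋ (h ℕ.+ h) middle)) ⟩
    g 0 + 0ℤ + g p
      ≡⟨ cong₂ (λ u v → u * 1ℤ * 1ℤ + 0ℤ + v * (+ a) ^ p * 1ℤ) (binom-0 p) (binom-n p) ⟩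
    1ℤ + 1ℤ * (+ a) ^ p * 1ℤ
      ≡⟨ cong (λ v → 1ℤ + v) (trans (ℤ.*-identityʳ (1ℤ * (+ a) ^ p)) (ℤ.*-identityˡ ((+ a) ^ p))) ⟩
    1ℤ + (+ a) ^ p
      ≋⟨ +-congˡ 1ℤ (fermat-ℕ a) ⟩
    1ℤ + + a ∎
    where
    g : ℕ → ℤ
    g k = binom p k * (+ a) ^ k * 1ℤ
    middle : ∀ k → k < h ℕ.+ h → g (suc k) ≋ 0ℤ
    middle k k<2h = ≋-trans (*-congʳ 1ℤ (*-congʳ ((+ a) ^ suc k) (binom-p≋0 k (s≤s k<2h)))) (≡⇒≋ refl)

  fermat : ∀ z → z ^ p ≋ z
  fermat z = ≋-trans (^-cong p z≋r) (≋-trans (fermat-ℕ (z %ℕ p)) (≋-sym z≋r))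
    where
    z≋r : z ≋ + (z %ℕ p)
    z≋r = mk≋ (z /ℕ p) (trans (cong (_- + (z %ℕ p)) (a≡a%ℕn+[a/ℕn]*n z p))
                              (identity (+ (z %ℕ p)) (z /ℕ p) (+ p)))
      where
      identity : ∀ r q p → r + q * p - r ≡ p * q
      identity = solve-∀

  fermat-unit : ∀ {z} → ¬ (z ≋ 0ℤ) → z ^ (h ℕ.+ h) ≋ 1ℤ
  fermat-unit {z} z≉0 = *-cancelˡ-≉0 z z≉0 (≋-trans (fermat z) (≡⇒≋ (sym (ℤ.*-identityʳ z))))

  1≉0 : ¬ (1ℤ ≋ 0ℤ)
  1≉0 = +k≉0 (s≤s z≤n) (s≤s (ℕ.≤-trans (ℕ.≤-trans (s≤s z≤n) 2≤h) (ℕ.m≤m+n h h)))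

  ^-distrib-* : ∀ a b n → (a * b) ^ n ≡ a ^ n * b ^ n
  ^-distrib-* a b zero    = refl
  ^-distrib-* a b (suc n) = trans (cong (a * b *_) (^-distrib-* a b n)) (interchange a b (a ^ n) (b ^ n))
    where
    interchange : ∀ a b c d → a * b * (c * d) ≡ a * c * (b * d)
    interchange = solve-∀

  suc-pred-2h : suc (h ℕ.+ h ∸ 1) ≡ h ℕ.+ h
  suc-pred-2h = ℕ.m+[n∸m]≡n {1} (ℕ.≤-trans (ℕ.≤-trans (s≤s z≤n) 2≤h) (ℕ.m≤m+n h h))

  opaque
    -- The exponent is p - 2. As a total power function it makes `inv-*` an equality of integers,
    -- and `inv-cong` asks for no proof that the arguments are units.
    inv : ℤ → ℤ
    inv z = z ^ (h ℕ.+ h ∸ 1)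

    inv-inverse : ∀ {z} → ¬ (z ≋ 0ℤ) → z * inv z ≋ 1ℤ
    inv-inverse {z} z≉0 = ≋-trans (≡⇒≋ (cong (z ^_) suc-pred-2h)) (fermat-unit z≉0)

    inv-cong : ∀ {a b} → a ≋ b → inv a ≋ inv b
    inv-cong = ^-cong (h ℕ.+ h ∸ 1)

    inv-* : ∀ a b → inv (a * b) ≡ inv a * inv b
    inv-* a b = ^-distrib-* a b (h ℕ.+ h ∸ 1)

  inv-inverse-< : ∀ {k} → 0 < k → k < p → + k * inv (+ k) ≋ 1ℤ
  inv-inverse-< 0<k k<p = inv-inverse (+k≉0 0<k k<p)

  inv-unique : ∀ {a b} → a * b ≋ 1ℤ → b ≋ inv a
  inv-unique {a} {b} ab≋1 = *-cancelˡ-≉0 a a≉0 (≋-trans ab≋1 (≋-sym (inv-inverse a≉0)))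
    where
    a≉0 : ¬ (a ≋ 0ℤ)
    a≉0 a≋0 = 1≉0 (≋-trans (≋-sym ab≋1) (≋-trans (*-congʳ b a≋0) (≡⇒≋ (ℤ.*-zeroˡ b))))

  -- Reducing the alternating Franel sum to the range m ≤ h

  m≤h⇒m+m<p : ∀ {m} → m ≤ h → m ℕ.+ m < p
  m≤h⇒m+m<p m≤h = s≤s (ℕ.+-mono-≤ m≤h m≤h)

  m≤h⇒m<p : ∀ {m} → m ≤ h → m < p
  m≤h⇒m<p {m} m≤h = ℕ.≤-<-trans (ℕ.m≤m+n m m) (m≤h⇒m+m<p m≤h)

  -- Put 2m = r + p with r < m, and c = m - r > 0. Vandermonde writes C(2m, m) as a combination of
  -- the C(p, c + l) with l ≤ r. Here 0 < c + l ≤ m < p, so each of them is divisible by p.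
  central-≋0 : ∀ {m} → h < m → m < p → central m ≋ 0ℤ
  central-≋0 {m} h<m m<p = begin
    binom (m ℕ.+ m) m              ≡⟨ cong₂ binom r+p≡m+m r+c≡m ⟨
    binom (r ℕ.+ p) (r ℕ.+ c)      ≡⟨ vandermonde r p c ⟨
    T 1ℤ r (λ l → binom p (c ℕ.+ l))   ≡⟨ T-1 r (λ l → binom p (c ℕ.+ l)) ⟩
    ∑ (suc r) (λ l → binom r l * binom p (c ℕ.+ l))
      ≋⟨ ∑-zero≋ (suc r) (λ { l (s≤s l≤r) → ≋-trans (*-congˡ (binom r l) (vanish l≤r)) (≡⇒≋ (ℤ.*-zeroʳ (binom r l))) }) ⟩
    0ℤ ∎
    where
    r = m ℕ.+ m ∸ p
    c = m ∸ r
    p≤m+m : p ≤ m ℕ.+ m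
    p≤m+m = ℕ.+-mono-≤ h<m (ℕ.<⇒≤ h<m)
    r+p≡m+m : r ℕ.+ p ≡ m ℕ.+ m
    r+p≡m+m = ℕ.m∸n+n≡m p≤m+m
    r<m : r < m
    r<m = ℕ.+-cancelʳ-< p r m (subst (_< m ℕ.+ p) (sym r+p≡m+m) (ℕ.+-monoʳ-< m m<p))
    r+c≡m : r ℕ.+ c ≡ m
    r+c≡m = ℕ.m+[n∸m]≡n (ℕ.<⇒≤ r<m)
    vanish : ∀ {l} → l ≤ r → binom p (c ℕ.+ l) ≋ 0ℤ
    vanish {l} l≤r with c | ℕ.m<n⇒0<n∸m r<m | r+c≡m
    ... | suc c′ | _ | r+c≡m′ = binom-p≋0 (c′ ℕ.+ l)
      (ℕ.≤-<-trans (ℕ.≤-trans (ℕ.+-monoʳ-≤ (suc c′) l≤r) (ℕ.≤-reflexive (trans (ℕ.+-comm (suc c′) r) r+c≡m′))) m<p)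

  -- The U_m of the overview: with its sign it is the forward difference Δ^m of k ↦ C(k, m) a(k),
  -- taken at k = m.
  transform : ℕ → (ℕ → ℤ) → ℤ
  transform m a = -1ℤ ^ m * T -1ℤ m (λ l → binom (l ℕ.+ m) m * a (l ℕ.+ m))

  franelℤ : ℕ → ℤ
  franelℤ k = ∑ (suc k) (λ i → cube (binom k i))

  -1^m*-1^m≡1 : ∀ m → -1ℤ ^ m * -1ℤ ^ m ≡ 1ℤ
  -1^m*-1^m≡1 zero    = refl
  -1^m*-1^m≡1 (suc m) = trans (identity (-1ℤ ^ m)) (-1^m*-1^m≡1 m)
    where
    identity : ∀ s → -1ℤ * s * (-1ℤ * s) ≡ s * s
    identity = solve-∀

  ∑-alternating-franel : ∀ (a : ℕ → ℤ) →
    ∑ p (λ k → -1ℤ ^ k * a k * franelℤ k) ≋ ∑ (suc h) (λ m → central m * transform m a)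
  ∑-alternating-franel a = begin
    ∑ p (λ k → -1ℤ ^ k * a k * franelℤ k)
      ≡⟨ ∑-franel p s ⟩
    ∑ p g
      ≡⟨ ∑-++ (suc h) h g ⟩
    ∑ (suc h) g + ∑ h (λ i → g (suc h ℕ.+ i))
      ≋⟨ +-cong (≡⇒≋ (∑-cong (suc h) (λ { m (s≤s m≤h) → cong (central m *_) (inner m m≤h) })))
                (∑-zero≋ h upper) ⟩
    ∑ (suc h) (λ m → central m * transform m a) + 0ℤ
      ≡⟨ ℤ.+-identityʳ _ ⟩
    ∑ (suc h) (λ m → central m * transform m a) ∎
    where
    s : ℕ → ℤ
    s k = -1ℤ ^ k * a k
    f : ℕ → ℕ → ℤ
    f m l = binom m l * (binom (m ℕ.+ l) m * s (m ℕ.+ l))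
    g : ℕ → ℤ
    g m = central m * ∑ (p ∸ m) (f m)
    upper : ∀ i → i < h → g (suc h ℕ.+ i) ≋ 0ℤ
    upper i i<h = ≋-trans
      (*-congʳ (∑ (p ∸ (suc h ℕ.+ i)) (f (suc h ℕ.+ i)))
        (central-≋0 (s≤s (ℕ.m≤m+n h i)) (s≤s (ℕ.+-monoʳ-< h i<h))))
      (≡⇒≋ (ℤ.*-zeroˡ (∑ (p ∸ (suc h ℕ.+ i)) (f (suc h ℕ.+ i)))))
    inner : ∀ m → m ≤ h → ∑ (p ∸ m) (f m) ≡ transform m a
    inner m m≤h = trans
      -- Since 2m < p, the range l < p - m contains all l ≤ m, so no term of the m-th difference is
      -- cut off.
      (∑-extend (suc m) (p ∸ m) (f m)
        (subst (_≤ p ∸ m) (ℕ.m+n∸m≡n m (suc m))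
          (ℕ.∸-monoˡ-≤ m (subst (_≤ p) (sym (ℕ.+-suc m m)) (m≤h⇒m+m<p m≤h))))
        (λ l m<l → cong (_* (binom (m ℕ.+ l) m * s (m ℕ.+ l))) (binom-> m<l)))
      (trans (∑-cong (suc m) (λ l _ → step l))
        (trans (sym (*-distribˡ-∑ (suc m) (-1ℤ ^ m) _)) (cong (-1ℤ ^ m *_) (sym (T-∑ -1ℤ m _)))))
      where
      regroup : ∀ b c x y z → b * (c * (x * y * z)) ≡ x * (b * y * (c * z))
      regroup = solve-∀
      step : ∀ l → f m l ≡ -1ℤ ^ m * (binom m l * -1ℤ ^ l * (binom (l ℕ.+ m) m * a (l ℕ.+ m)))
      step l rewrite ℕ.+-comm m l | ℤ.^-distribˡ-+-* -1ℤ l m | ℤ.*-comm (-1ℤ ^ l) (-1ℤ ^ m) =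
        regroup (binom m l) (binom (l ℕ.+ m) m) (-1ℤ ^ m) (-1ℤ ^ l) (a (l ℕ.+ m))

  -- Differences of binomials times harmonic numbers

  1/suc : ℕ → ℤ
  1/suc i = inv (+ suc i)

  1/suc-inverse : ∀ {k} → suc k < p → + suc k * 1/suc k ≋ 1ℤ
  1/suc-inverse = inv-inverse-< (s≤s z≤n)

  H₁ H₂ : ℕ → ℤ
  H₁ k = ∑ k 1/suc
  H₂ k = ∑ k (λ i → 1/suc i * 1/suc i)

  T-binom-suc : ∀ n k m →
    T -1ℤ (suc n) (λ i → binom (i ℕ.+ k) (suc m)) ≡ -1ℤ * T -1ℤ n (λ i → binom (i ℕ.+ k) m)
  T-binom-suc n k m = trans
    (cong (λ t → A + -1ℤ * t) (trans
      (T-cong -1ℤ n (λ i _ → trans (pascal (i ℕ.+ k) m)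
        (sym (cong₂ _+_ (ℤ.*-identityˡ (binom (i ℕ.+ k) m)) (ℤ.*-identityˡ (binom (i ℕ.+ k) (suc m)))))))
      (T-linear -1ℤ n 1ℤ 1ℤ (λ i → binom (i ℕ.+ k) m) (λ i → binom (i ℕ.+ k) (suc m)))))
    (identity A (T -1ℤ n (λ i → binom (i ℕ.+ k) m)))
    where
    A = T -1ℤ n (λ i → binom (i ℕ.+ k) (suc m))
    identity : ∀ a b → a + -1ℤ * (1ℤ * b + 1ℤ * a) ≡ -1ℤ * b
    identity = solve-∀

  T-binom-n : ∀ n k → T -1ℤ n (λ i → binom (i ℕ.+ k) n) ≡ -1ℤ ^ n
  T-binom-n zero    k = binom-0 k
  T-binom-n (suc n) k = trans (T-binom-suc n k n) (cong (-1ℤ *_) (T-binom-n n k))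

  T-binom-< : ∀ {m n} k → m < n → T -1ℤ n (λ i → binom (i ℕ.+ k) m) ≡ 0ℤ
  T-binom-< {zero}  {suc n} k _ =
    trans (T-cong -1ℤ (suc n) (λ i _ → binom-0 (i ℕ.+ k))) (trans (T-one -1ℤ (suc n)) (ℤ.*-zeroˡ (0ℤ ^ n)))
  T-binom-< {suc m} {suc n} k (s≤s m<n) =
    trans (T-binom-suc n k m) (cong (-1ℤ *_) (T-binom-< k m<n))

  -- Absorption in divided form. It cancels the denominator that an increment of H₁ or H₂ brings in,
  -- leaving a fixed factor `1/suc n`.
  binom-div : ∀ {κ n} → suc κ < p → suc n < p →
    binom (suc κ) (suc n) * 1/suc κ ≋ 1/suc n * binom κ n
  binom-div {κ} {n} κ<p n<p = linear₃ (- (B * v)) (w * v) (b * w)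
    (1/suc-inverse n<p) (≡⇒≋ (absorption κ n)) (1/suc-inverse κ<p) (identity B b v w (+ suc n) (+ suc κ))
    where
    B = binom (suc κ) (suc n)
    b = binom κ n
    v = 1/suc κ
    w = 1/suc n
    identity : ∀ B b v w n κ → B * v - w * b ≡
      - (B * v) * (n * w - 1ℤ) + w * v * (n * B - κ * b) + b * w * (κ * v - 1ℤ)
    identity = solve-∀

  -- Leibniz rule for the difference operator applied to C(i + k, n + 1) · a(i + k).
  T-binom-product : ∀ n k (a b : ℕ → ℤ) →
    (∀ i → i ≤ n → binom (suc (i ℕ.+ k)) (suc n) * a (suc (i ℕ.+ k))
      ≋ binom (suc (i ℕ.+ k)) (suc n) * a (i ℕ.+ k) + 1/suc n * b i) →
    T -1ℤ (suc n) (λ i → binom (i ℕ.+ k) (suc n) * a (i ℕ.+ k))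
      ≋ -1ℤ * (T -1ℤ n (λ i → binom (i ℕ.+ k) n * a (i ℕ.+ k)) + 1/suc n * T -1ℤ n b)
  T-binom-product n k a b step = begin
    F + -1ℤ * T -1ℤ n (f ∘ suc)
      ≋⟨ +-congˡ F (*-congˡ -1ℤ (T-cong≋ -1ℤ n (λ i i≤n → ≋-trans (step i i≤n) (≡⇒≋ (split i))))) ⟩
    F + -1ℤ * T -1ℤ n (λ i → 1ℤ * (1ℤ * f i + 1ℤ * g i) + 1/suc n * b i)
      ≡⟨ cong (λ t → F + -1ℤ * t) (trans (T-linear -1ℤ n 1ℤ (1/suc n) (λ i → 1ℤ * f i + 1ℤ * g i) b)
           (cong (λ t → 1ℤ * t + 1/suc n * T -1ℤ n b) (T-linear -1ℤ n 1ℤ 1ℤ f g))) ⟩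
    F + -1ℤ * (1ℤ * (1ℤ * F + 1ℤ * T -1ℤ n g) + 1/suc n * T -1ℤ n b)
      ≡⟨ identity F (T -1ℤ n g) (1/suc n * T -1ℤ n b) ⟩
    -1ℤ * (T -1ℤ n g + 1/suc n * T -1ℤ n b) ∎
    where
    f g : ℕ → ℤ
    f i = binom (i ℕ.+ k) (suc n) * a (i ℕ.+ k)
    g i = binom (i ℕ.+ k) n * a (i ℕ.+ k)
    F = T -1ℤ n f
    distribute : ∀ x y a w → (x + y) * a + w ≡ 1ℤ * (1ℤ * (y * a) + 1ℤ * (x * a)) + w
    distribute = solve-∀
    split : ∀ i → binom (suc (i ℕ.+ k)) (suc n) * a (i ℕ.+ k) + 1/suc n * b i
      ≡ 1ℤ * (1ℤ * f i + 1ℤ * g i) + 1/suc n * b i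
    split i = trans (cong (λ c → c * a (i ℕ.+ k) + 1/suc n * b i) (pascal (i ℕ.+ k) n))
      (distribute (binom (i ℕ.+ k) n) (binom (i ℕ.+ k) (suc n)) (a (i ℕ.+ k)) (1/suc n * b i))
    identity : ∀ f g w → f + -1ℤ * (1ℤ * (1ℤ * f + 1ℤ * g) + w) ≡ -1ℤ * (g + w)
    identity = solve-∀

  i+k<p : ∀ {i n k} → i ≤ n → suc n ℕ.+ k < p → suc (i ℕ.+ k) < p
  i+k<p {k = k} i≤n n+k<p = ℕ.≤-<-trans (ℕ.+-monoˡ-≤ k (s≤s i≤n)) n+k<p

  -- Each Leibniz step trades one difference for one degree of the binomial. The increment of H₁
  -- contributes `1/suc n` times the n-th difference of C(x, n), which is a constant.
  T-H₁ : ∀ n k → n ℕ.+ k < p →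
    T -1ℤ n (λ i → binom (i ℕ.+ k) n * H₁ (i ℕ.+ k)) ≋ -1ℤ ^ n * (H₁ k + H₁ n)
  T-H₁ zero    k _ = ≡⇒≋ (trans (cong (_* H₁ k) (binom-0 k)) (cong (1ℤ *_) (sym (ℤ.+-identityʳ (H₁ k)))))
  T-H₁ (suc n) k n+k<p = begin
    T -1ℤ (suc n) (λ i → binom (i ℕ.+ k) (suc n) * H₁ (i ℕ.+ k))
      ≋⟨ T-binom-product n k H₁ (λ i → binom (i ℕ.+ k) n) step ⟩
    -1ℤ * (T -1ℤ n (λ i → binom (i ℕ.+ k) n * H₁ (i ℕ.+ k)) + 1/suc n * T -1ℤ n (λ i → binom (i ℕ.+ k) n))
      ≋⟨ *-congˡ -1ℤ (+-cong (T-H₁ n k (ℕ.<⇒≤ n+k<p)) (≡⇒≋ (cong (1/suc n *_) (T-binom-n n k)))) ⟩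
    -1ℤ * (-1ℤ ^ n * (H₁ k + H₁ n) + 1/suc n * -1ℤ ^ n)
      ≡⟨ identity (-1ℤ ^ n) (H₁ k) (H₁ n) (1/suc n) ⟩
    -1ℤ ^ suc n * (H₁ k + H₁ (suc n)) ∎
    where
    identity : ∀ s a b w → -1ℤ * (s * (a + b) + w * s) ≡ -1ℤ * s * (a + (b + w))
    identity = solve-∀
    step : ∀ i → i ≤ n → binom (suc (i ℕ.+ k)) (suc n) * H₁ (suc (i ℕ.+ k))
      ≋ binom (suc (i ℕ.+ k)) (suc n) * H₁ (i ℕ.+ k) + 1/suc n * binom (i ℕ.+ k) n
    step i i≤n = ≋-trans
      (≡⇒≋ (ℤ.*-distribˡ-+ (binom (suc (i ℕ.+ k)) (suc n)) (H₁ (i ℕ.+ k)) (1/suc (i ℕ.+ k))))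
      (+-congˡ (binom (suc (i ℕ.+ k)) (suc n) * H₁ (i ℕ.+ k))
        (binom-div (i+k<p i≤n n+k<p) (ℕ.≤-<-trans (ℕ.m≤m+n (suc n) k) n+k<p)))

  transform-H₁ : ∀ m → m ≤ h → transform m H₁ ≋ + 2 * H₁ m
  transform-H₁ m m≤h = begin
    -1ℤ ^ m * T -1ℤ m (λ l → binom (l ℕ.+ m) m * H₁ (l ℕ.+ m))
      ≋⟨ *-congˡ (-1ℤ ^ m) (T-H₁ m m (m≤h⇒m+m<p m≤h)) ⟩
    -1ℤ ^ m * (-1ℤ ^ m * (H₁ m + H₁ m))
      ≡⟨ ℤ.*-assoc (-1ℤ ^ m) (-1ℤ ^ m) (H₁ m + H₁ m) ⟨
    -1ℤ ^ m * -1ℤ ^ m * (H₁ m + H₁ m)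
      ≡⟨ cong (_* (H₁ m + H₁ m)) (-1^m*-1^m≡1 m) ⟩
    1ℤ * (H₁ m + H₁ m)
      ≡⟨ identity (H₁ m) ⟩
    + 2 * H₁ m ∎
    where
    identity : ∀ a → 1ℤ * (a + a) ≡ + 2 * a
    identity = solve-∀

  -- β n k = n! k! / (n + k + 1)!, by binom-β.
  β : ℕ → ℕ → ℤ
  β n k = T -1ℤ n (λ i → 1/suc (i ℕ.+ k))

  -- β n k stands for Euler's integral of x^k (1 - x)^n over [0, 1]; one more factor 1 - x splits it
  -- in two.
  β-suc : ∀ n k → β (suc n) k ≡ β n k + -1ℤ * β n (suc k)
  β-suc n k = cong (λ t → β n k + -1ℤ * t) (T-cong -1ℤ n (λ i _ → cong 1/suc (sym (ℕ.+-suc i k))))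

  -- The ratio of consecutive beta values, obtained without factorials: the induction on n combines
  -- `β-suc` with the hypotheses at k and at k + 1.
  β-recurrence : ∀ n k → suc (suc (n ℕ.+ k)) < p →
    + suc (suc (n ℕ.+ k)) * β (suc n) k ≋ + suc n * β n k
  β-recurrence zero k k<p = linear₂ 1ℤ -1ℤ (1/suc-inverse (ℕ.<-trans (ℕ.n<1+n _) k<p)) (1/suc-inverse k<p)
    (trans (cong (λ t → + suc (suc k) * t - 1ℤ * 1/suc k) (β-suc 0 k)) (identity (+ suc k) (1/suc k) (1/suc (suc k))))
    where
    identity : ∀ k u v → (1ℤ + k) * (u + -1ℤ * v) - 1ℤ * u ≡ 1ℤ * (k * u - 1ℤ) + -1ℤ * ((1ℤ + k) * v - 1ℤ)
    identity = solve-∀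
  β-recurrence (suc n) k n+k<p = linear₃ 1ℤ 1ℤ -1ℤ
    (≡⇒≋ (cong (+ suc (suc (suc (n ℕ.+ k))) *_) (β-suc (suc n) k)))
    (≋-trans (β-recurrence n k (ℕ.<-trans (ℕ.n<1+n _) n+k<p)) (≡⇒≋ refl))
    (linear₂ {+ suc n * β (suc n) k + + suc (suc (suc (n ℕ.+ k))) * β (suc n) (suc k)} {+ suc n * β n k} 1ℤ (+ suc n) (subst (λ x → + suc (suc x) * β (suc n) (suc k) ≋ + suc n * β n (suc k)) (ℕ.+-suc n k)
            (β-recurrence n (suc k) (subst (λ x → suc (suc x) < p) (sym (ℕ.+-suc n k)) n+k<p)))
       (≡⇒≋ (β-suc n k))
       (combine (+ n) (+ suc (suc (suc (n ℕ.+ k)))) (β n k) (β n (suc k)) (β (suc n) k) (β (suc n) (suc k))))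
    (identity (+ n) (+ suc (suc (n ℕ.+ k))) (β n k) (β (suc n) k) (β (suc n) (suc k)) (β (suc (suc n)) k))
    where
    combine : ∀ n N b₀ b₁ c₀ c₁ →
      (1ℤ + n) * c₀ + N * c₁ - (1ℤ + n) * b₀ ≡ 1ℤ * (N * c₁ - (1ℤ + n) * b₁) + (1ℤ + n) * (c₀ - (b₀ + -1ℤ * b₁))
    combine = solve-∀
    identity : ∀ n N b₀ c₀ c₁ d → (1ℤ + N) * d - (+ 2 + n) * c₀ ≡
      1ℤ * ((1ℤ + N) * d - (1ℤ + N) * (c₀ + -1ℤ * c₁))
      + 1ℤ * (N * c₀ - (1ℤ + n) * b₀)
      + -1ℤ * ((1ℤ + n) * c₀ + (1ℤ + N) * c₁ - (1ℤ + n) * b₀)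
    identity = solve-∀

  β-exchange : ∀ n k → suc (suc (n ℕ.+ k)) < p →
    + suc k * β (suc n) k ≋ + suc n * β n (suc k)
  β-exchange n k n+k<p = *-cancelˡ-< (s≤s z≤n) n+k<p
    (linear₂ (+ suc k + + suc n) (- (+ suc n * + suc (suc (n ℕ.+ k)))) (β-recurrence n k n+k<p) (≡⇒≋ (β-suc n k))
      (trans (cong (λ N → N * (+ suc k * β (suc n) k) - N * (+ suc n * β n (suc k))) N≡)
        (trans (identity (+ n) (+ k) (β n k) (β n (suc k)) (β (suc n) k))
          (cong (λ N → (+ suc k + + suc n) * (N * β (suc n) k - + suc n * β n k)
            + - (+ suc n * N) * (β (suc n) k - (β n k + -1ℤ * β n (suc k)))) (sym N≡)))))
    where
    N≡ : + suc (suc (n ℕ.+ k)) ≡ + 2 + (+ n + + k)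
    N≡ = refl
    identity : ∀ n k b₀ b₁ c →
      (+ 2 + (n + k)) * ((1ℤ + k) * c) - (+ 2 + (n + k)) * ((1ℤ + n) * b₁) ≡
      (1ℤ + k + (1ℤ + n)) * ((+ 2 + (n + k)) * c - (1ℤ + n) * b₀)
      + - ((1ℤ + n) * (+ 2 + (n + k))) * (c - (b₀ + -1ℤ * b₁))
    identity = solve-∀

  binom-β : ∀ n k → suc (n ℕ.+ k) < p →
    + suc n * (binom (suc (n ℕ.+ k)) (suc n) * β n k) ≋ 1ℤ
  binom-β zero k k<p = ≋-trans (≡⇒≋ eq) (1/suc-inverse k<p)
    where
    identity : ∀ x v → 1ℤ * (x * v) ≡ 1ℤ * x * v
    identity = solve-∀
    eq : 1ℤ * (binom (suc k) 1 * 1/suc k) ≡ + suc k * 1/suc k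
    eq = trans (identity (binom (suc k) 1) (1/suc k)) (cong (_* 1/suc k)
      (trans (absorption k 0) (trans (cong (+ suc k *_) (binom-0 k)) (ℤ.*-identityʳ (+ suc k)))))
  binom-β (suc n) k n+k<p = linear₃ b₁ b₀ 1ℤ
    (≡⇒≋ (absorption (suc (n ℕ.+ k)) (suc n)))
    (β-recurrence n k n+k<p)
    (binom-β n k (ℕ.<-trans (ℕ.n<1+n _) n+k<p))
    (identity (+ n) (+ suc (suc (n ℕ.+ k))) (binom (suc (suc (n ℕ.+ k))) (suc (suc n))) b₀ b₁ (β n k))
    where
    b₀ = binom (suc (n ℕ.+ k)) (suc n)
    b₁ = β (suc n) k
    identity : ∀ n N B b c c₀ → (+ 2 + n) * (B * c) - 1ℤ ≡
      c * ((+ 2 + n) * B - N * b) + b * (N * c - (1ℤ + n) * c₀) + 1ℤ * ((1ℤ + n) * (b * c₀) - 1ℤ)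
    identity = solve-∀

  -- The symmetry x ↔ 1 - x, here `β-exchange` with equal indices, makes the two parts of β j j in
  -- `β-suc` congruent.
  β-middle : ∀ j → suc j ≤ h → β j j ≋ + 2 * β j (suc j)
  β-middle j j<h = linear₂ -1ℤ 1ℤ (≡⇒≋ (β-suc j j))
    (*-cancelˡ-< (s≤s z≤n) (m≤h⇒m<p j<h) (β-exchange j j 2j<p))
    (identity (β j j) (β j (suc j)) (β (suc j) j))
    where
    2j<p : suc (suc (j ℕ.+ j)) < p
    2j<p = subst (_< p) (cong suc (ℕ.+-suc j j)) (m≤h⇒m+m<p j<h)
    identity : ∀ b₀ b₁ c → b₀ - + 2 * b₁ ≡ -1ℤ * (c - (b₀ + -1ℤ * b₁)) + 1ℤ * (c - b₁)
    identity = solve-∀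

  -- C(x, m) is (-1)^m plus x + 1 times a polynomial of degree below m. Division by x + 1 leaves
  -- that polynomial, killed by the n-th difference, and (-1)^m/(x + 1). The induction removes one
  -- degree at a time.
  T-binom/suc : ∀ m n k → m ≤ n → suc n ℕ.+ k < p →
    T -1ℤ n (λ i → binom (i ℕ.+ k) m * 1/suc (i ℕ.+ k)) ≋ -1ℤ ^ m * β n k
  T-binom/suc zero n k _ _ = ≡⇒≋ (trans
    (T-cong -1ℤ n (λ i _ → trans (cong (_* 1/suc (i ℕ.+ k)) (binom-0 (i ℕ.+ k))) (ℤ.*-identityˡ (1/suc (i ℕ.+ k)))))
    (sym (ℤ.*-identityˡ (β n k))))
  T-binom/suc (suc m) n k m<n n+k<p = begin
    T -1ℤ n (λ i → binom (i ℕ.+ k) (suc m) * 1/suc (i ℕ.+ k))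
      ≋⟨ T-cong≋ -1ℤ n step ⟩
    T -1ℤ n (λ i → 1/suc m * binom (i ℕ.+ k) m + -1ℤ * (binom (i ℕ.+ k) m * 1/suc (i ℕ.+ k)))
      ≡⟨ T-linear -1ℤ n (1/suc m) -1ℤ (λ i → binom (i ℕ.+ k) m) (λ i → binom (i ℕ.+ k) m * 1/suc (i ℕ.+ k)) ⟩
    1/suc m * T -1ℤ n (λ i → binom (i ℕ.+ k) m) + -1ℤ * T -1ℤ n (λ i → binom (i ℕ.+ k) m * 1/suc (i ℕ.+ k))
      ≋⟨ +-cong (≡⇒≋ (cong (1/suc m *_) (T-binom-< k m<n))) (*-congˡ -1ℤ (T-binom/suc m n k (ℕ.<⇒≤ m<n) n+k<p)) ⟩
    1/suc m * 0ℤ + -1ℤ * (-1ℤ ^ m * β n k)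
      ≡⟨ identity (1/suc m) (-1ℤ ^ m) (β n k) ⟩
    -1ℤ ^ suc m * β n k ∎
    where
    identity : ∀ w s b → w * 0ℤ + -1ℤ * (s * b) ≡ -1ℤ * s * b
    identity = solve-∀
    combine : ∀ B b b′ v w → b′ * v - (w * b + -1ℤ * (b * v)) ≡ 1ℤ * (B * v - w * b) + - v * (B - (b + b′))
    combine = solve-∀
    step : ∀ i → i ≤ n → binom (i ℕ.+ k) (suc m) * 1/suc (i ℕ.+ k)
      ≋ 1/suc m * binom (i ℕ.+ k) m + -1ℤ * (binom (i ℕ.+ k) m * 1/suc (i ℕ.+ k))
    step i i≤n = linear₂ 1ℤ (- 1/suc (i ℕ.+ k))
      (binom-div {i ℕ.+ k} {m} (i+k<p i≤n n+k<p) (ℕ.≤-<-trans (ℕ.≤-trans m<n (ℕ.≤-trans (ℕ.n≤1+n n) (ℕ.m≤m+n (suc n) k))) n+k<p))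
      (≡⇒≋ (pascal (i ℕ.+ k) m))
      (combine (binom (suc (i ℕ.+ k)) (suc m)) (binom (i ℕ.+ k) m) (binom (i ℕ.+ k) (suc m)) (1/suc (i ℕ.+ k)) (1/suc m))

  -- U_m for H^(2) is `V m m`. The two arguments are separate because the Leibniz induction on n
  -- keeps the base point k fixed.
  V : ℕ → ℕ → ℤ
  V n k = H₂ k + ∑ n (λ s → 1/suc s * β s k)

  T-H₂ : ∀ n k → n ℕ.+ k < p →
    T -1ℤ n (λ i → binom (i ℕ.+ k) n * H₂ (i ℕ.+ k)) ≋ -1ℤ ^ n * V n k
  T-H₂ zero    k _ = ≡⇒≋ (trans (cong (_* H₂ k) (binom-0 k)) (cong (1ℤ *_) (sym (ℤ.+-identityʳ (H₂ k)))))
  T-H₂ (suc n) k n+k<p = begin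
    T -1ℤ (suc n) (λ i → binom (i ℕ.+ k) (suc n) * H₂ (i ℕ.+ k))
      ≋⟨ T-binom-product n k H₂ (λ i → binom (i ℕ.+ k) n * 1/suc (i ℕ.+ k)) step ⟩
    -1ℤ * (T -1ℤ n (λ i → binom (i ℕ.+ k) n * H₂ (i ℕ.+ k))
      + 1/suc n * T -1ℤ n (λ i → binom (i ℕ.+ k) n * 1/suc (i ℕ.+ k)))
      ≋⟨ *-congˡ -1ℤ (+-cong (T-H₂ n k (ℕ.<⇒≤ n+k<p)) (*-congˡ (1/suc n) (T-binom/suc n n k ℕ.≤-refl n+k<p))) ⟩
    -1ℤ * (-1ℤ ^ n * V n k + 1/suc n * (-1ℤ ^ n * β n k))
      ≡⟨ identity (-1ℤ ^ n) (H₂ k) (∑ n (λ s → 1/suc s * β s k)) (1/suc n) (β n k) ⟩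
    -1ℤ ^ suc n * V (suc n) k ∎
    where
    identity : ∀ s a b w c → -1ℤ * (s * (a + b) + w * (s * c)) ≡ -1ℤ * s * (a + (b + w * c))
    identity = solve-∀
    combine : ∀ B b a v w → B * (a + v * v) - (B * a + w * (b * v)) ≡ v * (B * v - w * b)
    combine = solve-∀
    step : ∀ i → i ≤ n → binom (suc (i ℕ.+ k)) (suc n) * H₂ (suc (i ℕ.+ k))
      ≋ binom (suc (i ℕ.+ k)) (suc n) * H₂ (i ℕ.+ k) + 1/suc n * (binom (i ℕ.+ k) n * 1/suc (i ℕ.+ k))
    step i i≤n = linear₁ (1/suc (i ℕ.+ k))
      (binom-div {i ℕ.+ k} {n} (i+k<p i≤n n+k<p) (ℕ.≤-<-trans (ℕ.m≤m+n (suc n) k) n+k<p))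
      (combine (binom (suc (i ℕ.+ k)) (suc n)) (binom (i ℕ.+ k) n) (H₂ (i ℕ.+ k)) (1/suc (i ℕ.+ k)) (1/suc n))

  transform-H₂ : ∀ m → m ≤ h → transform m H₂ ≋ V m m
  transform-H₂ m m≤h = begin
    -1ℤ ^ m * T -1ℤ m (λ l → binom (l ℕ.+ m) m * H₂ (l ℕ.+ m))
      ≋⟨ *-congˡ (-1ℤ ^ m) (T-H₂ m m (m≤h⇒m+m<p m≤h)) ⟩
    -1ℤ ^ m * (-1ℤ ^ m * V m m)   ≡⟨ ℤ.*-assoc (-1ℤ ^ m) (-1ℤ ^ m) (V m m) ⟨
    -1ℤ ^ m * -1ℤ ^ m * V m m     ≡⟨ cong (_* V m m) (-1^m*-1^m≡1 m) ⟩
    1ℤ * V m m                    ≡⟨ ℤ.*-identityˡ (V m m) ⟩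
    V m m                         ∎

  ∑-β : ∀ n k → ∑ n (λ s → β s (suc k)) ≡ β 0 k + -1ℤ * β n k
  ∑-β zero    k = sym (trans (cong (λ b → β 0 k + b) (ℤ.-1*i≡-i (β 0 k))) (ℤ.+-inverseʳ (β 0 k)))
  ∑-β (suc n) k = trans (cong (_+ β n (suc k)) (∑-β n k))
    (trans (identity (β 0 k) (β n k) (β n (suc k))) (cong (λ b → β 0 k + -1ℤ * b) (sym (β-suc n k))))
    where
    identity : ∀ a b c → a + -1ℤ * b + c ≡ a + -1ℤ * (b + -1ℤ * c)
    identity = solve-∀

  -- Moving the base point from j to j + 1 costs `1/suc j * β s (suc j)` in each summand. These
  -- costs telescope, cancel the new square in H₂ and leave β j j, that is, two copies of β j (j +
  -- 1). The new summand s = j supplies the third.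
  V-diagonal-β : ∀ j → suc j ≤ h → V (suc j) (suc j) ≋ V j j + + 3 * (1/suc j * β j (suc j))
  V-diagonal-β j j<h = linear₂ 1ℤ w
    (≋-trans (∑-cong≋ j termwise) (≡⇒≋ (trans
      (∑-distrib-+ j (λ s → 1/suc s * β s j) (λ s → - w * β s (suc j)))
      (cong (λ t → ∑ j (λ s → 1/suc s * β s j) + t)
        (trans (sym (*-distribˡ-∑ j (- w) (λ s → β s (suc j)))) (cong (- w *_) (∑-β j j)))))))
    (β-middle j j<h)
    (identity (H₂ j) w (∑ j (λ s → 1/suc s * β s (suc j))) (∑ j (λ s → 1/suc s * β s j)) (β j (suc j)) (β j j))
    where
    w = 1/suc j
    identity : ∀ H w x y b c → H + w * w + (x + w * b) - (H + y + + 3 * (w * b))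
      ≡ 1ℤ * (x - (y + - w * (w + -1ℤ * c))) + w * (c - + 2 * b)
    identity = solve-∀
    combine : ∀ s j w v b₀ b₁ c → v * b₁ - (v * b₀ + - w * b₁) ≡
      v * (c - (b₀ + -1ℤ * b₁)) + - (v * w) * ((1ℤ + j) * c - (1ℤ + s) * b₁)
      + (v * c * ((1ℤ + j) * w - 1ℤ) + - (w * b₁) * ((1ℤ + s) * v - 1ℤ))
    combine = solve-∀
    termwise : ∀ s → s < j → 1/suc s * β s (suc j) ≋ 1/suc s * β s j + - w * β s (suc j)
    termwise s s<j = linear₃ (1/suc s) (- (1/suc s * w)) 1ℤ
      (≡⇒≋ (β-suc s j))
      (β-exchange s j (ℕ.≤-<-trans (s≤s (ℕ.+-mono-≤ s<j (ℕ.n≤1+n j))) (ℕ.≤-<-trans (ℕ.≤-reflexive refl) (m≤h⇒m+m<p j<h))))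
      (linear₂ {1/suc s * β (suc s) j * (+ suc j * w) + - (w * β s (suc j)) * (+ suc s * 1/suc s)}
           {1/suc s * β (suc s) j * 1ℤ + - (w * β s (suc j)) * 1ℤ}
           (1/suc s * β (suc s) j) (- (w * β s (suc j)))
        (1/suc-inverse (m≤h⇒m<p j<h)) (1/suc-inverse (m≤h⇒m<p (ℕ.≤-trans s<j (ℕ.<⇒≤ j<h))))
        (distribute (1/suc s * β (suc s) j) (- (w * β s (suc j))) (+ suc j * w) (+ suc s * 1/suc s)))
      (trans (combine (+ s) (+ j) w (1/suc s) (β s j) (β s (suc j)) (β (suc s) j))
        (cong (λ t → 1/suc s * (β (suc s) j - (β s j + -1ℤ * β s (suc j)))
            + - (1/suc s * w) * (+ suc j * β (suc s) j - + suc s * β s (suc j)) + t)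
          (regroup (1/suc s * β (suc s) j) (- (w * β s (suc j))) (+ suc j * w) (+ suc s * 1/suc s))))
      where
      distribute : ∀ a b x y → a * x + b * y - (a * 1ℤ + b * 1ℤ) ≡ a * (x - 1ℤ) + b * (y - 1ℤ)
      distribute = solve-∀
      regroup : ∀ a b x y → a * (x - 1ℤ) + b * (y - 1ℤ) ≡ 1ℤ * (a * x + b * y - (a * 1ℤ + b * 1ℤ))
      regroup = solve-∀

  inv-central : ℕ → ℤ
  inv-central m = inv (central m)

  -- Exhibits an inverse of C(2m, m) for m = j + 1, which both proves it a unit and turns β j (j +
  -- 1) into 1/(m C(2m, m)).
  central-β : ∀ j → suc j ≤ h → central (suc j) * (+ suc j * β j (suc j)) ≋ 1ℤ
  central-β j j<h = ≋-trans (≡⇒≋ (swap (central (suc j)) (+ suc j) (β j (suc j))))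
    (binom-β j (suc j) (m≤h⇒m+m<p j<h))
    where
    swap : ∀ c n b → c * (n * b) ≡ n * (c * b)
    swap = solve-∀

  central-inverse : ∀ m → m ≤ h → central m * inv-central m ≋ 1ℤ
  central-inverse zero    _   = ≋-trans (*-congˡ (central 0) (≋-sym (inv-unique {central 0} {1ℤ} c*1≋1))) c*1≋1
    where
    c*1≋1 : central 0 * 1ℤ ≋ 1ℤ
    c*1≋1 = ≡⇒≋ (cong (_* 1ℤ) (binom-0 0))
  central-inverse (suc j) j<h =
    ≋-trans (*-congˡ (central (suc j)) (≋-sym (inv-unique {central (suc j)} (central-β j j<h)))) (central-β j j<h)

  V-diagonal : ∀ j → suc j ≤ h →
    V (suc j) (suc j) ≋ V j j + + 3 * (inv-central (suc j) * (1/suc j * 1/suc j))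
  V-diagonal j j<h = ≋-trans (V-diagonal-β j j<h) (+-congˡ (V j j) (*-congˡ (+ 3)
    (linear₂ (w * w) (- (w * b)) (inv-unique {central (suc j)} (central-β j j<h)) (1/suc-inverse (m≤h⇒m<p j<h))
      (identity (+ suc j) w b (inv-central (suc j))))))
    where
    w = 1/suc j
    b = β j (suc j)
    identity : ∀ n w b c → w * b - c * (w * w) ≡ w * w * (n * b - c) + - (w * b) * (n * w - 1ℤ)
    identity = solve-∀

  -- Central binomials modulo p, odd parts and the sum for H

  2ℤ -4ℤ -3ℤ -2ℤ : ℤ
  2ℤ = + 2
  -4ℤ = -[1+ 3 ]
  -3ℤ = -[1+ 2 ]
  -2ℤ = -[1+ 1 ]

  -- The offset d is needed for the telescoping in `∑-ratio`; d = 0 is the usual recurrence of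
  -- central binomials.
  central-step : ∀ m d →
    (+ suc m * + suc m - + d * + d) * binom (suc m ℕ.+ suc m) (suc m ℕ.+ d)
      ≡ + (suc m ℕ.+ suc m) * + suc (m ℕ.+ m) * binom (m ℕ.+ m) (m ℕ.+ d)
  central-step m d rewrite ℕ.+-suc m m = combine
    (+ m) (+ d) (binom (suc (suc (m ℕ.+ m))) (suc (m ℕ.+ d))) (binom (suc (m ℕ.+ m)) (m ℕ.+ d)) (binom (m ℕ.+ m) (m ℕ.+ d))
    (absorption (suc (m ℕ.+ m)) (m ℕ.+ d)) (absorption′ (m ℕ.+ m) (m ℕ.+ d))
    where
    factor : ∀ m d B → ((1ℤ + m) * (1ℤ + m) - d * d) * B ≡ (1ℤ + m - d) * ((1ℤ + (m + d)) * B)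
    factor = solve-∀
    swap : ∀ m d b → (1ℤ + m - d) * ((+ 2 + (m + m)) * b) ≡ (+ 2 + (m + m)) * ((1ℤ + (m + m) - (m + d)) * b)
    swap = solve-∀
    combine : ∀ m d B b c → (1ℤ + (m + d)) * B ≡ (+ 2 + (m + m)) * b →
      (1ℤ + (m + m) - (m + d)) * b ≡ (1ℤ + (m + m)) * c →
      ((1ℤ + m) * (1ℤ + m) - d * d) * B ≡ (+ 2 + (m + m)) * (1ℤ + (m + m)) * c
    combine m d B b c e₁ e₂ = trans (factor m d B) (trans (cong ((1ℤ + m - d) *_) e₁)
      (trans (swap m d b) (trans (cong ((+ 2 + (m + m)) *_) e₂) (sym (ℤ.*-assoc (+ 2 + (m + m)) (1ℤ + (m + m)) c)))))

  central-suc : ∀ m →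
    + suc m * + suc m * central (suc m) ≡ + (suc m ℕ.+ suc m) * + suc (m ℕ.+ m) * central m
  central-suc m = trans
    (cong₂ (λ x y → x * binom (suc m ℕ.+ suc m) y) (sym (ℤ.+-identityʳ (+ suc m * + suc m))) (sym (ℕ.+-identityʳ (suc m))))
    (trans (central-step m 0) (cong (λ y → + (suc m ℕ.+ suc m) * + suc (m ℕ.+ m) * binom (m ℕ.+ m) y) (ℕ.+-identityʳ m)))

  central-suc′ : ∀ m → + suc m * central (suc m) ≡ + 2 * + suc (m ℕ.+ m) * central m
  central-suc′ m = ℤ.*-cancelˡ-≡ (+ suc m) _ _ (trans (sym (ℤ.*-assoc (+ suc m) (+ suc m) (central (suc m))))
    (trans (central-suc m) (identity (+ suc m) (+ suc (m ℕ.+ m)) (central m))))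
    where
    identity : ∀ n k c → (n + n) * k * c ≡ n * (+ 2 * k * c)
    identity = solve-∀

  binom-suc : ∀ n k → + suc k * binom n (suc k) ≡ (+ n - + k) * binom n k
  binom-suc n k = trans (identity₁ (+ suc k) (binom n k) (binom n (suc k)))
    (trans (cong (λ b → + suc k * b - + suc k * binom n k) (sym (pascal n k)))
      (trans (cong (_- + suc k * binom n k) (absorption n k)) (identity₂ (+ n) (+ k) (binom n k))))
    where
    identity₁ : ∀ k a b → k * b ≡ k * (a + b) - k * a
    identity₁ = solve-∀
    identity₂ : ∀ n k a → (1ℤ + n) * a - (1ℤ + k) * a ≡ (n - k) * a
    identity₂ = solve-∀

  -- Since h ≡ -1/2, this is C(2m, m) = C(-1/2, m)(-4)^m. In the induction 2(2m + 1) and -4(h - m)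
  -- differ by exactly 2p.
  central-≋ : ∀ m → m ≤ h → central m ≋ binom h m * -4ℤ ^ m
  central-≋ zero    _   = ≡⇒≋ (trans (binom-0 0) (cong (_* 1ℤ) (sym (binom-0 h))))
  central-≋ (suc m) m<h = *-cancelˡ-< (s≤s z≤n) (m≤h⇒m<p m<h)
    (linear₂ (+ 2 * + suc (m ℕ.+ m)) (+ 2 * (b * s))
      (central-≋ m (ℕ.<⇒≤ m<h)) p≋0
      (trans (cong₂ (λ u v → u - v) (central-suc′ m)
               (trans (swap₁ (+ suc m) (binom h (suc m)) -4ℤ s) (cong (_* (-4ℤ * s)) (binom-suc h m))))
             (identity (+ m) (+ h) (central m) b s)))
    where
    b = binom h m
    s = -4ℤ ^ m
    swap₁ : ∀ n b x s → n * (b * (x * s)) ≡ n * b * (x * s)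
    swap₁ = solve-∀
    identity : ∀ m h c b s → + 2 * (1ℤ + (m + m)) * c - (h - m) * b * (-4ℤ * s)
      ≡ + 2 * (1ℤ + (m + m)) * (c - b * s) + + 2 * (b * s) * (1ℤ + (h + h) - 0ℤ)
    identity = solve-∀

  ∑-central-T : ∀ (a : ℕ → ℤ) → ∑ (suc h) (λ m → central m * a m) ≋ T -4ℤ h a
  ∑-central-T a = ≋-trans (∑-cong≋ (suc h) (λ { m (s≤s m≤h) → *-congʳ (a m) (central-≋ m m≤h) }))
    (≡⇒≋ (sym (T-∑ -4ℤ h a)))

  -- k-th terms of the odd and even parts of (1 + √y)ⁿ = Σₖ C(n,k) √yᵏ.
  oddPow evenPow : ℤ → ℕ → ℤ
  oddPow  y zero    = 0ℤ
  oddPow  y (suc k) = evenPow y k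
  evenPow y zero    = 1ℤ
  evenPow y (suc k) = y * oddPow y k

  oddPow-even : ∀ y i → oddPow y (i ℕ.+ i) ≡ 0ℤ
  oddPow-even y zero    = refl
  oddPow-even y (suc i) rewrite ℕ.+-suc i i = trans (cong (y *_) (oddPow-even y i)) (ℤ.*-zeroʳ y)

  oddPow-odd : ∀ y i → oddPow y (suc (i ℕ.+ i)) ≡ y ^ i
  oddPow-odd y zero    = refl
  oddPow-odd y (suc i) rewrite ℕ.+-suc i i = cong (y *_) (oddPow-odd y i)

  -- (1 + √y)^n = `evenPart y n` + `oddPart y n` √y, so that one step n ↦ n + 1 is multiplication by
  -- 1 + √y.
  oddPart evenPart : ℤ → ℕ → ℤ
  oddPart  y n = T 1ℤ n (oddPow y)
  evenPart y n = T 1ℤ n (evenPow y)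

  oddPart-suc : ∀ y n → oddPart y (suc n) ≡ oddPart y n + evenPart y n
  oddPart-suc y n = cong (λ t → oddPart y n + t) (ℤ.*-identityˡ (evenPart y n))

  T-scale : ∀ x n c (f : ℕ → ℤ) → T x n (λ k → c * f k) ≡ c * T x n f
  T-scale x zero    c f = refl
  T-scale x (suc n) c f = trans (cong₂ (λ u v → u + x * v) (T-scale x n c f) (T-scale x n c (f ∘ suc)))
    (identity x c (T x n f) (T x n (f ∘ suc)))
    where
    identity : ∀ x c u v → c * u + x * (c * v) ≡ c * (u + x * v)
    identity = solve-∀

  evenPart-suc : ∀ y n → evenPart y (suc n) ≡ evenPart y n + y * oddPart y n
  evenPart-suc y n = cong (λ t → evenPart y n + t)
    (trans (ℤ.*-identityˡ (T 1ℤ n (λ k → y * oddPow y k))) (T-scale 1ℤ n y (oddPow y)))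

  oddPart-1 : ∀ n → oddPart 1ℤ (suc n) ≡ 2ℤ ^ n
  evenPart-1 : ∀ n → evenPart 1ℤ (suc n) ≡ 2ℤ ^ n
  oddPart-1 zero    = refl
  oddPart-1 (suc n) = trans (oddPart-suc 1ℤ (suc n))
    (trans (cong₂ _+_ (oddPart-1 n) (evenPart-1 n)) (identity (2ℤ ^ n)))
    where
    identity : ∀ a → a + a ≡ + 2 * a
    identity = solve-∀
  evenPart-1 zero    = refl
  evenPart-1 (suc n) = trans (evenPart-suc 1ℤ (suc n))
    (trans (cong₂ (λ u v → u + 1ℤ * v) (evenPart-1 n) (oddPart-1 n)) (identity (2ℤ ^ n)))
    where
    identity : ∀ a → a + 1ℤ * a ≡ + 2 * a
    identity = solve-∀

  -- (1 + √-3)³ = -8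
  oddPart-3+ : ∀ n → oddPart -3ℤ (3 ℕ.+ n) ≡ -[1+ 7 ] * oddPart -3ℤ n
  oddPart-3+ n
    rewrite oddPart-suc -3ℤ (2 ℕ.+ n) | oddPart-suc -3ℤ (1 ℕ.+ n) | evenPart-suc -3ℤ (1 ℕ.+ n)
          | oddPart-suc -3ℤ n | evenPart-suc -3ℤ n = identity (oddPart -3ℤ n) (evenPart -3ℤ n)
    where
    identity : ∀ q r → q + r + (r + -3ℤ * q) + (r + -3ℤ * q + -3ℤ * (q + r)) ≡ -[1+ 7 ] * q
    identity = solve-∀

  oddPart-1+3g : ∀ g → oddPart -3ℤ (1 ℕ.+ g ℕ.* 3) ≡ -2ℤ ^ (g ℕ.* 3)
  oddPart-1+3g zero    = refl
  oddPart-1+3g (suc g) = trans (oddPart-3+ (1 ℕ.+ g ℕ.* 3))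
    (trans (cong (-[1+ 7 ] *_) (oddPart-1+3g g)) (identity (-2ℤ ^ (g ℕ.* 3))))
    where
    identity : ∀ a → -[1+ 7 ] * a ≡ -2ℤ * (-2ℤ * (-2ℤ * a))
    identity = solve-∀

  oddPart-2+3g : ∀ g → oddPart -3ℤ (2 ℕ.+ g ℕ.* 3) ≡ -1ℤ * -2ℤ ^ (1 ℕ.+ g ℕ.* 3)
  oddPart-2+3g zero    = refl
  oddPart-2+3g (suc g) = trans (oddPart-3+ (2 ℕ.+ g ℕ.* 3))
    (trans (cong (-[1+ 7 ] *_) (oddPart-2+3g g)) (identity (-2ℤ ^ (1 ℕ.+ g ℕ.* 3))))
    where
    identity : ∀ a → -[1+ 7 ] * (-1ℤ * a) ≡ -1ℤ * (-2ℤ * (-2ℤ * (-2ℤ * a)))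
    identity = solve-∀

  -- ε is the Legendre symbol (p/3).
  data Mod3 : ℤ → Set where
    one : ∀ g → h ℕ.+ h ≡ g ℕ.* 3     → Mod3 1ℤ
    two : ∀ g → h ℕ.+ h ≡ 1 ℕ.+ g ℕ.* 3 → Mod3 -1ℤ

  ε*ε≡1 : ∀ {ε} → Mod3 ε → ε * ε ≡ 1ℤ
  ε*ε≡1 (one g _) = refl
  ε*ε≡1 (two g _) = refl

  -2^2h : -2ℤ ^ (h ℕ.+ h) ≡ 2ℤ ^ (h ℕ.+ h)
  -2^2h = trans (ℤ.^-distribˡ-+-* -2ℤ h h) (trans (sym (^-distrib-* -2ℤ -2ℤ h))
    (trans (^-distrib-* 2ℤ 2ℤ h) (sym (ℤ.^-distribˡ-+-* 2ℤ h h))))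

  oddPart-p : ∀ {ε} → Mod3 ε → oddPart -3ℤ p ≡ ε * 2ℤ ^ (h ℕ.+ h)
  oddPart-p (one g 2h≡) = trans (cong (oddPart -3ℤ ∘ suc) 2h≡) (trans (oddPart-1+3g g)
    (trans (cong (-2ℤ ^_) (sym 2h≡)) (trans -2^2h (sym (ℤ.*-identityˡ (2ℤ ^ (h ℕ.+ h)))))))
  oddPart-p (two g 2h≡) = trans (cong (oddPart -3ℤ ∘ suc) 2h≡) (trans (oddPart-2+3g g)
    (cong (-1ℤ *_) (trans (cong (-2ℤ ^_) (sym 2h≡)) -2^2h)))

  oddPart-∑ : ∀ y → oddPart y p ≡ ∑ h (λ i → binom p (suc (i ℕ.+ i)) * y ^ i) + y ^ h
  oddPart-∑ y = trans (T-1 p (oddPow y)) (trans (cong (λ x → ∑ (suc x) f) (sym (ℕ.+-suc h h)))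
    (trans (∑-pairs (suc h) f) (cong₂ _+_ (∑-cong h (λ i _ → pair i))
      (trans (pair h) (trans (cong (_* y ^ h) (binom-n p)) (ℤ.*-identityˡ (y ^ h)))))))
    where
    f : ℕ → ℤ
    f k = binom p k * oddPow y k
    pair : ∀ i → f (i ℕ.+ i) + f (suc (i ℕ.+ i)) ≡ binom p (suc (i ℕ.+ i)) * y ^ i
    pair i = trans (cong₂ (λ u v → binom p (i ℕ.+ i) * u + binom p (suc (i ℕ.+ i)) * v) (oddPow-even y i) (oddPow-odd y i))
      (trans (cong (_+ binom p (suc (i ℕ.+ i)) * y ^ i) (ℤ.*-zeroʳ (binom p (i ℕ.+ i)))) (ℤ.+-identityˡ _))

  2i+1<p : ∀ {i} → i < h → suc (i ℕ.+ i) < p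
  2i+1<p i<h = s≤s (ℕ.+-mono-<-≤ i<h (ℕ.<⇒≤ i<h))

  2^2h≋1 : 2ℤ ^ (h ℕ.+ h) ≋ 1ℤ
  2^2h≋1 = fermat-unit (+k≉0 (s≤s z≤n) (m≤h⇒m<p 2≤h))

  -- Euler's criterion together with reciprocity for -3: modulo p only the top term (-3)^h of the
  -- odd part of (1 + √-3)^p survives.
  -3^h≋ε : ∀ {ε} → Mod3 ε → -3ℤ ^ h ≋ ε
  -3^h≋ε {ε} mod3 = begin
    -3ℤ ^ h            ≡⟨ ℤ.+-identityˡ (-3ℤ ^ h) ⟨
    0ℤ + -3ℤ ^ h       ≋⟨ +-congʳ (-3ℤ ^ h) (∑-zero≋ h (λ i i<h → ≋-trans
                            (*-congʳ (-3ℤ ^ i) (binom-p≋0 (i ℕ.+ i) (2i+1<p i<h))) (≡⇒≋ (ℤ.*-zeroˡ (-3ℤ ^ i))))) ⟨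
    ∑ h (λ i → binom p (suc (i ℕ.+ i)) * -3ℤ ^ i) + -3ℤ ^ h
                       ≡⟨ oddPart-∑ -3ℤ ⟨
    oddPart -3ℤ p      ≡⟨ oddPart-p mod3 ⟩
    ε * 2ℤ ^ (h ℕ.+ h)   ≋⟨ *-congˡ ε 2^2h≋1 ⟩
    ε * 1ℤ             ≡⟨ ℤ.*-identityʳ ε ⟩
    ε                  ∎

  -- The binomial theorem, integrated.
  T-1/suc : ∀ x n → suc n < p → + suc n * (x * T x n 1/suc) ≋ (1ℤ + x) ^ suc n - 1ℤ
  T-1/suc x n n<p = begin
    + suc n * (x * T x n 1/suc)
      ≡⟨ cong (λ t → + suc n * (x * t)) (T-∑ x n 1/suc) ⟩
    + suc n * (x * ∑ (suc n) (λ k → binom n k * x ^ k * 1/suc k))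
      ≡⟨ cong (+ suc n *_) (*-distribˡ-∑ (suc n) x (λ k → binom n k * x ^ k * 1/suc k)) ⟩
    + suc n * ∑ (suc n) (λ k → x * (binom n k * x ^ k * 1/suc k))
      ≡⟨ *-distribˡ-∑ (suc n) (+ suc n) (λ k → x * (binom n k * x ^ k * 1/suc k)) ⟩
    ∑ (suc n) (λ k → + suc n * (x * (binom n k * x ^ k * 1/suc k)))
      ≋⟨ ∑-cong≋ (suc n) (λ { k (s≤s k≤n) → term k (ℕ.≤-<-trans (s≤s k≤n) n<p) }) ⟩
    ∑ (suc n) (F ∘ suc)
      ≡⟨ identity (∑ (suc n) (F ∘ suc)) ⟩
    1ℤ * 1ℤ * 1ℤ + ∑ (suc n) (F ∘ suc) - 1ℤ
      ≡⟨ cong (λ b → b * 1ℤ * 1ℤ + ∑ (suc n) (F ∘ suc) - 1ℤ) (binom-0 (suc n)) ⟨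
    F 0 + ∑ (suc n) (F ∘ suc) - 1ℤ
      ≡⟨ cong (_- 1ℤ) (trans (sym (∑-front (suc n) F)) (trans (sym (T-∑ x (suc n) (λ _ → 1ℤ))) (T-one x (suc n)))) ⟩
    (1ℤ + x) ^ suc n - 1ℤ ∎
    where
    F : ℕ → ℤ
    F k = binom (suc n) k * x ^ k * 1ℤ
    identity : ∀ a → a ≡ 1ℤ * 1ℤ * 1ℤ + a - 1ℤ
    identity = solve-∀
    combine : ∀ N K x X b B v → N * (x * (b * X * v)) - B * (x * X) * 1ℤ
      ≡ B * (x * X) * (K * v - 1ℤ) + - (x * X * v) * (K * B - N * b)
    combine = solve-∀
    term : ∀ k → suc k < p → + suc n * (x * (binom n k * x ^ k * 1/suc k)) ≋ F (suc k)
    term k k<p = linear₂ (binom (suc n) (suc k) * (x * x ^ k)) (- (x * x ^ k * 1/suc k))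
      (1/suc-inverse k<p) (≡⇒≋ (absorption n k))
      (combine (+ suc n) (+ suc k) x (x ^ k) (binom n k) (binom (suc n) (suc k)) (1/suc k))

  -- With z = 1 + x, the transform at n + 1 is z times the one at n plus (z^{n+1} - 1)/(n + 1).
  -- Multiplying the sum by z shifts i, and the new summand is the one for i = 0.
  T-H₁-∑ : ∀ x n → n < p →
    T x n H₁ ≋ ∑ n (λ i → ((1ℤ + x) ^ n - (1ℤ + x) ^ i) * inv (+ (n ∸ i)))
  T-H₁-∑ x zero    _   = ≋-refl
  T-H₁-∑ x (suc n) n<p = begin
    T x n H₁ + x * T x n (λ k → H₁ k + 1/suc k)
      ≡⟨ cong (λ t → T x n H₁ + x * t) (trans
           (T-cong x n (λ k _ → sym (cong₂ _+_ (ℤ.*-identityˡ (H₁ k)) (ℤ.*-identityˡ (1/suc k)))))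
           (T-linear x n 1ℤ 1ℤ H₁ 1/suc)) ⟩
    T x n H₁ + x * (1ℤ * T x n H₁ + 1ℤ * T x n 1/suc)
      ≋⟨ linear₃ (1ℤ + x) (1/suc n) (- (x * T x n 1/suc)) (T-H₁-∑ x n (ℕ.<-trans (ℕ.n<1+n n) n<p))
           (T-1/suc x n n<p) (1/suc-inverse n<p)
           (combine (+ suc n) x (1/suc n) (T x n H₁) (T x n 1/suc) G (z ^ suc n)) ⟩
    (z ^ suc n - 1ℤ) * 1/suc n + z * G
      ≡⟨ cong (λ t → (z ^ suc n - 1ℤ) * 1/suc n + t) (trans (*-distribˡ-∑ n z _)
           (∑-cong n (λ i _ → factor z (z ^ n) (z ^ i) (inv (+ (n ∸ i)))))) ⟩
    (z ^ suc n - 1ℤ) * 1/suc n + ∑ n (λ i → (z ^ suc n - z ^ suc i) * inv (+ (n ∸ i)))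
      ≡⟨ ∑-front n (λ i → (z ^ suc n - z ^ i) * inv (+ (suc n ∸ i))) ⟨
    ∑ (suc n) (λ i → (z ^ suc n - z ^ i) * inv (+ (suc n ∸ i))) ∎
    where
    z = 1ℤ + x
    G = ∑ n (λ i → (z ^ n - z ^ i) * inv (+ (n ∸ i)))
    factor : ∀ z a b v → z * ((a - b) * v) ≡ (z * a - z * b) * v
    factor = solve-∀
    combine : ∀ n x w t u G Z → t + x * (1ℤ * t + 1ℤ * u) - ((Z - 1ℤ) * w + (1ℤ + x) * G)
      ≡ (1ℤ + x) * (t - G) + w * (n * (x * u) - (Z - 1ℤ)) + - (x * u) * (n * w - 1ℤ)
    combine = solve-∀

  -- 2(h - i) = p - (2i + 1), while (2i + 1) M = C(p - 1, 2i) ≡ (-1)^{2i} = 1.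
  half-reciprocal : ∀ i M → i < h → + suc (i ℕ.+ i) * M ≡ binom (h ℕ.+ h) (i ℕ.+ i) → inv (+ (h ∸ i)) ≋ -2ℤ * M
  half-reciprocal i M i<h [2i+1]M = ≋-sym (inv-unique (≋-trans (≡⇒≋ (cong (_* (-2ℤ * M)) h-i))
    (linear₃ (- M) 1ℤ 1ℤ p≋0 (≡⇒≋ [2i+1]M) b≋1 (combine (+ h) (+ i) M (binom (h ℕ.+ h) (i ℕ.+ i))))))
    where
    h-i : + (h ∸ i) ≡ + h - + i
    h-i = trans (sym (ℤ.⊖-≥ (ℕ.<⇒≤ i<h))) (sym (ℤ.m-n≡m⊖n h i))
    b≋1 : binom (h ℕ.+ h) (i ℕ.+ i) ≋ 1ℤ
    b≋1 = ≋-trans (binom-pred-p (i ℕ.+ i) (ℕ.<-trans (ℕ.n<1+n _) (2i+1<p i<h)))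
      (≡⇒≋ (trans (ℤ.^-distribˡ-+-* -1ℤ i i) (-1^m*-1^m≡1 i)))
    combine : ∀ h i M b → (h - i) * (-2ℤ * M) - 1ℤ ≡
      - M * (1ℤ + (h + h) - 0ℤ) + 1ℤ * ((1ℤ + (i + i)) * M - b) + 1ℤ * (b - 1ℤ)
    combine = solve-∀

  binom-p-quotient : ∀ i → i < h →
    ∃[ M ] binom p (suc (i ℕ.+ i)) ≡ + p * M × inv (+ (h ∸ i)) ≋ -2ℤ * M
  binom-p-quotient i i<h = M , pM , half-reciprocal i M i<h
    (ℤ.*-cancelˡ-≡ (+ p) (+ suc (i ℕ.+ i) * M) (binom (h ℕ.+ h) (i ℕ.+ i))
      (trans (swap (+ p) (+ suc (i ℕ.+ i)) M)
        (trans (cong (+ suc (i ℕ.+ i) *_) (sym pM)) (absorption (h ℕ.+ h) (i ℕ.+ i)))))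
    where
    p∣binom : binom p (suc (i ℕ.+ i)) ≋ 0ℤ
    p∣binom = binom-p≋0 (i ℕ.+ i) (2i+1<p i<h)
    M = _≋_.quotient p∣binom
    pM : binom p (suc (i ℕ.+ i)) ≡ + p * M
    pM = trans (sym (ℤ.+-identityʳ (binom p (suc (i ℕ.+ i))))) (_≋_.difference p∣binom)
    swap : ∀ a b c → a * (b * c) ≡ b * (a * c)
    swap = solve-∀

  -- The first component is an exact equality on purpose: X modulo p requires the binomial sum
  -- modulo p².
  ∑-binom-p-quotient : ∀ (c : ℕ → ℤ) n → n ≤ h →
    ∃[ X ] ∑ n (λ i → binom p (suc (i ℕ.+ i)) * c i) ≡ + p * X × ∑ n (λ i → c i * inv (+ (h ∸ i))) ≋ -2ℤ * X
  ∑-binom-p-quotient c zero    _ = 0ℤ , sym (ℤ.*-zeroʳ (+ p)) , ≋-refl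
  ∑-binom-p-quotient c (suc n) n<h = extend (∑-binom-p-quotient c n (ℕ.<⇒≤ n<h)) (binom-p-quotient n n<h)
    where
    factor : ∀ p X M c → p * X + p * M * c ≡ p * (X + M * c)
    factor = solve-∀
    combine : ∀ s c v X M → s + c * v - -2ℤ * (X + M * c) ≡ 1ℤ * (s - -2ℤ * X) + c * (v - -2ℤ * M)
    combine = solve-∀
    s = ∑ n (λ i → binom p (suc (i ℕ.+ i)) * c i)
    t = ∑ n (λ i → c i * inv (+ (h ∸ i)))
    b = binom p (suc (n ℕ.+ n))
    v = inv (+ (h ∸ n))
    extend : ∃[ X ] s ≡ + p * X × t ≋ -2ℤ * X → ∃[ M ] b ≡ + p * M × v ≋ -2ℤ * M →
      ∃[ X ] s + b * c n ≡ + p * X × t + c n * v ≋ -2ℤ * X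
    extend (X , e , X≋) (M , e′ , M≋) = X + M * c n ,
      trans (cong₂ (λ u w → u + w * c n) e e′) (factor (+ p) X M (c n)) ,
      linear₂ 1ℤ (c n) X≋ M≋ (combine t (c n) v X M)

  -- With y - ε = pN and A = 2^{p-1}, both quotients by p are explicit: K = N(y + ε) and X = NA. The
  -- sum is then -4X ≡ -4N, and -2εK ≡ -2εN · 2ε = -4N.
  ∑-central-H₁ : ∀ {ε} → Mod3 ε →
    ∃[ K ] (+ 3) ^ (h ℕ.+ h) - 1ℤ ≡ + p * K × ∑ (suc h) (λ m → central m * (+ 2 * H₁ m)) ≋ -2ℤ * ε * K
  ∑-central-H₁ {ε} mod3
    = N * (y + ε) , pK , (begin
    ∑ (suc h) (λ m → central m * (+ 2 * H₁ m))
      ≡⟨ ∑-cong (suc h) (λ m _ → swap (central m) (H₁ m)) ⟩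
    ∑ (suc h) (λ m → + 2 * (central m * H₁ m))
      ≡⟨ *-distribˡ-∑ (suc h) (+ 2) (λ m → central m * H₁ m) ⟨
    + 2 * ∑ (suc h) (λ m → central m * H₁ m)
      ≋⟨ *-congˡ (+ 2) (≋-trans (∑-central-T H₁) (≋-trans (T-H₁-∑ -4ℤ h (m≤h⇒m<p ℕ.≤-refl)) sum≋-2X)) ⟩
    + 2 * (-2ℤ * X)
      ≡⟨ cong (λ t → + 2 * (-2ℤ * t)) X≡ ⟩
    + 2 * (-2ℤ * (N * A))
      ≋⟨ linear₃ (+ 2 * -2ℤ * N) (+ 2 * ε * N) (+ 4 * N) 2^2h≋1 (-3^h≋ε mod3) (≡⇒≋ (ε*ε≡1 mod3)) (combine N A y ε) ⟩
    -2ℤ * ε * (N * (y + ε)) ∎)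
    where
    y = -3ℤ ^ h
    quotients = ∑-binom-p-quotient (λ i → -3ℤ ^ h - -3ℤ ^ i) h ℕ.≤-refl
    X = proj₁ quotients
    pX = proj₁ (proj₂ quotients)
    sum≋-2X = proj₂ (proj₂ quotients)
    N = _≋_.quotient (-3^h≋ε mod3)
    pN = _≋_.difference (-3^h≋ε mod3)
    A = 2ℤ ^ (h ℕ.+ h)
    f : ℕ → ℤ
    f i = binom p (suc (i ℕ.+ i))
    swap : ∀ c H → c * (+ 2 * H) ≡ + 2 * (c * H)
    swap = solve-∀
    combine : ∀ N A y ε → + 2 * (-2ℤ * (N * A)) - -2ℤ * ε * (N * (y + ε))
      ≡ + 2 * -2ℤ * N * (A - 1ℤ) + + 2 * ε * N * (y - ε) + + 4 * N * (ε * ε - 1ℤ)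
    combine = solve-∀
    square : y * y ≡ (+ 3) ^ (h ℕ.+ h)
    square = trans (sym (^-distrib-* -3ℤ -3ℤ h)) (trans (^-distrib-* (+ 3) (+ 3) h) (sym (ℤ.^-distribˡ-+-* (+ 3) h h)))
    pK : (+ 3) ^ (h ℕ.+ h) - 1ℤ ≡ + p * (N * (y + ε))
    pK = trans (cong₂ _-_ (sym square) (sym (ε*ε≡1 mod3)))
      (trans (difference-of-squares y ε) (trans (cong (_* (y + ε)) pN) (ℤ.*-assoc (+ p) N (y + ε))))
      where
      difference-of-squares : ∀ y ε → y * y - ε * ε ≡ (y - ε) * (y + ε)
      difference-of-squares = solve-∀
    separate : ∀ n → ∑ n (λ i → f i * (y - -3ℤ ^ i)) ≡ y * ∑ n (λ i → f i * 1ℤ ^ i) - ∑ n (λ i → f i * -3ℤ ^ i)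
    separate zero    = sym (trans (ℤ.+-identityʳ (y * 0ℤ)) (ℤ.*-zeroʳ y))
    separate (suc n) = trans (cong (_+ f n * (y - -3ℤ ^ n)) (separate n))
      (trans (identity y (∑ n (λ i → f i * 1ℤ ^ i)) (∑ n (λ i → f i * -3ℤ ^ i)) (f n) (-3ℤ ^ n))
        (cong (λ t → y * (∑ n (λ i → f i * 1ℤ ^ i) + f n * t) - (∑ n (λ i → f i * -3ℤ ^ i) + f n * -3ℤ ^ n)) (sym (ℤ.^-zeroˡ n))))
      where
      identity : ∀ y a b f t → y * a - b + f * (y - t) ≡ y * (a + f * 1ℤ) - (b + f * t)
      identity = solve-∀
    X≡ : X ≡ N * A
    X≡ = ℤ.*-cancelˡ-≡ (+ p) X (N * A) (trans (sym pX) (trans (separate h)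
      -- The top terms of the two odd parts are inserted to complete them; weighted by y and -1 they
      -- cancel.
      (trans (rearrange y (∑ h (λ i → f i * 1ℤ ^ i)) (1ℤ ^ h) (∑ h (λ i → f i * -3ℤ ^ i)))
        (trans (cong₂ (λ u v → y * (u - 1ℤ ^ h) - (v - y))
            (trans (sym (oddPart-∑ 1ℤ)) (oddPart-1 (h ℕ.+ h)))
            (trans (sym (oddPart-∑ -3ℤ)) (oddPart-p mod3)))
          (trans (cong (λ t → y * (A - t) - (ε * A - y)) (ℤ.^-zeroˡ h))
            (trans (factor y A ε) (trans (cong (_* A) pN) (ℤ.*-assoc (+ p) N A))))))))
      where
      rearrange : ∀ y a c b → y * a - b ≡ y * (a + c - c) - (b + y - y)
      rearrange = solve-∀
      factor : ∀ y A ε → y * (A - 1ℤ) - (ε * A - y) ≡ (y - ε) * A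
      factor = solve-∀

  -- Inverse squares with weights of period 3

  per : ℤ → ℤ → ℤ → ℕ → ℤ
  per a b c zero    = a
  per a b c (suc n) = per b c a n

  per-sum : ∀ a b c n → per a b c n + per a b c (1 ℕ.+ n) + per a b c (2 ℕ.+ n) ≡ a + b + c
  per-sum a b c zero    = refl
  per-sum a b c (suc n) = trans (per-sum b c a n) (rotate a b c)
    where
    rotate : ∀ a b c → b + c + a ≡ a + b + c
    rotate = solve-∀

  per-linear : ∀ a b c n →
    per a b c n ≡ a * per 1ℤ 0ℤ 0ℤ n + b * per 0ℤ 1ℤ 0ℤ n + c * per 0ℤ 0ℤ 1ℤ n
  per-linear a b c zero    = identity a b c
    where
    identity : ∀ a b c → a ≡ a * 1ℤ + b * 0ℤ + c * 0ℤ
    identity = solve-∀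
  per-linear a b c (suc n) = trans (per-linear b c a n)
    (rotate (a * per 0ℤ 0ℤ 1ℤ n) (b * per 1ℤ 0ℤ 0ℤ n) (c * per 0ℤ 1ℤ 0ℤ n))
    where
    rotate : ∀ a b c → b + c + a ≡ a + b + c
    rotate = solve-∀

  per-double : ∀ a b c n → per a b c (n ℕ.+ n) ≡ per a c b n
  per-double a b c zero    = refl
  per-double a b c (suc n) = trans (cong (per b c a) (ℕ.+-suc n n)) (per-double c a b n)

  -- The weights of e ↦ n - e at e = 0, 1, 2; the arguments n + 2 and n + 1 stand for n - 1 and n -
  -- 2 modulo 3.
  per-reflect : ∀ a b c e f → let n = e ℕ.+ f in
    per a b c f ≡ per (per a b c n) (per a b c (2 ℕ.+ n)) (per a b c (1 ℕ.+ n)) e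
  per-reflect a b c zero    f = refl
  per-reflect a b c (suc e) f = per-reflect a b c e f

  per-*3 : ∀ a b c g → per a b c (g ℕ.* 3) ≡ a
  per-*3 a b c zero    = refl
  per-*3 a b c (suc g) = per-*3 a b c g

  ∑-reflect : ∀ (φ : ℕ → ℤ) → ∑ (h ℕ.+ h) (φ ∘ suc) ≡ ∑ h (λ i → φ (suc i) + φ (p ∸ suc i))
  ∑-reflect φ = trans (∑-++ h h (φ ∘ suc)) (trans
    (cong (λ t → ∑ h (φ ∘ suc) + t) (trans (∑-reverse h (λ i → φ (suc (h ℕ.+ i))))
      (∑-cong h (λ i i<h → cong φ (sym (trans (ℕ.+-∸-assoc (suc h) i<h) refl))))))
    (sym (∑-distrib-+ h (φ ∘ suc) (λ i → φ (p ∸ suc i)))))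

  -- As p is odd, p - 2e runs through the odd numbers below p while 2e runs through the even ones.
  ∑-parity : ∀ (φ : ℕ → ℤ) →
    ∑ (h ℕ.+ h) (φ ∘ suc) ≡ ∑ h (λ i → φ (suc i ℕ.+ suc i) + φ (p ∸ (suc i ℕ.+ suc i)))
  ∑-parity φ = trans (∑-pairs h (φ ∘ suc)) (trans
    (∑-distrib-+ h (λ i → φ (suc (i ℕ.+ i))) (λ i → φ (suc (suc (i ℕ.+ i))))) (trans
    (ℤ.+-comm (∑ h (λ i → φ (suc (i ℕ.+ i)))) (∑ h (λ i → φ (suc (suc (i ℕ.+ i))))))
    (trans (cong₂ _+_
        (∑-cong h (λ i _ → cong (φ ∘ suc) (sym (ℕ.+-suc i i))))
        (trans (∑-reverse h (λ i → φ (suc (i ℕ.+ i)))) (∑-cong h (λ i i<h → cong φ (odd i<h)))))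
      (sym (∑-distrib-+ h (λ i → φ (suc i ℕ.+ suc i)) (λ i → φ (p ∸ (suc i ℕ.+ suc i))))))))
    where
    odd : ∀ {i} → i < h → suc ((h ∸ suc i) ℕ.+ (h ∸ suc i)) ≡ p ∸ (suc i ℕ.+ suc i)
    odd {i} i<h = sym (trans (cong (_∸ (suc i ℕ.+ suc i)) p≡) (ℕ.m+n∸n≡m (suc (r ℕ.+ r)) (suc i ℕ.+ suc i)))
      where
      r = h ∸ suc i
      r+i≡h : r ℕ.+ suc i ≡ h
      r+i≡h = ℕ.m∸n+n≡m i<h
      p≡ : p ≡ suc (r ℕ.+ r) ℕ.+ (suc i ℕ.+ suc i)
      p≡ = cong suc (trans (sym (cong₂ ℕ._+_ r+i≡h r+i≡h)) (interchange r (suc i)))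
        where
        interchange : ∀ a b → (a ℕ.+ b) ℕ.+ (a ℕ.+ b) ≡ (a ℕ.+ a) ℕ.+ (b ℕ.+ b)
        interchange = ℕ-solve-∀

  inv² : ℕ → ℤ
  inv² d = inv (+ d * + d)

  inv²-H₂ : ∀ n → ∑ n (inv² ∘ suc) ≡ H₂ n
  inv²-H₂ n = ∑-cong n (λ i _ → inv-* (+ suc i) (+ suc i))

  inv²-inverse : ∀ {d} → 0 < d → d < p → + d * + d * inv² d ≋ 1ℤ
  inv²-inverse {d} 0<d d<p = linear₂ (+ d * inv (+ d)) 1ℤ (inv-inverse-< 0<d d<p) (inv-inverse-< 0<d d<p)
    (trans (cong (λ t → + d * + d * t - 1ℤ) (inv-* (+ d) (+ d))) (identity (+ d) (inv (+ d))))
    where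
    identity : ∀ d v → d * d * (v * v) - 1ℤ ≡ d * v * (d * v - 1ℤ) + 1ℤ * (d * v - 1ℤ)
    identity = solve-∀

  inv²-scale : ∀ k d → inv² (k ℕ.* d) ≡ inv² k * inv² d
  inv²-scale k d = trans (cong inv (trans (cong₂ _*_ (ℤ.pos-* k d) (ℤ.pos-* k d)) (interchange (+ k) (+ d))))
    (inv-* (+ k * + k) (+ d * + d))
    where
    interchange : ∀ k d → k * d * (k * d) ≡ k * k * (d * d)
    interchange = solve-∀

  inv²-reflect : ∀ {d e} → d ℕ.+ e ≡ p → inv² e ≋ inv² d
  inv²-reflect {d} {e} d+e≡p = inv-cong (linear₁ (+ e - + d) (≋-trans (≡⇒≋ (cong +_ d+e≡p)) p≋0) (identity (+ d) (+ e)))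
    where
    identity : ∀ d e → e * e - d * d ≡ (e - d) * (d + e - 0ℤ)
    identity = solve-∀

  ¼ : ℤ
  ¼ = inv² 2

  4*¼≋1 : + 4 * ¼ ≋ 1ℤ
  4*¼≋1 = inv²-inverse (s≤s z≤n) (m≤h⇒m<p 2≤h)

  inv²-double : ∀ d → inv² (d ℕ.+ d) ≡ ¼ * inv² d
  inv²-double d = trans (cong inv² (cong (d ℕ.+_) (sym (ℕ.+-identityʳ d)))) (inv²-scale 2 d)

  half : (ℕ → ℤ) → ℤ
  half w = ∑ h (λ i → w (suc i) * inv² (suc i))

  half-per : ∀ a b c → half (per a b c)
    ≡ a * half (per 1ℤ 0ℤ 0ℤ) + b * half (per 0ℤ 1ℤ 0ℤ) + c * half (per 0ℤ 0ℤ 1ℤ)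
  half-per a b c = go h
    where
    S : (ℕ → ℤ) → ℕ → ℤ
    S w n = ∑ n (λ i → w (suc i) * inv² (suc i))
    identity : ∀ a b c x y z u v w s →
      a * x + b * y + c * z + (a * u + b * v + c * w) * s ≡ a * (x + u * s) + b * (y + v * s) + c * (z + w * s)
    identity = solve-∀
    identity₀ : ∀ a b c → 0ℤ ≡ a * 0ℤ + b * 0ℤ + c * 0ℤ
    identity₀ = solve-∀
    go : ∀ n → S (per a b c) n ≡ a * S (per 1ℤ 0ℤ 0ℤ) n + b * S (per 0ℤ 1ℤ 0ℤ) n + c * S (per 0ℤ 0ℤ 1ℤ) n
    go zero    = identity₀ a b c
    go (suc n) = trans (cong₂ (λ x y → x + y * inv² (suc n)) (go n) (per-linear a b c (suc n)))
      (identity a b c (S (per 1ℤ 0ℤ 0ℤ) n) (S (per 0ℤ 1ℤ 0ℤ) n) (S (per 0ℤ 0ℤ 1ℤ) n)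
        (per 1ℤ 0ℤ 0ℤ (suc n)) (per 0ℤ 1ℤ 0ℤ (suc n)) (per 0ℤ 0ℤ 1ℤ (suc n)) (inv² (suc n)))

  e+[p∸e]≡p : ∀ {i} → i < h → suc i ℕ.+ (p ∸ suc i) ≡ p
  e+[p∸e]≡p i<h = ℕ.m+[n∸m]≡n (s≤s (ℕ.≤-trans (ℕ.<⇒≤ i<h) (ℕ.m≤m+n h h)))

  2e+[p∸2e]≡p : ∀ {i} → i < h → (suc i ℕ.+ suc i) ℕ.+ (p ∸ (suc i ℕ.+ suc i)) ≡ p
  2e+[p∸2e]≡p i<h = ℕ.m+[n∸m]≡n (ℕ.<⇒≤ (m≤h⇒m+m<p i<h))

  -1^-reflect : ∀ d e → d ℕ.+ e ≡ p → -1ℤ ^ e ≡ -1ℤ * -1ℤ ^ d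
  -1^-reflect d e d+e≡p = trans (identity (-1ℤ ^ e)) (trans (cong (_* -1ℤ ^ e) (sym (-1^m*-1^m≡1 d)))
      (trans (regroup (-1ℤ ^ d) (-1ℤ ^ e)) (trans (cong (-1ℤ ^ d *_)
        (trans (sym (ℤ.^-distribˡ-+-* -1ℤ d e)) (trans (cong (-1ℤ ^_) d+e≡p)
          (cong (-1ℤ *_) (trans (ℤ.^-distribˡ-+-* -1ℤ h h) (-1^m*-1^m≡1 h))))))
        (ℤ.*-comm (-1ℤ ^ d) (-1ℤ * 1ℤ)))))
    where
    identity : ∀ a → a ≡ 1ℤ * a
    identity = solve-∀
    regroup : ∀ a b → a * a * b ≡ a * (a * b)
    regroup = solve-∀

  -- Sums over 0 < d < p are evaluated in two ways: pairing d with p − d, and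
  -- pairing 2e with p − 2e.  Comparing the two yields the relations needed.
  module Periodic (a b c : ℤ) where
    a′ b′ c′ : ℤ
    a′ = per a b c p
    b′ = per a b c (2 ℕ.+ p)
    c′ = per a b c (1 ℕ.+ p)

    w w′ : ℕ → ℤ
    w  = per a b c
    w′ = per a′ b′ c′

    reflected : ∀ d e → d ℕ.+ e ≡ p → w e ≡ w′ d
    reflected d e d+e≡p = trans (per-reflect a b c d e)
      (cong (λ n → per (per a b c n) (per a b c (2 ℕ.+ n)) (per a b c (1 ℕ.+ n)) d) d+e≡p)

    full : ℤ
    full = ∑ (h ℕ.+ h) (λ i → w (suc i) * inv² (suc i))

    alternating : ℤ
    alternating = ∑ (h ℕ.+ h) (λ i → -1ℤ ^ suc i * w (suc i) * inv² (suc i))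

    full-reflect : full ≋ half w + half w′
    full-reflect = ≋-trans (≡⇒≋ (∑-reflect (λ d → w d * inv² d)))
      (≋-trans (∑-cong≋ h (λ i i<h → +-congˡ (w (suc i) * inv² (suc i))
          (*-cong (≡⇒≋ (reflected (suc i) (p ∸ suc i) (e+[p∸e]≡p i<h)))
                  (inv²-reflect {suc i} {p ∸ suc i} (e+[p∸e]≡p i<h)))))
        (≡⇒≋ (∑-distrib-+ h (λ i → w (suc i) * inv² (suc i)) (λ i → w′ (suc i) * inv² (suc i)))))

    full-parity : full ≋ ¼ * (half (per a c b) + half (per a′ c′ b′))
    full-parity = ≋-trans (≡⇒≋ (∑-parity (λ d → w d * inv² d)))
      (≋-trans (∑-cong≋ h term)
        (≡⇒≋ (trans (sym (*-distribˡ-∑ h ¼ _)) (cong (¼ *_)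
          (∑-distrib-+ h (λ i → per a c b (suc i) * inv² (suc i)) (λ i → per a′ c′ b′ (suc i) * inv² (suc i)))))))
      where
      identity : ∀ u v q s → u * (q * s) + v * (q * s) ≡ q * (u * s + v * s)
      identity = solve-∀
      term : ∀ i → i < h → w (suc i ℕ.+ suc i) * inv² (suc i ℕ.+ suc i)
          + w (p ∸ (suc i ℕ.+ suc i)) * inv² (p ∸ (suc i ℕ.+ suc i))
        ≋ ¼ * (per a c b (suc i) * inv² (suc i) + per a′ c′ b′ (suc i) * inv² (suc i))
      term i i<h = ≋-trans
        (+-cong (*-cong (≡⇒≋ (per-double a b c (suc i))) (≡⇒≋ (inv²-double (suc i))))
          (*-cong (≡⇒≋ (trans (reflected (suc i ℕ.+ suc i) _ (2e+[p∸2e]≡p i<h)) (per-double a′ b′ c′ (suc i))))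
            (≋-trans (inv²-reflect {suc i ℕ.+ suc i} (2e+[p∸2e]≡p i<h)) (≡⇒≋ (inv²-double (suc i))))))
        (≡⇒≋ (identity (per a c b (suc i)) (per a′ c′ b′ (suc i)) ¼ (inv² (suc i))))

    -- The numbers d and p - d have opposite parity, which produces the difference of weights; this
    -- difference later serves as the coefficients of the tail expansion.
    alternating-reflect : alternating ≋ half (λ d → -1ℤ ^ d * (w d - w′ d))
    alternating-reflect = ≋-trans (≡⇒≋ (∑-reflect (λ d → -1ℤ ^ d * w d * inv² d))) (∑-cong≋ h term)
      where
      identity : ∀ x u v s → x * u * s + -1ℤ * x * v * s ≡ x * (u - v) * s
      identity = solve-∀
      term : ∀ i → i < h → -1ℤ ^ suc i * w (suc i) * inv² (suc i) + -1ℤ ^ (p ∸ suc i) * w (p ∸ suc i) * inv² (p ∸ suc i)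
        ≋ -1ℤ ^ suc i * (w (suc i) - w′ (suc i)) * inv² (suc i)
      term i i<h = ≋-trans (+-congˡ (-1ℤ ^ suc i * w (suc i) * inv² (suc i))
          (*-cong (≡⇒≋ (cong₂ _*_ (-1^-reflect (suc i) (p ∸ suc i) (e+[p∸e]≡p i<h))
                                   (reflected (suc i) (p ∸ suc i) (e+[p∸e]≡p i<h))))
                  (inv²-reflect {suc i} {p ∸ suc i} (e+[p∸e]≡p i<h))))
        (≡⇒≋ (identity (-1ℤ ^ suc i) (w (suc i)) (w′ (suc i)) (inv² (suc i))))

    alternating-parity : alternating ≋ ¼ * (half (per a c b) - half (per a′ c′ b′))
    alternating-parity = ≋-trans (≡⇒≋ (∑-parity (λ d → -1ℤ ^ d * w d * inv² d)))
      (≋-trans (∑-cong≋ h term)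
        (≡⇒≋ (trans (sym (*-distribˡ-∑ h ¼ _)) (cong (¼ *_) (trans
          (∑-distrib-+ h (λ i → per a c b (suc i) * inv² (suc i)) (λ i → -1ℤ * (per a′ c′ b′ (suc i) * inv² (suc i))))
          (cong (λ t → half (per a c b) + t)
            (trans (sym (*-distribˡ-∑ h -1ℤ _)) (ℤ.-1*i≡-i (half (per a′ c′ b′))))))))))
      where
      identity : ∀ u v q s → 1ℤ * u * (q * s) + -1ℤ * 1ℤ * v * (q * s) ≡ q * (u * s + -1ℤ * (v * s))
      identity = solve-∀
      -1^2e : ∀ i → -1ℤ ^ (suc i ℕ.+ suc i) ≡ 1ℤ
      -1^2e i = trans (ℤ.^-distribˡ-+-* -1ℤ (suc i) (suc i)) (-1^m*-1^m≡1 (suc i))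
      term : ∀ i → i < h → -1ℤ ^ (suc i ℕ.+ suc i) * w (suc i ℕ.+ suc i) * inv² (suc i ℕ.+ suc i)
          + -1ℤ ^ (p ∸ (suc i ℕ.+ suc i)) * w (p ∸ (suc i ℕ.+ suc i)) * inv² (p ∸ (suc i ℕ.+ suc i))
        ≋ ¼ * (per a c b (suc i) * inv² (suc i) + -1ℤ * (per a′ c′ b′ (suc i) * inv² (suc i)))
      term i i<h = ≋-trans
        (+-cong (*-cong (≡⇒≋ (cong₂ _*_ (-1^2e i) (per-double a b c (suc i)))) (≡⇒≋ (inv²-double (suc i))))
          (*-cong (≡⇒≋ (cong₂ _*_
              (trans (-1^-reflect (suc i ℕ.+ suc i) _ (2e+[p∸2e]≡p i<h)) (cong (-1ℤ *_) (-1^2e i)))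
              (trans (reflected (suc i ℕ.+ suc i) _ (2e+[p∸2e]≡p i<h)) (per-double a′ b′ c′ (suc i)))))
            (≋-trans (inv²-reflect {suc i ℕ.+ suc i} (2e+[p∸2e]≡p i<h)) (≡⇒≋ (inv²-double (suc i))))))
        (≡⇒≋ (identity (per a c b (suc i)) (per a′ c′ b′ (suc i)) ¼ (inv² (suc i))))

  -- Tails of the central binomial sum and summation by parts

  shifted : ℕ → ℕ → ℤ
  shifted m i = binom (m ℕ.+ m) (m ℕ.+ i)

  shifted-0 : ∀ m → shifted m 0 ≡ central m
  shifted-0 m = cong (binom (m ℕ.+ m)) (ℕ.+-identityʳ m)

  shifted-> : ∀ {m i} → m < i → shifted m i ≡ 0ℤ
  shifted-> {m} m<i = binom-> (ℕ.+-monoʳ-< m m<i)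

  shifted-suc : ∀ m i → shifted (suc m) (suc i) ≡ shifted m i + + 2 * shifted m (1 ℕ.+ i) + shifted m (2 ℕ.+ i)
  shifted-suc m i = trans
    (cong₂ (λ x y → binom (suc x) (suc y)) (ℕ.+-suc m m) (ℕ.+-suc m i))
    (trans (pascal² (m ℕ.+ m) (m ℕ.+ i))
      (cong₂ (λ x y → shifted m i + + 2 * binom (m ℕ.+ m) x + binom (m ℕ.+ m) y)
        (sym (ℕ.+-suc m i)) (sym (trans (ℕ.+-suc m (suc i)) (cong suc (ℕ.+-suc m i))))))
    where
    identity : ∀ a b c → (a + b) + (b + c) ≡ a + + 2 * b + c
    identity = solve-∀
    pascal² : ∀ n k → binom (2 ℕ.+ n) (2 ℕ.+ k) ≡ binom n k + + 2 * binom n (1 ℕ.+ k) + binom n (2 ℕ.+ k)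
    pascal² n k = trans (pascal (suc n) (suc k)) (trans (cong₂ _+_ (pascal n k) (pascal n (suc k)))
      (identity (binom n k) (binom n (1 ℕ.+ k)) (binom n (2 ℕ.+ k))))

  -- The case d = 0 of the double Pascal step, where C(2m, m - 1) is folded onto C(2m, m + 1).
  central-suc-shifted : ∀ m → central (suc m) ≡ + 2 * shifted m 0 + + 2 * shifted m 1
  central-suc-shifted m = trans (pascal (m ℕ.+ suc m) m) (trans
    (cong (_+ binom (m ℕ.+ suc m) (suc m)) (binom-sym-+ m (suc m)))
    (trans (cong (λ t → t + t) middle) (identity (shifted m 0) (shifted m 1))))
    where
    identity : ∀ a b → (a + b) + (a + b) ≡ + 2 * a + + 2 * b
    identity = solve-∀
    middle : binom (m ℕ.+ suc m) (suc m) ≡ shifted m 0 + shifted m 1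
    middle = trans (cong (λ x → binom x (suc m)) (ℕ.+-suc m m)) (trans (pascal (m ℕ.+ m) m)
      (cong₂ (λ x y → binom (m ℕ.+ m) x + binom (m ℕ.+ m) y)
        (sym (ℕ.+-identityʳ m)) (sym (trans (ℕ.+-suc m 0) (cong suc (ℕ.+-identityʳ m))))))

  inv-central-suc : ∀ m → m < h →
    + (suc m ℕ.+ suc m) * + suc (m ℕ.+ m) * inv-central (suc m) ≋ + suc m * + suc m * inv-central m
  inv-central-suc m m<h = linear₃ (- (K * κ′)) (- (κ * κ′)) (n² * κ)
    (central-inverse m (ℕ.<⇒≤ m<h)) (≡⇒≋ (central-suc m)) (central-inverse (suc m) m<h)
    (identity K n² (central m) (central (suc m)) κ κ′)
    where
    K = + (suc m ℕ.+ suc m) * + suc (m ℕ.+ m)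
    n² = + suc m * + suc m
    κ = inv-central m
    κ′ = inv-central (suc m)
    identity : ∀ K n C C′ κ κ′ → K * κ′ - n * κ ≡
      - (K * κ′) * (C * κ - 1ℤ) + - (κ * κ′) * (n * C′ - K * C) + n * κ * (C′ * κ′ - 1ℤ)
    identity = solve-∀

  -- With A(m) = C(2m, m + d) / C(2m, m), the sum telescopes: A(m) − A(m − 1) = (d/m)² A(m).
  ∑-ratio : ∀ i → i < h → ∀ n → n ≤ h →
    ∑ n (λ m → shifted (suc m) (suc i) * inv-central (suc m) * inv² (suc m))
      ≋ inv² (suc i) * (shifted n (suc i) * inv-central n)
  ∑-ratio i i<h zero    _   = ≡⇒≋ (sym (trans
    (cong (λ t → inv² (suc i) * (t * inv-central 0)) (shifted-> {0} {suc i} (s≤s z≤n))) (identity (inv² (suc i)) (inv-central 0))))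
    where
    identity : ∀ s κ → s * (0ℤ * κ) ≡ 0ℤ
    identity = solve-∀
  ∑-ratio i i<h (suc n) n<h = ≋-trans
    (+-congʳ (A′ * inv² (suc n)) (∑-ratio i i<h n (ℕ.<⇒≤ n<h)))
    (linear₃ (inv² (suc i) * inv² (suc n)) (- (inv² (suc i) * (A - A′))) (- (A′ * inv² (suc n)))
      ratio-step (inv²-inverse (s≤s z≤n) (m≤h⇒m<p n<h)) (inv²-inverse (s≤s z≤n) (m≤h⇒m<p i<h))
      (identity (+ suc n) (+ suc i) (inv² (suc n)) (inv² (suc i)) A A′))
    where
    A A′ : ℤ
    A  = shifted n (suc i) * inv-central n
    A′ = shifted (suc n) (suc i) * inv-central (suc n)
    identity : ∀ n d w v A A′ → v * A + A′ * w - v * A′ ≡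
      v * w * (n * n * A - (n * n - d * d) * A′) + - (v * (A - A′)) * (n * n * w - 1ℤ) + - (A′ * w) * (d * d * v - 1ℤ)
    identity = solve-∀
    combine : ∀ K n² D B B′ κ κ′ → n² * (B * κ) - D * (B′ * κ′) ≡
      - B * (K * κ′ - n² * κ) + - κ′ * (D * B′ - K * B)
    combine = solve-∀
    ratio-step : + suc n * + suc n * A ≋ (+ suc n * + suc n - + suc i * + suc i) * A′
    ratio-step = linear₂ (- shifted n (suc i)) (- inv-central (suc n)) (inv-central-suc n n<h) (≡⇒≋ (central-step n (suc i)))
      (combine (+ (suc n ℕ.+ suc n) * + suc (n ℕ.+ n)) (+ suc n * + suc n) (+ suc n * + suc n - + suc i * + suc i)
        (shifted n (suc i)) (shifted (suc n) (suc i)) (inv-central n) (inv-central (suc n)))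

  -- 2h = p - 1, so numerator and denominator are signs, (-1)^{h+d} and (-1)^h.
  ratio-h : ∀ d → d ≤ h → shifted h d * inv-central h ≋ -1ℤ ^ d
  ratio-h d d≤h = ≋-trans (*-cong (binom-pred-p (h ℕ.+ d) (s≤s (ℕ.+-monoʳ-≤ h d≤h))) (≋-sym inverse))
    (≡⇒≋ (trans (cong (_* -1ℤ ^ h) (ℤ.^-distribˡ-+-* -1ℤ h d)) (trans (regroup (-1ℤ ^ h) (-1ℤ ^ d))
      (trans (cong (_* -1ℤ ^ d) (-1^m*-1^m≡1 h)) (ℤ.*-identityˡ (-1ℤ ^ d))))))
    where
    regroup : ∀ a b → a * b * a ≡ a * a * b
    regroup = solve-∀
    inverse : -1ℤ ^ h ≋ inv-central h
    inverse = inv-unique {central h} (≋-trans (*-congʳ (-1ℤ ^ h) (binom-pred-p h (s≤s (ℕ.m≤m+n h h))))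
      (≡⇒≋ (-1^m*-1^m≡1 h)))

  -- Σ_{j<m} C(2j,j) is expanded in the numbers C(2m, m + d) with coefficients of
  -- period 3 in d, since 1 + x + x² = 0 gives (1 + x)² / x = 1.
  module Tail (ε : ℤ) (c : ℕ → ℤ) (c-0 : c 0 ≡ 1ℤ) (c-1 : 1ℤ + + 2 * c 1 ≡ - ε)
              (c-sum : ∀ d → c d + c (1 ℕ.+ d) + c (2 ℕ.+ d) ≡ 0ℤ) where

    -- The sum of c(|d|) C(2m, m + d) over all integers d with |d| ≤ h, folded by symmetry.
    R : ℕ → ℤ
    R m = central m + + 2 * ∑ h (λ i → c (suc i) * shifted m (suc i))

    R-0 : R 0 ≡ 1ℤ
    R-0 = cong₂ (λ x y → x + + 2 * y) (binom-0 0)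
      (∑-zero h (λ i _ → trans (cong (c (suc i) *_) (shifted-> {0} {suc i} (s≤s z≤n))) (ℤ.*-zeroʳ (c (suc i)))))

    -- Collecting the terms by shift, c(d - 1) + 2c(d) + c(d + 1) = c(d) by `c-sum`; what remains
    -- are boundary terms at both ends.
    summation : ∀ m n →
      ∑ n (λ i → c (suc i) * (shifted m i + + 2 * shifted m (1 ℕ.+ i) + shifted m (2 ℕ.+ i))) ≡
      ∑ n (λ i → c (suc i) * shifted m (suc i)) + c 1 * shifted m 0 - c 0 * shifted m 1
        + (c n * shifted m (suc n) - c (suc n) * shifted m n)
    summation m zero    = identity (c 0) (c 1) (shifted m 0) (shifted m 1)
      where
      identity : ∀ a b x y → 0ℤ ≡ 0ℤ + b * x - a * y + (a * y - b * x)
      identity = solve-∀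
    summation m (suc n) = trans (cong (_+ c (suc n) * (N₀ + + 2 * N₁ + N₂)) (summation m n))
      (trans (identity (∑ n (λ i → c (suc i) * shifted m (suc i))) (c 1 * shifted m 0) (c 0 * shifted m 1)
               (c n) (c (suc n)) (c (2 ℕ.+ n)) N₀ N₁ N₂)
        (trans (cong (λ t → rhs + t * N₁) (c-sum n)) (trans (cong (λ t → rhs + t) (ℤ.*-zeroˡ N₁)) (ℤ.+-identityʳ rhs))))
      where
      N₀ = shifted m n
      N₁ = shifted m (suc n)
      N₂ = shifted m (2 ℕ.+ n)
      rhs = ∑ n (λ i → c (suc i) * shifted m (suc i)) + c (suc n) * N₁ + c 1 * shifted m 0 - c 0 * shifted m 1
        + (c (suc n) * N₂ - c (2 ℕ.+ n) * N₁)
      identity : ∀ s u v a b d N₀ N₁ N₂ →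
        s + u - v + (a * N₁ - b * N₀) + b * (N₀ + + 2 * N₁ + N₂) ≡
        s + b * N₁ + u - v + (b * N₂ - d * N₁) + (a + b + d) * N₁
      identity = solve-∀

    -- Weighting by (1 + x)²/x reproduces c(|d|) except at d = 0, where the fold gives 2 + 2 c(1) =
    -- 1 - ε instead of 1. As m < h, the boundary terms at h vanish.
    R-suc : ∀ m → m < h → R (suc m) ≡ R m - ε * central m
    R-suc m m<h = trans
      (cong₂ (λ x y → x + + 2 * y) (central-suc-shifted m)
        (trans (∑-cong h (λ i _ → cong (c (suc i) *_) (shifted-suc m i)))
          (trans (summation m h)
            (cong₂ (λ x y → S + c 1 * N₀ - c 0 * N₁ + (c h * x - c (suc h) * y))
              (shifted-> {m} {suc h} (ℕ.<-trans m<h (ℕ.n<1+n h))) (shifted-> {m} {h} m<h)))))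
      (trans (cong (λ t → + 2 * N₀ + + 2 * N₁ + + 2 * (S + c 1 * N₀ - t * N₁ + (c h * 0ℤ - c (suc h) * 0ℤ))) c-0)
        (trans (identity N₀ N₁ S (c 1) (c h) (c (suc h)))
          (trans (cong (λ t → N₀ + + 2 * S + t * N₀) c-1)
            (trans (cong (λ t → t + + 2 * S + - ε * t) (shifted-0 m)) (final (central m) S ε)))))
      where
      N₀ = shifted m 0
      N₁ = shifted m 1
      S = ∑ h (λ i → c (suc i) * shifted m (suc i))
      identity : ∀ N₀ N₁ S b x y →
        + 2 * N₀ + + 2 * N₁ + + 2 * (S + b * N₀ - 1ℤ * N₁ + (x * 0ℤ - y * 0ℤ)) ≡ N₀ + + 2 * S + (1ℤ + + 2 * b) * N₀
      identity = solve-∀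
      final : ∀ N S ε → N + + 2 * S + - ε * N ≡ N + + 2 * S - ε * N
      final = solve-∀

    -- If the complete sum over j ≤ h is ≡ ε and ε² = 1, this says that R m is ε times the tail of
    -- C(2j, j) over m ≤ j ≤ h.
    R-∑ : ∀ m → m ≤ h → R m ≡ 1ℤ - ε * ∑ m central
    R-∑ zero    _   = trans R-0 (sym (trans (cong (λ t → 1ℤ - t) (ℤ.*-zeroʳ ε)) refl))
    R-∑ (suc m) m<h = trans (R-suc m m<h) (trans (cong (_- ε * central m) (R-∑ m (ℕ.<⇒≤ m<h)))
      (identity ε (∑ m central) (central m)))
      where
      identity : ∀ ε s c → 1ℤ - ε * s - ε * c ≡ 1ℤ - ε * (s + c)
      identity = solve-∀

    Y t : ℕ → ℤ
    Y m = V m m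
    t m = + 3 * (inv-central (suc m) * (1/suc m * 1/suc m))

    -- Summation by parts, with ε C(2j, j) = R j - R (j + 1) and Y (m + 1) - Y m ≡ t m. There is no
    -- lower boundary term because `Y 0` is 0.
    abel : ∀ n → n ≤ h → ε * ∑ n (λ j → central j * Y j) ≋ ∑ n (λ m → R (suc m) * t m) - R n * Y n
    abel zero    _   = ≡⇒≋ (identity ε (R 0))
      where
      identity : ∀ ε r → ε * 0ℤ ≡ 0ℤ - r * 0ℤ
      identity = solve-∀
    abel (suc n) n<h = linear₃ 1ℤ (R (suc n)) (Y n)
      (abel n (ℕ.<⇒≤ n<h)) (V-diagonal n n<h) (≡⇒≋ (R-suc n n<h))
      (identity ε (∑ n (λ j → central j * Y j)) (∑ n (λ m → R (suc m) * t m)) (central n) (Y n) (Y (suc n)) (R n) (R (suc n)) (t n))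
      where
      identity : ∀ ε s u C Y Y′ R R′ t →
        ε * (s + C * Y) - (u + R′ * t - R′ * Y′) ≡
        1ℤ * (ε * s - (u - R * Y)) + R′ * (Y′ - (Y + t)) + Y * (R′ - (R - ε * C))
      identity = solve-∀

    -- R h ≡ ε C(2h, h), so the boundary term cancels the summand j = h.
    abel-h : ε * ε ≡ 1ℤ → ∑ (suc h) central ≋ ε → ε * ∑ (suc h) (λ j → central j * Y j) ≋ ∑ h (λ m → R (suc m) * t m)
    abel-h ε² ∑≋ε = linear₃ 1ℤ (ε * Y h) (- Y h) (abel h ℕ.≤-refl) ∑≋ε
      (linear₁ { R h} {ε * ε - ε * ∑ h central} 1ℤ (≡⇒≋ (R-∑ h ℕ.≤-refl))
        (trans (cong (λ e → R h - (e - ε * ∑ h central)) ε²) (sym (ℤ.*-identityˡ (R h - (1ℤ - ε * ∑ h central))))))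
      (identity ε (∑ h (λ j → central j * Y j)) (∑ h (λ m → R (suc m) * t m)) (central h) (Y h) (R h) (∑ h central))
      where
      identity : ∀ ε s u C Y R σ →
        ε * (s + C * Y) - u ≡ 1ℤ * (ε * s - (u - R * Y)) + ε * Y * (σ + C - ε) + - Y * (R - (ε * ε - ε * σ))
      identity = solve-∀

    -- In R the term C(2m, m) cancels against its inverse in `t` and yields H₂ h. For the others the
    -- order of summation is exchanged and the sum over m telescopes by `∑-ratio`.
    ∑-R : ∑ h (λ m → R (suc m) * t m) ≋ + 3 * (H₂ h + + 2 * ∑ h (λ i → -1ℤ ^ suc i * c (suc i) * inv² (suc i)))
    ∑-R = begin
      ∑ h (λ m → R (suc m) * t m)
        ≋⟨ ∑-cong≋ h split ⟩
      ∑ h (λ m → + 3 * (1/suc m * 1/suc m + + 2 * ∑ h (G m)))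
        ≡⟨ trans (sym (*-distribˡ-∑ h (+ 3) (λ m → 1/suc m * 1/suc m + + 2 * ∑ h (G m)))) (cong (+ 3 *_)
             (trans (∑-distrib-+ h (λ m → 1/suc m * 1/suc m) (λ m → + 2 * ∑ h (G m)))
               (cong (λ s → H₂ h + s) (trans (sym (*-distribˡ-∑ h (+ 2) (λ m → ∑ h (G m)))) (cong (+ 2 *_) (∑-swap h h G)))))) ⟩
      + 3 * (H₂ h + + 2 * ∑ h (λ i → ∑ h (λ m → G m i)))
        ≋⟨ *-congˡ (+ 3) (+-congˡ (H₂ h) (*-congˡ (+ 2) (∑-cong≋ h column))) ⟩
      + 3 * (H₂ h + + 2 * ∑ h (λ i → -1ℤ ^ suc i * c (suc i) * inv² (suc i))) ∎
      where
      G : ℕ → ℕ → ℤ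
      G m i = c (suc i) * (shifted (suc m) (suc i) * inv-central (suc m) * inv² (suc m))
      identity : ∀ C s κ v q → (C + + 2 * s) * (+ 3 * (κ * v)) - + 3 * (v + + 2 * (κ * q * s)) ≡
        + 3 * v * (C * κ - 1ℤ) + + 6 * s * κ * (v - q)
      identity = solve-∀
      regroup : ∀ κ q c N → κ * q * (c * N) ≡ c * (N * κ * q)
      regroup = solve-∀
      split : ∀ m → m < h → R (suc m) * t m ≋ + 3 * (1/suc m * 1/suc m + + 2 * ∑ h (G m))
      split m m<h = ≋-trans
        (linear₂ (+ 3 * v) (+ 6 * S * inv-central (suc m)) (central-inverse (suc m) m<h) (≡⇒≋ (sym (inv-* (+ suc m) (+ suc m))))
          (identity (central (suc m)) S (inv-central (suc m)) v (inv² (suc m))))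
        (≡⇒≋ (cong (λ s → + 3 * (v + + 2 * s)) (trans
          (*-distribˡ-∑ h (inv-central (suc m) * inv² (suc m)) (λ i → c (suc i) * shifted (suc m) (suc i)))
          (∑-cong h (λ i _ → regroup (inv-central (suc m)) (inv² (suc m)) (c (suc i)) (shifted (suc m) (suc i)))))))
        where
        v = 1/suc m * 1/suc m
        S = ∑ h (λ i → c (suc i) * shifted (suc m) (suc i))
      reorder : ∀ c s x → c * (s * x) ≡ x * c * s
      reorder = solve-∀
      column : ∀ i → i < h → ∑ h (λ m → G m i) ≋ -1ℤ ^ suc i * c (suc i) * inv² (suc i)
      column i i<h = ≋-trans
        (≡⇒≋ (sym (*-distribˡ-∑ h (c (suc i)) (λ m → shifted (suc m) (suc i) * inv-central (suc m) * inv² (suc m)))))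
        (≋-trans (*-congˡ (c (suc i)) (≋-trans (∑-ratio i i<h h ℕ.≤-refl)
            (*-congˡ (inv² (suc i)) (ratio-h (suc i) i<h))))
          (≡⇒≋ (reorder (c (suc i)) (inv² (suc i)) (-1ℤ ^ suc i))))

  -- Reducing the residue-class sums to one third of the range

  per-const : ∀ a n → per a a a n ≡ a
  per-const a zero    = refl
  per-const a (suc n) = per-const a n

  per-cong : ∀ {a a′ b b′ c c′} → a ≡ a′ → b ≡ b′ → c ≡ c′ → per a b c ≡ per a′ b′ c′
  per-cong refl refl refl = refl

  module Ones = Periodic 1ℤ 1ℤ 1ℤ
  module Thirds = Periodic 1ℤ 0ℤ 0ℤ

  ∑-ones : ∀ n → ∑ n (λ i → per 1ℤ 1ℤ 1ℤ (suc i) * inv² (suc i)) ≡ H₂ n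
  ∑-ones n = trans (∑-cong n (λ i _ → trans (cong (_* inv² (suc i)) (per-const 1ℤ (suc i))) (ℤ.*-identityˡ (inv² (suc i))))) (inv²-H₂ n)

  ones-w′ : half Ones.w′ ≡ H₂ h
  ones-w′ = trans (cong half (per-cong (per-const 1ℤ p) (per-const 1ℤ (2 ℕ.+ p)) (per-const 1ℤ (1 ℕ.+ p)))) (∑-ones h)

  ones-w″ : half (per Ones.a′ Ones.c′ Ones.b′) ≡ H₂ h
  ones-w″ = trans (cong half (per-cong (per-const 1ℤ p) (per-const 1ℤ (1 ℕ.+ p)) (per-const 1ℤ (2 ℕ.+ p)))) (∑-ones h)

  full≋2H₂ : H₂ (h ℕ.+ h) ≋ H₂ h + H₂ h
  full≋2H₂ = ≋-trans (≡⇒≋ (sym (∑-ones (h ℕ.+ h)))) (≋-trans Ones.full-reflect (≡⇒≋ (cong₂ _+_ (∑-ones h) ones-w′)))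

  -- Reflection evaluates the full sum as 2H and the parity split as H/2, where H = H₂ h; so 6H ≡ 0,
  -- and p > 3.
  H₂-h≋0 : H₂ h ≋ 0ℤ
  H₂-h≋0 = *-cancelˡ-< {2} (s≤s z≤n) (m≤h⇒m<p 2≤h) (*-cancelˡ-< {3} (s≤s z≤n) 3<p
    (linear₃ (- + 4) (+ 4) (H₂ h + H₂ h) full≋2H₂
      (≋-trans (≡⇒≋ (sym (∑-ones (h ℕ.+ h)))) (≋-trans Ones.full-parity
        (≡⇒≋ (cong (¼ *_) (cong₂ _+_ (∑-ones h) ones-w″)))))
      4*¼≋1
      (identity (H₂ h) ¼ (H₂ (h ℕ.+ h)))))
    where
    3<p : 3 < p
    3<p = s≤s (ℕ.≤-trans (ℕ.n≤1+n 3) (ℕ.+-mono-≤ 2≤h 2≤h))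
    identity : ∀ H q F → + 3 * (+ 2 * H) - + 3 * (+ 2 * 0ℤ) ≡ - + 4 * (F - (H + H)) + + 4 * (F - q * (H + H)) + (H + H) * (+ 4 * q - 1ℤ)
    identity = solve-∀

  H₂-2h≋0 : H₂ (h ℕ.+ h) ≋ 0ℤ
  H₂-2h≋0 = ≋-trans full≋2H₂ (+-cong H₂-h≋0 H₂-h≋0)

  X₀ X₁ X₂ : ℤ
  X₀ = half (per 1ℤ 0ℤ 0ℤ)
  X₁ = half (per 0ℤ 1ℤ 0ℤ)
  X₂ = half (per 0ℤ 0ℤ 1ℤ)

  X₀+X₁+X₂≋0 : X₀ + X₁ + X₂ ≋ 0ℤ
  X₀+X₁+X₂≋0 = ≋-trans (≡⇒≋ (trans (identity X₀ X₁ X₂) (trans (sym (half-per 1ℤ 1ℤ 1ℤ)) (∑-ones h)))) H₂-h≋0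
    where
    identity : ∀ x y z → x + y + z ≡ 1ℤ * x + 1ℤ * y + 1ℤ * z
    identity = solve-∀

  -- Write F and A for the full and alternating sums. Reflection gives F ≡ X₀ + Y ≡ -Z, and the
  -- parity split 4F ≡ X₀ + Z, hence X₀ ≡ -5Z. Then 4A ≡ X₀ - Z gives 6A ≡ -9Z ≡ 9F.
  alternating-full : ∀ {Y Z} → half Thirds.w′ ≡ Y → half (per Thirds.a′ Thirds.c′ Thirds.b′) ≡ Z →
    X₀ + Y + Z ≋ 0ℤ → + 3 * (H₂ h + + 2 * Thirds.alternating) ≋ + 9 * Thirds.full
  alternating-full {Y} {Z} w′≡Y w″≡Z sum≋0 =
    linear₃ (+ 3) 1ℤ (- + 9) H₂-h≋0 6A≋-9Z F≋-Z (identity (H₂ h) A F Z)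
    where
    F A : ℤ
    F = Thirds.full
    A = Thirds.alternating
    F≋-Z : F ≋ - Z
    F≋-Z = linear₂ 1ℤ 1ℤ (≋-trans Thirds.full-reflect (≡⇒≋ (cong (λ t → X₀ + t) w′≡Y))) sum≋0 (eq F X₀ Y Z)
      where
      eq : ∀ F X Y Z → F - - Z ≡ 1ℤ * (F - (X + Y)) + 1ℤ * (X + Y + Z - 0ℤ)
      eq = solve-∀
    X₀≋-5Z : X₀ ≋ - (+ 5 * Z)
    X₀≋-5Z = linear₃ (- + 4) (+ 4) (- (X₀ + Z))
      (≋-trans Thirds.full-parity (≡⇒≋ (cong (λ t → ¼ * (X₀ + t)) w″≡Z))) F≋-Z 4*¼≋1 (eq F X₀ Z ¼)
      where
      eq : ∀ F X Z q → X - - (+ 5 * Z) ≡ - + 4 * (F - q * (X + Z)) + + 4 * (F - - Z) + - (X + Z) * (+ 4 * q - 1ℤ)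
      eq = solve-∀
    6A≋-9Z : + 6 * A ≋ - (+ 9 * Z)
    6A≋-9Z = linear₃ (+ 6) (+ 6 * ¼) (- (+ 9 * Z))
      (≋-trans Thirds.alternating-parity (≡⇒≋ (cong (λ t → ¼ * (X₀ - t)) w″≡Z))) X₀≋-5Z 4*¼≋1 (eq A X₀ Z ¼)
      where
      eq : ∀ A X Z q → + 6 * A - - (+ 9 * Z) ≡
        + 6 * (A - q * (X - Z)) + + 6 * q * (X - - (+ 5 * Z)) + - (+ 9 * Z) * (+ 4 * q - 1ℤ)
      eq = solve-∀
    identity : ∀ H A F Z → + 3 * (H + + 2 * A) - + 9 * F ≡
      + 3 * (H - 0ℤ) + 1ℤ * (+ 6 * A - - (+ 9 * Z)) + - + 9 * (F - - Z)
    identity = solve-∀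

  ∑-thirds : ∀ g → ∑ (g ℕ.* 3) (λ i → per 1ℤ 0ℤ 0ℤ (suc i) * inv² (suc i)) ≡ inv² 3 * H₂ g
  ∑-thirds g = trans (∑-triples g (λ i → per 1ℤ 0ℤ 0ℤ (suc i) * inv² (suc i)))
    (trans (∑-cong g (λ i _ → term i)) (trans (sym (*-distribˡ-∑ g (inv² 3) (inv² ∘ suc))) (cong (inv² 3 *_) (inv²-H₂ g))))
    where
    identity : ∀ a b s t → 0ℤ * a + 0ℤ * b + 1ℤ * (s * t) ≡ t * s
    identity = solve-∀
    term : ∀ i → per 1ℤ 0ℤ 0ℤ (suc (i ℕ.* 3)) * inv² (suc (i ℕ.* 3))
        + per 1ℤ 0ℤ 0ℤ (2 ℕ.+ i ℕ.* 3) * inv² (2 ℕ.+ i ℕ.* 3) + per 1ℤ 0ℤ 0ℤ (3 ℕ.+ i ℕ.* 3) * inv² (3 ℕ.+ i ℕ.* 3)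
      ≡ inv² 3 * inv² (suc i)
    term i = trans (cong₂ _+_ (cong₂ (λ u v → u * inv² (suc (i ℕ.* 3)) + v * inv² (2 ℕ.+ i ℕ.* 3)) (per-*3 0ℤ 0ℤ 1ℤ i) (per-*3 0ℤ 1ℤ 0ℤ i))
        (cong₂ _*_ (per-*3 1ℤ 0ℤ 0ℤ i) (inv²-scale (suc i) 3)))
      (identity (inv² (suc (i ℕ.* 3))) (inv² (2 ℕ.+ i ℕ.* 3)) (inv² (suc i)) (inv² 3))

  -- The integer part of p/3.
  third : ∀ {ε} → Mod3 ε → ℕ
  third (one g _) = g
  third (two g _) = g

  full≡ : ∀ {ε} (mod3 : Mod3 ε) → Thirds.full ≡ inv² 3 * H₂ (third mod3)
  full≡ (one g 2h≡) = trans (cong (λ n → ∑ n (λ i → per 1ℤ 0ℤ 0ℤ (suc i) * inv² (suc i))) 2h≡) (∑-thirds g)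
  full≡ (two g 2h≡) = trans (cong (λ n → ∑ n (λ i → per 1ℤ 0ℤ 0ℤ (suc i) * inv² (suc i))) 2h≡)
    (trans (cong₂ _+_ (∑-thirds g) (cong (_* inv² (suc (g ℕ.* 3))) (per-*3 0ℤ 0ℤ 1ℤ g)))
      (identity (inv² 3 * H₂ g) (inv² (suc (g ℕ.* 3)))))
    where
    identity : ∀ a b → a + 0ℤ * b ≡ a
    identity = solve-∀

  9*full≋ : ∀ {ε} (mod3 : Mod3 ε) → + 9 * Thirds.full ≋ H₂ (third mod3)
  9*full≋ mod3 = linear₂ (+ 9) (H₂ (third mod3)) (≡⇒≋ (full≡ mod3)) (inv²-inverse {3} (s≤s z≤n) 3<p)
    (identity Thirds.full (inv² 3) (H₂ (third mod3)))
    where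
    3<p : 3 < p
    3<p = s≤s (ℕ.≤-trans (ℕ.n≤1+n 3) (ℕ.+-mono-≤ 2≤h 2≤h))
    identity : ∀ F s H → + 9 * F - H ≡ + 9 * (F - s * H) + H * (+ 3 * + 3 * s - 1ℤ)
    identity = solve-∀

  a′≡ : ∀ {ε} → Mod3 ε → Thirds.a′ ≡ 0ℤ
  a′≡ (one g 2h≡) = trans (cong (per 0ℤ 0ℤ 1ℤ) 2h≡) (per-*3 0ℤ 0ℤ 1ℤ g)
  a′≡ (two g 2h≡) = trans (cong (per 0ℤ 0ℤ 1ℤ) 2h≡) (per-*3 0ℤ 1ℤ 0ℤ g)

  b′ c′ : ∀ {ε} → Mod3 ε → ℤ
  b′ (one _ _) = 1ℤ
  b′ (two _ _) = 0ℤ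
  c′ (one _ _) = 0ℤ
  c′ (two _ _) = 1ℤ

  b′≡ : ∀ {ε} (mod3 : Mod3 ε) → Thirds.b′ ≡ b′ mod3
  b′≡ (one g 2h≡) = trans (cong (per 1ℤ 0ℤ 0ℤ) 2h≡) (per-*3 1ℤ 0ℤ 0ℤ g)
  b′≡ (two g 2h≡) = trans (cong (per 1ℤ 0ℤ 0ℤ) 2h≡) (per-*3 0ℤ 0ℤ 1ℤ g)

  c′≡ : ∀ {ε} (mod3 : Mod3 ε) → Thirds.c′ ≡ c′ mod3
  c′≡ (one g 2h≡) = trans (cong (per 0ℤ 1ℤ 0ℤ) 2h≡) (per-*3 0ℤ 1ℤ 0ℤ g)
  c′≡ (two g 2h≡) = trans (cong (per 0ℤ 1ℤ 0ℤ) 2h≡) (per-*3 1ℤ 0ℤ 0ℤ g)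

  alternating≋ : ∀ {ε} (mod3 : Mod3 ε) → + 3 * (H₂ h + + 2 * Thirds.alternating) ≋ H₂ (third mod3)
  alternating≋ mod3 = ≋-trans (by-cases mod3) (9*full≋ mod3)
    where
    swap : ∀ x y z → x + z + y ≡ x + y + z
    swap = solve-∀
    by-cases : ∀ {ε} (mod3 : Mod3 ε) → + 3 * (H₂ h + + 2 * Thirds.alternating) ≋ + 9 * Thirds.full
    by-cases mod3@(one _ _) = alternating-full
      (cong half (per-cong (a′≡ mod3) (b′≡ mod3) (c′≡ mod3)))
      (cong half (per-cong (a′≡ mod3) (c′≡ mod3) (b′≡ mod3))) X₀+X₁+X₂≋0
    by-cases mod3@(two _ _) = alternating-full
      (cong half (per-cong (a′≡ mod3) (b′≡ mod3) (c′≡ mod3)))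
      (cong half (per-cong (a′≡ mod3) (c′≡ mod3) (b′≡ mod3)))
      (≋-trans (≡⇒≋ (swap X₀ X₁ X₂)) X₀+X₁+X₂≋0)

  -- By the binomial theorem the sum is ≡ (1 - 4)^h.
  ∑-central≋ε : ∀ {ε} → Mod3 ε → ∑ (suc h) central ≋ ε
  ∑-central≋ε mod3 = ≋-trans (≡⇒≋ (∑-cong (suc h) (λ m _ → sym (ℤ.*-identityʳ (central m)))))
    (≋-trans (∑-central-T (λ _ → 1ℤ)) (≋-trans (≡⇒≋ (T-one -4ℤ h)) (-3^h≋ε mod3)))

  ∑-central-V : ∀ {ε} (mod3 : Mod3 ε) → ∑ (suc h) (λ m → central m * V m m) ≋ ε * H₂ (third mod3)
  ∑-central-V {ε} mod3 = linear₂ ε (- S) ε*S≋ (≡⇒≋ (ε*ε≡1 mod3)) (identity ε S (H₂ (third mod3)))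
    where
    S = ∑ (suc h) (λ m → central m * V m m)
    identity : ∀ ε S H → S - ε * H ≡ ε * (ε * S - H) + - S * (ε * ε - 1ℤ)
    identity = solve-∀
    -- The tail expansion forces c(1) = -(1 + ε)/2. Hence c is 1 on multiples of 3, -1 on the class
    -- of p and 0 elsewhere, which is the weight in `Thirds.alternating-reflect`.
    c : ℕ → ℤ
    c d = Thirds.w d - Thirds.w′ d
    c-0 : c 0 ≡ 1ℤ
    c-0 = cong (λ a → 1ℤ - a) (a′≡ mod3)
    by-cases : ∀ {ε} (mod3 : Mod3 ε) → 1ℤ + + 2 * (0ℤ - b′ mod3) ≡ - ε
    by-cases (one _ _) = refl
    by-cases (two _ _) = refl
    c-1 : 1ℤ + + 2 * c 1 ≡ - ε
    c-1 = trans (cong (λ b → 1ℤ + + 2 * (0ℤ - b)) (b′≡ mod3)) (by-cases mod3)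
    c-sum : ∀ d → c d + c (1 ℕ.+ d) + c (2 ℕ.+ d) ≡ 0ℤ
    c-sum d = trans (regroup (Thirds.w d) (Thirds.w′ d) (Thirds.w (1 ℕ.+ d)) (Thirds.w′ (1 ℕ.+ d)) (Thirds.w (2 ℕ.+ d)) (Thirds.w′ (2 ℕ.+ d)))
      (cong₂ _-_ (per-sum 1ℤ 0ℤ 0ℤ d) (trans (per-sum Thirds.a′ Thirds.b′ Thirds.c′ d)
        (trans (rotate Thirds.a′ Thirds.b′ Thirds.c′) (per-sum 1ℤ 0ℤ 0ℤ p))))
      where
      regroup : ∀ a a′ b b′ c c′ → (a - a′) + (b - b′) + (c - c′) ≡ (a + b + c) - (a′ + b′ + c′)
      regroup = solve-∀
      rotate : ∀ a b c → a + b + c ≡ a + c + b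
      rotate = solve-∀
    open Tail ε c c-0 c-1 c-sum
    ε*S≋ : ε * S ≋ H₂ (third mod3)
    ε*S≋ = ≋-trans (abel-h (ε*ε≡1 mod3) (∑-central≋ε mod3)) (≋-trans ∑-R
      (≋-trans (*-congˡ (+ 3) (+-congˡ (H₂ h) (*-congˡ (+ 2) (≋-sym Thirds.alternating-reflect)))) (alternating≋ mod3)))

  -- Its successor represents 1/3 modulo p: it is (2p + 1)/3 or (p + 1)/3. The predecessor is kept
  -- because it is the upper limit of the harmonic sum.
  one-third : ∀ {ε} → Mod3 ε → ℕ
  one-third (one g _) = g ℕ.+ g
  one-third (two g _) = g

  one-third-< : ∀ {ε} (mod3 : Mod3 ε) → suc (one-third mod3) < p
  one-third-< (one g 2h≡) = s≤s (ℕ.≤-trans (ℕ.+-monoˡ-≤ (g ℕ.+ g) (positive g 2h≡))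
      (ℕ.≤-reflexive (trans (thrice g) (sym 2h≡))))
    where
    thrice : ∀ g → g ℕ.+ (g ℕ.+ g) ≡ g ℕ.* 3
    thrice = ℕ-solve-∀
    positive : ∀ g → h ℕ.+ h ≡ g ℕ.* 3 → 1 ≤ g
    positive zero    2h≡0 = subst (1 ≤_) 2h≡0 (ℕ.≤-trans (ℕ.≤-trans (s≤s z≤n) 2≤h) (ℕ.m≤m+n h h))
    positive (suc g) _    = s≤s z≤n
  one-third-< (two g 2h≡) = s≤s (subst (suc g ≤_) (sym 2h≡) (s≤s (ℕ.m≤m*n g 3)))

  3*one-third≋1 : ∀ {ε} (mod3 : Mod3 ε) → + 3 * + suc (one-third mod3) ≋ 1ℤ
  3*one-third≋1 (one g 2h≡) = linear₂ (+ 2) (+ 2) p≋0 (≡⇒≋ (cong +_ (trans (thrice g) (sym 2h≡))))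
      (identity (+ g) (+ (h ℕ.+ h)))
    where
    thrice : ∀ g → g ℕ.+ (g ℕ.+ g) ≡ g ℕ.* 3
    thrice = ℕ-solve-∀
    identity : ∀ g n → + 3 * (1ℤ + (g + g)) - 1ℤ ≡ + 2 * (1ℤ + n - 0ℤ) + + 2 * (g + (g + g) - n)
    identity = solve-∀
  3*one-third≋1 (two g 2h≡) = linear₂ 1ℤ 1ℤ p≋0 (≡⇒≋ (cong +_ (trans (cong suc (thrice g)) (sym 2h≡))))
      (identity (+ g) (+ (h ℕ.+ h)))
    where
    thrice : ∀ g → g ℕ.+ (g ℕ.+ g) ≡ g ℕ.* 3
    thrice = ℕ-solve-∀
    identity : ∀ g n → + 3 * (1ℤ + g) - 1ℤ ≡ 1ℤ * (1ℤ + n - 0ℤ) + 1ℤ * (1ℤ + (g + (g + g)) - n)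
    identity = solve-∀

  ε*H₂-third : ∀ {ε} (mod3 : Mod3 ε) → ε * H₂ (third mod3) ≋ - H₂ (one-third mod3)
  ε*H₂-third (two g 2h≡) = ≡⇒≋ (ℤ.-1*i≡-i (H₂ g))
  ε*H₂-third (one g 2h≡) = linear₂ 1ℤ -1ℤ H₂-2h≋0 split (identity (H₂ g) (H₂ (g ℕ.+ g)) (H₂ (h ℕ.+ h)))
    where
    identity : ∀ a b c → 1ℤ * a - - b ≡ 1ℤ * (c - 0ℤ) + -1ℤ * (c - (b + a))
    identity = solve-∀
    thrice : ∀ g → g ℕ.* 3 ≡ (g ℕ.+ g) ℕ.+ g
    thrice = ℕ-solve-∀
    2h≡3g : h ℕ.+ h ≡ (g ℕ.+ g) ℕ.+ g
    2h≡3g = trans 2h≡ (thrice g)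
    reflected : ∀ i → i < g → suc i ℕ.+ suc ((g ℕ.+ g) ℕ.+ (g ∸ suc i)) ≡ p
    reflected i i<g = trans (shuffle (suc i) (g ℕ.+ g) (g ∸ suc i))
      (cong suc (trans (cong ((g ℕ.+ g) ℕ.+_) (ℕ.m+[n∸m]≡n i<g)) (sym 2h≡3g)))
      where
      shuffle : ∀ a b c → a ℕ.+ suc (b ℕ.+ c) ≡ suc (b ℕ.+ (a ℕ.+ c))
      shuffle = ℕ-solve-∀
    split : H₂ (h ℕ.+ h) ≋ H₂ (g ℕ.+ g) + H₂ g
    split = begin
      H₂ (h ℕ.+ h)                      ≡⟨ cong H₂ 2h≡3g ⟩
      H₂ ((g ℕ.+ g) ℕ.+ g)              ≡⟨ inv²-H₂ ((g ℕ.+ g) ℕ.+ g) ⟨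
      ∑ ((g ℕ.+ g) ℕ.+ g) (inv² ∘ suc)    ≡⟨ ∑-++ (g ℕ.+ g) g (inv² ∘ suc) ⟩
      ∑ (g ℕ.+ g) (inv² ∘ suc) + ∑ g (λ i → inv² (suc ((g ℕ.+ g) ℕ.+ i)))
        ≡⟨ cong₂ _+_ (inv²-H₂ (g ℕ.+ g)) (∑-reverse g (λ i → inv² (suc ((g ℕ.+ g) ℕ.+ i)))) ⟩
      H₂ (g ℕ.+ g) + ∑ g (λ i → inv² (suc ((g ℕ.+ g) ℕ.+ (g ∸ suc i))))
        ≋⟨ +-congˡ (H₂ (g ℕ.+ g)) (≋-trans (∑-cong≋ g (λ i i<g → inv²-reflect {suc i} (reflected i i<g))) (≡⇒≋ (inv²-H₂ g))) ⟩
      H₂ (g ℕ.+ g) + H₂ g               ∎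

-- Residue classes of p-integral rationals

module Reduction (h : ℕ) (prime : Prime (suc (h ℕ.+ h))) (2≤h : 2 ≤ h) where
  open import Defs
  open import Data.Rational.Base using (ℚ; mkℚ; 0ℚ; 1ℚ; ½; _/_; _+_; _*_; _-_; -_; toℚᵘ; ↥_; ↧_; ↧ₙ_)
  open +-*-Solver using (solve; _:+_; _:*_; _:=_; _:-_; con)
  open Algebra.Properties.Semiring.Sum ℕ.+-*-semiring using () renaming (sum to ℕ-sum)
  open IntegerSums
  open PowerSeries
  open Residues h prime 2≤h

  /1-injective : ∀ {a b} → a / 1 ≡ b / 1 → a ≡ b
  /1-injective {a} {b} e with ℚᵘ.≃-trans (ℚᵘ.≃-sym (toℚᵘ-/1 a)) (ℚᵘ.≃-trans (ℚᵘ.≃-reflexive (cong toℚᵘ e)) (toℚᵘ-/1 b))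
  ... | ℚᵘ.*≡* a*1≡b*1 = trans (sym (ℤ.*-identityʳ a)) (trans a*1≡b*1 (ℤ.*-identityʳ b))

  /1-neg : ∀ a → (ℤ.- a) / 1 ≡ - (a / 1)
  /1-neg a = ℚ.toℚᵘ-injective (ℚᵘ.≃-trans (toℚᵘ-/1 (ℤ.- a)) (ℚᵘ.≃-sym
    (ℚᵘ.≃-trans (ℚ.toℚᵘ-homo‿- (a / 1)) (ℚᵘ.-‿cong (toℚᵘ-/1 a)))))

  *-≉0 : ∀ {a b} → ¬ (a ≋ 0ℤ) → ¬ (b ≋ 0ℤ) → ¬ (a ℤ.* b ≋ 0ℤ)
  *-≉0 {a} {b} a≉0 b≉0 ab≋0 = b≉0 (*-cancelˡ-≉0 a a≉0 (≋-trans ab≋0 (≡⇒≋ (sym (ℤ.*-zeroʳ a)))))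

  -- x ↝ z: the rational x is p-integral with residue class z.
  infix 4 _↝_

  record _↝_ (x : ℚ) (z : ℤ) : Set where
    constructor mk↝
    field
      den num : ℤ
      den≉0 : ¬ (den ≋ 0ℤ)
      clear : x * (den / 1) ≡ num / 1
      num≋ : num ≋ z ℤ.* den

  ↝-resp : ∀ {x z z′} → z ≋ z′ → x ↝ z → x ↝ z′
  ↝-resp z≋z′ (mk↝ d a d≉0 e a≋) = mk↝ d a d≉0 e (≋-trans a≋ (*-congʳ d z≋z′))

  ↝-/1 : ∀ z → z / 1 ↝ z
  ↝-/1 z = mk↝ 1ℤ z 1≉0 (ℚ.*-identityʳ (z / 1)) (≡⇒≋ (sym (ℤ.*-identityʳ z)))

  ↝-+ : ∀ {x y z w} → x ↝ z → y ↝ w → x + y ↝ z ℤ.+ w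
  ↝-+ {x} {y} {z} {w} (mk↝ d a d≉0 e a≋) (mk↝ d′ a′ d′≉0 e′ a′≋) = mk↝ (d ℤ.* d′) (a ℤ.* d′ ℤ.+ a′ ℤ.* d)
    (*-≉0 d≉0 d′≉0)
    (trans (cong ((x + y) *_) (/1-* d d′)) (trans (regroup x y (d / 1) (d′ / 1))
      (trans (cong₂ (λ u v → u * (d′ / 1) + v * (d / 1)) e e′)
        (sym (trans (/1-+ (a ℤ.* d′) (a′ ℤ.* d)) (cong₂ _+_ (/1-* a d′) (/1-* a′ d)))))))
    (linear₂ d′ d a≋ a′≋ (combine a a′ d d′ z w))
    where
    regroup : ∀ x y d e → (x + y) * (d * e) ≡ x * d * e + y * e * d
    regroup = solve 4 (λ x y d e → (x :+ y) :* (d :* e) := x :* d :* e :+ y :* e :* d) refl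
    combine : ∀ a a′ d d′ z w → a ℤ.* d′ ℤ.+ a′ ℤ.* d ℤ.- (z ℤ.+ w) ℤ.* (d ℤ.* d′)
      ≡ d′ ℤ.* (a ℤ.- z ℤ.* d) ℤ.+ d ℤ.* (a′ ℤ.- w ℤ.* d′)
    combine = solve-∀

  ↝-* : ∀ {x y z w} → x ↝ z → y ↝ w → x * y ↝ z ℤ.* w
  ↝-* {x} {y} {z} {w} (mk↝ d a d≉0 e a≋) (mk↝ d′ a′ d′≉0 e′ a′≋) = mk↝ (d ℤ.* d′) (a ℤ.* a′)
    (*-≉0 d≉0 d′≉0)
    (trans (cong (x * y *_) (/1-* d d′)) (trans (interchange x y (d / 1) (d′ / 1))
      (trans (cong₂ _*_ e e′) (sym (/1-* a a′)))))
    (≋-trans (*-cong a≋ a′≋) (≡⇒≋ (interchangeℤ z d w d′)))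
    where
    interchange : ∀ x y d e → x * y * (d * e) ≡ x * d * (y * e)
    interchange = solve 4 (λ x y d e → x :* y :* (d :* e) := x :* d :* (y :* e)) refl
    interchangeℤ : ∀ z d w e → z ℤ.* d ℤ.* (w ℤ.* e) ≡ z ℤ.* w ℤ.* (d ℤ.* e)
    interchangeℤ = solve-∀

  ↝-neg : ∀ {x z} → x ↝ z → - x ↝ ℤ.- z
  ↝-neg {x} {z} (mk↝ d a d≉0 e a≋) = mk↝ d (ℤ.- a) d≉0
    (trans (sym (ℚ.neg-distribˡ-* x (d / 1))) (trans (cong -_ e) (sym (/1-neg a))))
    (linear₁ -1ℤ a≋ (negate a z d))
    where
    negate : ∀ a z d → ℤ.- a ℤ.- ℤ.- z ℤ.* d ≡ -1ℤ ℤ.* (a ℤ.- z ℤ.* d)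
    negate = solve-∀

  ↝-1/ : ∀ n .{{_ : NonZero n}} → ¬ (+ n ≋ 0ℤ) → + 1 / n ↝ inv (+ n)
  ↝-1/ n n≉0 = mk↝ (+ n) 1ℤ n≉0 (trans (ℚ.*-comm (+ 1 / n) (+ n / 1)) (m*1/m≡1 n))
    (≋-trans (≋-sym (inv-inverse n≉0)) (≡⇒≋ (ℤ.*-comm (+ n) (inv (+ n)))))

  ↝-^ : ∀ {x z} n → x ↝ z → x ^ n ↝ z ℤ.^ n
  ↝-^ zero    x↝z = ↝-/1 1ℤ
  ↝-^ (suc n) x↝z = ↝-* x↝z (↝-^ n x↝z)

  ↝-∑ : ∀ n (f : ℕ → ℚ) (g : ℕ → ℤ) → (∀ k → k < n → f k ↝ g k) → ∑[ k < n ] f (toℕ k) ↝ ∑ n g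
  ↝-∑ zero    f g f↝g = ↝-/1 0ℤ
  ↝-∑ (suc n) f g f↝g = ↝-resp (≡⇒≋ (sym (∑-front n g)))
    (↝-+ (f↝g 0 (s≤s z≤n)) (↝-∑ n (f ∘ suc) (g ∘ suc) (λ k k<n → f↝g (suc k) (s≤s k<n))))

  ↝-unique : ∀ {x z w} → x ↝ z → x ↝ w → z ≋ w
  ↝-unique {x} {z} {w} (mk↝ d a d≉0 e a≋) (mk↝ d′ a′ d′≉0 e′ a′≋) = *-cancelˡ-≉0 (d ℤ.* d′) (*-≉0 d≉0 d′≉0)
    (linear₃ (ℤ.- d′) d 1ℤ a≋ a′≋ (≡⇒≋ (/1-injective {a ℤ.* d′} {a′ ℤ.* d} (trans (/1-* a d′) (trans
        (cong (_* (d′ / 1)) (sym e)) (trans (swap x (d / 1) (d′ / 1)) (trans (cong (_* (d / 1)) e′) (sym (/1-* a′ d))))))))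
      (combine a a′ d d′ z w))
    where
    swap : ∀ x d e → x * d * e ≡ x * e * d
    swap = solve 3 (λ x d e → x :* d :* e := x :* e :* d) refl
    combine : ∀ a a′ d d′ z w → d ℤ.* d′ ℤ.* z ℤ.- d ℤ.* d′ ℤ.* w ≡
      ℤ.- d′ ℤ.* (a ℤ.- z ℤ.* d) ℤ.+ d ℤ.* (a′ ℤ.- w ℤ.* d′) ℤ.+ 1ℤ ℤ.* (a ℤ.* d′ ℤ.- a′ ℤ.* d)
    combine = solve-∀

  -- A denominator in lowest terms divides every integer that clears it; if p divided it, p would
  -- divide `d`.
  clear⇒coprime : ∀ c d b → ¬ (d ≋ 0ℤ) → c * (d / 1) ≡ b / 1 → Coprime (↧ₙ c) p
  clear⇒coprime c@(mkℚ _ _ coprime) d b d≉0 e {i} (i∣↧c , i∣p) with prime⇒irreducible prime i∣p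
  ... | inj₁ i≡1 = i≡1
  ... | inj₂ refl = contradiction (∣⇒≋ (subst (λ z → p ∣ ℤ.∣ z ∣) (sym (ℤ.+-identityʳ d)) (∣-trans i∣↧c ↧c∣d))) d≉0
    where
    cleared : toℚᵘ c ℚᵘ.* (d ℚᵘ./ 1) ℚᵘ.≃ b ℚᵘ./ 1
    cleared = ℚᵘ.≃-trans (ℚᵘ.*-congˡ {toℚᵘ c} (ℚᵘ.≃-sym (toℚᵘ-/1 d)))
      (ℚᵘ.≃-trans (ℚᵘ.≃-sym (ℚ.toℚᵘ-homo-* c (d / 1)))
        (ℚᵘ.≃-trans (ℚᵘ.≃-reflexive (cong toℚᵘ e)) (toℚᵘ-/1 b)))
    ↧c∣↥c*d : ↧ₙ c ∣ ℤ.∣ ↥ c ∣ ℕ.* ℤ.∣ d ∣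
    ↧c∣↥c*d with cleared
    ... | ℚᵘ.*≡* eq = divides ℤ.∣ b ∣ (trans (sym (ℤ.abs-* (↥ c) d)) (trans
      (cong ℤ.∣_∣ (trans (sym (ℤ.*-identityʳ (↥ c ℤ.* d))) (trans eq (cong (b ℤ.*_) (cong +_ (ℕ.*-identityʳ (↧ₙ c)))))))
      (ℤ.abs-* b (↧ c))))
    ↧c∣d : ↧ₙ c ∣ ℤ.∣ d ∣
    ↧c∣d = coprime-divisor (Coprimality.sym (Coprimality.recompute coprime)) ↧c∣↥c*d

  -- The witness is (x - y)/p. The product of the two given denominators clears it too, with the
  -- quotient of a congruence as numerator.
  ↝⇒≈ : ∀ {x y z} → x ↝ z → y ↝ z → x ≈ y [mod p ]
  ↝⇒≈ {x} {y} {z} (mk↝ d a d≉0 e a≋) (mk↝ d′ a′ d′≉0 e′ a′≋) = c ,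
    clear⇒coprime c (d ℤ.* d′) b (*-≉0 d≉0 d′≉0) c*dd′≡b , sym p*c≡x-y
    where
    difference : a ℤ.* d′ ≋ a′ ℤ.* d
    difference = linear₂ d′ (ℤ.- d) a≋ a′≋ (combine a a′ d d′ z)
      where
      combine : ∀ a a′ d d′ z → a ℤ.* d′ ℤ.- a′ ℤ.* d ≡ d′ ℤ.* (a ℤ.- z ℤ.* d) ℤ.+ ℤ.- d ℤ.* (a′ ℤ.- z ℤ.* d′)
      combine = solve-∀
    b : ℤ
    b = _≋_.quotient difference
    c : ℚ
    c = (x - y) * (+ 1 / p)
    p*c≡x-y : (+ p / 1) * c ≡ x - y
    p*c≡x-y = trans (regroup (+ p / 1) (x - y) (+ 1 / p)) (trans (cong ((x - y) *_) (m*1/m≡1 p)) (ℚ.*-identityʳ (x - y)))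
      where
      regroup : ∀ p x v → p * (x * v) ≡ x * (p * v)
      regroup = solve 3 (λ p x v → p :* (x :* v) := x :* (p :* v)) refl
    [x-y]dd′ : (x - y) * ((d ℤ.* d′) / 1) ≡ (+ p ℤ.* b) / 1
    [x-y]dd′ = trans (cong ((x - y) *_) (/1-* d d′)) (trans (regroup x y (d / 1) (d′ / 1))
      (trans (cong₂ (λ u v → u * (d′ / 1) - v * (d / 1)) e e′) (trans
        (cong₂ _-_ (sym (/1-* a d′)) (sym (/1-* a′ d)))
        (trans (cong (λ t → (a ℤ.* d′) / 1 + t) (sym (/1-neg (a′ ℤ.* d)))) (trans (sym (/1-+ (a ℤ.* d′) (ℤ.- (a′ ℤ.* d))))
          (cong (_/ 1) (_≋_.difference difference)))))))
      where
      regroup : ∀ x y d e → (x - y) * (d * e) ≡ x * d * e - y * e * d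
      regroup = solve 4 (λ x y d e → (x :- y) :* (d :* e) := x :* d :* e :- y :* e :* d) refl
    c*dd′≡b : c * ((d ℤ.* d′) / 1) ≡ b / 1
    c*dd′≡b = trans (regroup (x - y) (+ 1 / p) ((d ℤ.* d′) / 1)) (trans (cong (_* (+ 1 / p)) [x-y]dd′)
      (trans (cong (_* (+ 1 / p)) (/1-* (+ p) b)) (trans (regroup′ (+ p / 1) (b / 1) (+ 1 / p))
        (trans (cong ((b / 1) *_) (m*1/m≡1 p)) (ℚ.*-identityʳ (b / 1))))))
      where
      regroup : ∀ x v d → x * v * d ≡ x * d * v
      regroup = solve 3 (λ x v d → x :* v :* d := x :* d :* v) refl
      regroup′ : ∀ p b v → p * b * v ≡ b * (p * v)
      regroup′ = solve 3 (λ p b v → p :* b :* v := b :* (p :* v)) refl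

  -- The Bernoulli polynomial at 1/3 modulo p

  !≉0 : ∀ n → n < p → ¬ (+ (n !) ≋ 0ℤ)
  !≉0 zero    _   = 1≉0
  !≉0 (suc n) n<p n!≋0 = *-≉0 (+k≉0 (s≤s z≤n) n<p) (!≉0 n (ℕ.<-trans (ℕ.n<1+n n) n<p))
    (≋-trans (≡⇒≋ (sym (ℤ.pos-* (suc n) (n !)))) n!≋0)

  ↝-1/! : ∀ n → n < p → 1/ n ! ↝ inv (+ (n !))
  ↝-1/! n n<p = ↝-1/ (n !) (!≉0 n n<p)
    where instance _ = n ℕ.!≢0

  ↝-exp : ∀ {t m} n → n < p → t ↝ m → exp t n ↝ m ℤ.^ n ℤ.* inv (+ (n !))
  ↝-exp n n<p t↝m = ↝-* (↝-^ n t↝m) (↝-1/! n n<p)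

  infix 4 _~_

  -- Both p-integral with equal residues; in particular `x ~ x` expresses that x is p-integral.
  _~_ : ℚ → ℚ → Set
  x ~ y = ∃[ z ] x ↝ z × y ↝ z

  ~-∑ : ∀ n (f g : Fin n → ℚ) → (∀ i → f i ~ g i) → ∑[ i < n ] f i ~ ∑[ i < n ] g i
  ~-∑ zero    f g f~g = 0ℤ , ↝-/1 0ℤ , ↝-/1 0ℤ
  ~-∑ (suc n) f g f~g with f~g Fin.zero | ~-∑ n (f ∘ Fin.suc) (g ∘ Fin.suc) (f~g ∘ Fin.suc)
  ... | z , f↝ , g↝ | w , fs↝ , gs↝ = z ℤ.+ w , ↝-+ f↝ fs↝ , ↝-+ g↝ gs↝

  -- The constant coefficient of the divisor is taken to be 1, so the recursion never divides and
  -- p-integrality passes through it.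
  quotients-~ : ∀ {f f′ g} n → (∀ k → k < n → f k ~ f′ k) → (∀ k → k < n → g k ~ g k) →
    ∀ i → quotients f g n i ~ quotients f′ g n i
  quotients-~ {f} {f′} {g} (suc n) f~f′ g~g Fin.zero = subtract (f~f′ n ℕ.≤-refl)
    (~-∑ n _ _ (λ i → multiply (previous i) (g~g (suc (toℕ i)) (s≤s (Fin.toℕ<n i)))))
    where
    previous : ∀ i → quotients f g n i ~ quotients f′ g n i
    previous = quotients-~ n (λ k k<n → f~f′ k (ℕ.m<n⇒m<1+n k<n)) (λ k k<n → g~g k (ℕ.m<n⇒m<1+n k<n))
    multiply : ∀ {x x′ y y′} → x ~ x′ → y ~ y′ → x * y ~ x′ * y′
    multiply (z , x↝ , x′↝) (w , y↝ , y′↝) = z ℤ.* w , ↝-* x↝ y↝ , ↝-* x′↝ y′↝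
    subtract : ∀ {x x′ y y′} → x ~ x′ → y ~ y′ → x - y ~ x′ - y′
    subtract (z , x↝ , x′↝) (w , y↝ , y′↝) = z ℤ.- w , ↝-+ x↝ (↝-neg y↝) , ↝-+ x′↝ (↝-neg y′↝)
  quotients-~ (suc n) f~f′ g~g (Fin.suc i) =
    quotients-~ n (λ k k<n → f~f′ k (ℕ.m<n⇒m<1+n k<n)) (λ k k<n → g~g k (ℕ.m<n⇒m<1+n k<n)) i

  q-~ : ∀ {s t m} → s ↝ m → t ↝ m → ∀ n → suc n < p → q s n ~ q t n
  q-~ {m = m} s↝m t↝m n n<p = quotients-~ (suc n)
    (λ k k<n → let k<p = ℕ.<-trans k<n n<p in m ℤ.^ k ℤ.* inv (+ (k !)) , ↝-exp k k<p s↝m , ↝-exp k k<p t↝m)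
    (λ k k<n → let k<p = ℕ.≤-<-trans k<n n<p; 1↝ = ↝-exp (suc k) k<p (↝-/1 1ℤ) in
      1ℤ ℤ.^ suc k ℤ.* inv (+ (suc k !)) , 1↝ , 1↝)
    Fin.zero

  -- The increments of `q-suc` are summed from t = 0, where the value vanishes because the index 3 +
  -- 2k is odd.
  q-/1 : ∀ k → let j = 2 ℕ.+ (k ℕ.+ k) in suc j < p → ∀ m →
    q (+ m / 1) (suc j) ↝ ∑ m (λ a → (+ a) ℤ.^ j ℤ.* inv (+ (j !)))
  q-/1 k j<p zero    = subst (_↝ 0ℤ) (sym (q-odd k)) (↝-/1 0ℤ)
  q-/1 k j<p (suc m) = subst (_↝ ∑ (suc m) (λ a → (+ a) ℤ.^ j ℤ.* inv (+ (j !)))) (sym q-step)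
    (↝-+ (q-/1 k j<p m) (↝-exp j (ℕ.<-trans (ℕ.n<1+n j) j<p) (↝-/1 (+ m))))
    where
    j = 2 ℕ.+ (k ℕ.+ k)
    q-step : q (+ suc m / 1) (suc j) ≡ q (+ m / 1) (suc j) + exp (+ m / 1) j
    q-step = trans (cong (λ t → q t (suc j)) (trans (suc/1 m) (ℚ.+-comm 1ℚ (+ m / 1)))) (q-suc (+ m / 1) (suc j))

  -- Here j = p - 3, so a^j ≡ 1/a² by Fermat, while the summand a = 0 vanishes as j > 0.
  power-sum : ∀ k → let j = 2 ℕ.+ (k ℕ.+ k) in suc (suc j) ≡ h ℕ.+ h → ∀ m → suc m < p → ∀ F →
    ∑ (suc m) (λ a → (+ a) ℤ.^ j ℤ.* F) ≋ F ℤ.* H₂ m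
  power-sum k 2+j≡2h m m<p F = ≋-trans (≡⇒≋ (∑-front m (λ a → (+ a) ℤ.^ j ℤ.* F)))
    (≋-trans (≡⇒≋ (ℤ.+-identityˡ (∑ m (λ a → (+ suc a) ℤ.^ j ℤ.* F))))
      (≋-trans (∑-cong≋ m (λ a a<m → ≋-trans (*-congʳ F (power a (ℕ.<-trans (s≤s a<m) m<p))) (≡⇒≋ (ℤ.*-comm (inv² (suc a)) F))))
        (≡⇒≋ (trans (sym (*-distribˡ-∑ m F (inv² ∘ suc))) (cong (F ℤ.*_) (inv²-H₂ m))))))
    where
    j = 2 ℕ.+ (k ℕ.+ k)
    regroup : ∀ a x → a ℤ.* a ℤ.* x ≡ a ℤ.* (a ℤ.* x)
    regroup = solve-∀
    power : ∀ a → suc a < p → (+ suc a) ℤ.^ j ≋ inv² (suc a)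
    power a a<p = inv-unique {+ suc a ℤ.* + suc a} {(+ suc a) ℤ.^ j} (≋-trans
      (≡⇒≋ (trans (regroup (+ suc a) ((+ suc a) ℤ.^ j)) (cong ((+ suc a) ℤ.^_) 2+j≡2h)))
      (fermat-unit {+ suc a} (+k≉0 (s≤s z≤n) a<p)))

  -- (p - 2)!/(p - 3)! = p - 2 ≡ -2, which together with the factor ½ leaves -1.
  bernoulli-third : ∀ m → suc m < p → + 3 ℤ.* + suc m ≋ 1ℤ → ½ * bernoulli (p ∸ 2) (+ 1 / 3) ↝ ℤ.- H₂ m
  bernoulli-third m m<p 3m≋1 = by-h h refl
    where
    third↝ : + 1 / 3 ↝ + suc m
    third↝ = ↝-resp (≋-sym (inv-unique {+ 3} {+ suc m} 3m≋1)) (↝-1/ 3 3≉0)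
      where
      3≉0 : ¬ (+ 3 ≋ 0ℤ)
      3≉0 3≋0 = 1≉0 (≋-trans (≋-sym 3m≋1) (≋-trans (*-congʳ (+ suc m) 3≋0) (≡⇒≋ (ℤ.*-zeroˡ (+ suc m)))))
    half↝ : ½ ↝ inv (+ 2)
    half↝ = ↝-1/ 2 (+k≉0 (s≤s z≤n) (m≤h⇒m<p 2≤h))
    -- A copy of h is matched, since h itself is a module parameter; h = k + 2 turns p - 2 into the
    -- odd index 3 + 2k.
    by-h : ∀ h′ → h′ ≡ h → ½ * bernoulli (p ∸ 2) (+ 1 / 3) ↝ ℤ.- H₂ m
    by-h zero          refl = contradiction 2≤h (λ ())
    by-h (suc zero)    refl = contradiction 2≤h (λ { (s≤s ()) })
    by-h (suc (suc k)) h≡  = subst (λ n → ½ * bernoulli n (+ 1 / 3) ↝ ℤ.- H₂ m) (sym p-2≡) (value (q-~ third↝ (↝-/1 (+ suc m)) (suc j) 1+j<p))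
      where
      j = 2 ℕ.+ (k ℕ.+ k)
      2+j≡2h : suc (suc j) ≡ h ℕ.+ h
      2+j≡2h = trans (cong (2 ℕ.+_) (trans (cong suc (sym (ℕ.+-suc k k))) (sym (ℕ.+-suc k (suc k))))) (cong (λ x → x ℕ.+ x) h≡)
      p-2≡ : p ∸ 2 ≡ suc j
      p-2≡ = cong (_∸ 1) (sym 2+j≡2h)
      1+j<p : suc (suc j) < p
      1+j<p = s≤s (ℕ.≤-reflexive 2+j≡2h)
      j<p : j < p
      j<p = ℕ.<-trans (ℕ.n<1+n j) (ℕ.<-trans (ℕ.n<1+n (suc j)) 1+j<p)
      F = inv (+ (j !))
      combine : ∀ v n f F H → v ℤ.* (n ℤ.* f ℤ.* (F ℤ.* H)) ℤ.- ℤ.- H ≡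
        v ℤ.* n ℤ.* H ℤ.* (f ℤ.* F ℤ.- 1ℤ) ℤ.+ v ℤ.* H ℤ.* (1ℤ ℤ.+ (1ℤ ℤ.+ n) ℤ.- 0ℤ) ℤ.+ ℤ.- H ℤ.* (+ 2 ℤ.* v ℤ.- 1ℤ)
      combine = solve-∀
      value : q (+ 1 / 3) (suc j) ~ q (+ suc m / 1) (suc j) → ½ * bernoulli (suc j) (+ 1 / 3) ↝ ℤ.- H₂ m
      value (z , q↝z , q′↝z) = ↝-resp
        (≋-trans (*-congˡ (inv (+ 2)) (*-cong (≡⇒≋ (ℤ.pos-* (suc j) (j !)))
            (≋-trans (↝-unique q′↝z (q-/1 k (ℕ.<-trans (ℕ.n<1+n (suc j)) 1+j<p) (suc m))) (power-sum k 2+j≡2h m m<p F))))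
          (linear₃ (inv (+ 2) ℤ.* + suc j ℤ.* H₂ m) (inv (+ 2) ℤ.* H₂ m) (ℤ.- H₂ m)
            (inv-inverse {+ (j !)} (!≉0 j j<p))
            (≋-trans (≡⇒≋ (cong (λ n → + suc n) 2+j≡2h)) p≋0)
            (inv-inverse-< {2} (s≤s z≤n) (m≤h⇒m<p 2≤h))
            (combine (inv (+ 2)) (+ suc j) (+ (j !)) F (H₂ m))))
        (↝-* half↝ (↝-* (↝-/1 (+ (suc j !))) q↝z))

  -- From the rational sums of the theorem to their residues

  ℕ-sum≡∑ : ∀ n (f : ℕ → ℕ) → + ℕ-sum {n} (f ∘ toℕ) ≡ ∑ n (λ k → + f k)
  ℕ-sum≡∑ zero    f = refl
  ℕ-sum≡∑ (suc n) f = trans (ℤ.pos-+ (f 0) (ℕ-sum {n} (f ∘ suc ∘ toℕ)))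
    (trans (cong (λ t → + f 0 ℤ.+ t) (ℕ-sum≡∑ n (f ∘ suc))) (sym (∑-front n (λ k → + f k))))

  franel≡ : ∀ n → + franel n ≡ franelℤ n
  franel≡ n = trans (ℕ-sum≡∑ (suc n) (λ k → (n C k) ℕ.^ 3)) (∑-cong (suc n) (λ k _ → term (n C k) (binom≡ n k)))
    where
    term : ∀ x {y} → + x ≡ y → + (x ℕ.* (x ℕ.* (x ℕ.* 1))) ≡ cube y
    term x refl = trans (ℤ.pos-* x (x ℕ.* (x ℕ.* 1))) (cong (+ x ℤ.*_) (trans (ℤ.pos-* x (x ℕ.* 1))
      (cong (λ t → + x ℤ.* + t) (ℕ.*-identityʳ x))))

  pos-*1 : ∀ a → + (a ℕ.* 1) ≡ + a
  pos-*1 a = cong +_ (ℕ.*-identityʳ a)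

  ↝-H₁ : ∀ k → k < p → H k 1 ↝ H₁ k
  ↝-H₁ k k<p = ↝-∑ k term 1/suc (λ i i<k → ↝-resp (≡⇒≋ (cong inv (pos-*1 (suc i))))
    (↝-1/ (suc i ℕ.^ 1) {{ℕ.m^n≢0 (suc i) 1}} (λ e → +k≉0 (s≤s z≤n) (ℕ.≤-<-trans i<k k<p) (≋-trans (≡⇒≋ (sym (pos-*1 (suc i)))) e))))
    where
    term : ℕ → ℚ
    term i = + 1 / (suc i ℕ.^ 1)
      where instance _ = ℕ.m^n≢0 (suc i) 1

  ↝-H₂ : ∀ k → k < p → H k 2 ↝ H₂ k
  ↝-H₂ k k<p = ↝-∑ k term (λ i → 1/suc i ℤ.* 1/suc i) (λ i i<k → ↝-resp
    (≡⇒≋ (trans (cong inv (square i)) (inv-* (+ suc i) (+ suc i))))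
    (↝-1/ (suc i ℕ.^ 2) {{ℕ.m^n≢0 (suc i) 2}} (λ e → *-≉0 (i≉0 i<k) (i≉0 i<k) (≋-trans (≡⇒≋ (sym (square i))) e))))
    where
    term : ℕ → ℚ
    term i = + 1 / (suc i ℕ.^ 2)
      where instance _ = ℕ.m^n≢0 (suc i) 2
    square : ∀ i → + (suc i ℕ.^ 2) ≡ + suc i ℤ.* + suc i
    square i = trans (ℤ.pos-* (suc i) (suc i ℕ.* 1)) (cong (+ suc i ℤ.*_) (pos-*1 (suc i)))
    i≉0 : ∀ {i} → i < k → ¬ (+ suc i ≋ 0ℤ)
    i≉0 i<k = +k≉0 (s≤s z≤n) (ℕ.≤-<-trans i<k k<p)

  ↝-franel-sum : ∀ (a : ℕ → ℚ) (b : ℕ → ℤ) → (∀ k → k < p → a k ↝ b k) →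
    ∑[ k < p ] ((- 1ℚ) ^ toℕ k * (+ franel (toℕ k) / 1) * a (toℕ k)) ↝ ∑ (suc h) (λ m → central m ℤ.* transform m b)
  ↝-franel-sum a b a↝b = ↝-resp
    (≋-trans (≡⇒≋ (∑-cong p (λ k _ → swap (-1ℤ ℤ.^ k) (franelℤ k) (b k)))) (∑-alternating-franel b))
    (↝-∑ p (λ k → (- 1ℚ) ^ k * (+ franel k / 1) * a k) (λ k → -1ℤ ℤ.^ k ℤ.* franelℤ k ℤ.* b k)
      (λ k k<p → ↝-* (↝-* (↝-^ k (↝-neg (↝-/1 1ℤ))) (↝-resp (≡⇒≋ (franel≡ k)) (↝-/1 (+ franel k)))) (a↝b k k<p)))
    where
    swap : ∀ s f a → s ℤ.* f ℤ.* a ≡ s ℤ.* a ℤ.* f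
    swap = solve-∀

  legendre₃-1 : ∀ a → a % 3 ≡ 1 → legendre₃ a ≡ 1ℤ
  legendre₃-1 a e with a % 3 | e
  ... | .1 | refl = refl

  legendre₃-2 : ∀ a → a % 3 ≡ 2 → legendre₃ a ≡ -1ℤ
  legendre₃-2 a e with a % 3 | e
  ... | .2 | refl = refl

  legendre₃-p : ∀ {ε} → Mod3 ε → legendre₃ p ≡ ε
  legendre₃-p (one g 2h≡) = legendre₃-1 p (trans (cong (λ x → suc x % 3) 2h≡) ([m+kn]%n≡m%n 1 g 3))
  legendre₃-p (two g 2h≡) = legendre₃-2 p (trans (cong (λ x → suc x % 3) 2h≡) ([m+kn]%n≡m%n 2 g 3))

  mod3 : ∃[ ε ] Mod3 ε
  mod3 = by-residue (p % 3) (m%n<n p 3) (m≡m%n+[m/n]*n p 3)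
    where
    by-residue : ∀ r → r < 3 → p ≡ r ℕ.+ p ℕ./ 3 ℕ.* 3 → ∃[ ε ] Mod3 ε
    by-residue 0 _ e with prime⇒irreducible prime (divides (p ℕ./ 3) e)
    ... | inj₁ ()
    ... | inj₂ 3≡p = contradiction (ℕ.+-mono-≤ 2≤h 2≤h) (ℕ.<⇒≱ (s≤s (ℕ.≤-trans (ℕ.≤-reflexive (sym (ℕ.suc-injective 3≡p))) (ℕ.n≤1+n 2))))
    by-residue 1 _ e = 1ℤ , one (p ℕ./ 3) (ℕ.suc-injective e)
    by-residue 2 _ e = -1ℤ , two (p ℕ./ 3) (ℕ.suc-injective e)
    by-residue (suc (suc (suc r))) (s≤s (s≤s (s≤s ()))) _

  pos-^ : ∀ a n → + (a ℕ.^ n) ≡ (+ a) ℤ.^ n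
  pos-^ a zero    = refl
  pos-^ a (suc n) = trans (ℤ.pos-* a (a ℕ.^ n)) (cong (+ a ℤ.*_) (pos-^ a n))

  -- Shows that the Fermat quotient is an integer, whose residue is then immediate.
  /p-exact : ∀ {N K} → N ≡ + p ℤ.* K → N / p ≡ K / 1
  /p-exact {N} {K} N≡pK = ℚ.fromℚᵘ-cong {N ℚᵘ./ p} {K ℚᵘ./ 1}
    (ℚᵘ.*≡* (trans (ℤ.*-identityʳ N) (trans N≡pK (ℤ.*-comm (+ p) K))))

  congruence-H₂ : ∑[ k < p ] ((- 1ℚ) ^ toℕ k * (+ franel (toℕ k) / 1) * H (toℕ k) 2)
    ≈ ½ * bernoulli (p ∸ 2) (+ 1 / 3) [mod p ]
  congruence-H₂ = ↝⇒≈
    (↝-resp (≋-trans (∑-cong≋ (suc h) (λ { m (s≤s m≤h) → *-congˡ (central m) (transform-H₂ m m≤h) }))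
        (≋-trans (∑-central-V m3) (ε*H₂-third m3)))
      (↝-franel-sum (λ k → H k 2) H₂ ↝-H₂))
    (bernoulli-third (one-third m3) (one-third-< m3) (3*one-third≋1 m3))
    where
    m3 = proj₂ mod3

  congruence-H₁ : ∑[ k < p ] ((- 1ℚ) ^ toℕ k * (+ franel (toℕ k) / 1) * H (toℕ k) 1)
    ≈ - (+ 2 / 1) * (legendre₃ p / 1) * fermatQuotient p {{prime⇒nonZero prime}} 3 [mod p ]
  congruence-H₁ = ↝⇒≈
    (↝-resp (≋-trans (∑-cong≋ (suc h) (λ { m (s≤s m≤h) → *-congˡ (central m) (transform-H₁ m m≤h) })) (proj₂ (proj₂ quotient₃)))
      (↝-franel-sum (λ k → H k 1) H₁ ↝-H₁))
    (↝-* (↝-* (↝-neg (↝-/1 (+ 2))) (↝-resp (≡⇒≋ (legendre₃-p (proj₂ mod3))) (↝-/1 (legendre₃ p))))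
      (subst (_↝ K) (sym (/p-exact (trans (cong (ℤ._- 1ℤ) (pos-^ 3 (h ℕ.+ h))) (proj₁ (proj₂ quotient₃))))) (↝-/1 K)))
    where
    quotient₃ = ∑-central-H₁ (proj₂ mod3)
    K = proj₁ quotient₃

open import Defs
open import Data.Rational.Base using (1ℚ; ½; _/_; _*_; -_)

-- In the form `suc (h ℕ.+ h)`, p can be replaced by matching on `refl`, and p - 1 then computes to
-- h + h.
odd-prime : ∀ p → Prime p → 5 ≤ p → ∃[ h ] p ≡ suc (h ℕ.+ h) × 2 ≤ h
odd-prime p prime 5≤p = by-parity (p % 2) (m%n<n p 2) (m≡m%n+[m/n]*n p 2)
  where
  by-parity : ∀ r → r < 2 → p ≡ r ℕ.+ p ℕ./ 2 ℕ.* 2 → ∃[ h ] p ≡ suc (h ℕ.+ h) × 2 ≤ h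
  by-parity 0 _ p≡ with prime⇒irreducible prime (divides (p ℕ./ 2) p≡)
  ... | inj₁ ()
  ... | inj₂ 2≡p = contradiction 5≤p (ℕ.<⇒≱ (ℕ.≤-trans (s≤s (ℕ.≤-reflexive (sym 2≡p))) (ℕ.m≤m+n 3 2)))
  by-parity 1 _ p≡ = p ℕ./ 2 , p≡1+2h , 2≤h
    where
    double : ∀ n → n ℕ.* 2 ≡ n ℕ.+ n
    double = ℕ-solve-∀
    p≡1+2h : p ≡ suc (p ℕ./ 2 ℕ.+ p ℕ./ 2)
    p≡1+2h = trans p≡ (cong suc (double (p ℕ./ 2)))
    2≤h : 2 ≤ p ℕ./ 2
    2≤h = ℕ.*-cancelʳ-≤ 2 (p ℕ./ 2) 2 (ℕ.≤-pred (subst (5 ≤_) p≡ 5≤p))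
  by-parity (suc (suc r)) (s≤s (s≤s ())) _

theorem1p3 : ∀ (p : ℕ) (pr : Prime p) → 5 ≤ p →
    ( (∑[ k < p ] ((- 1ℚ) ^ toℕ k * (+ franel (toℕ k) / 1) * H (toℕ k) 2))
    ≈ ½ * bernoulli (p ∸ 2) (+ 1 / 3) [mod p ] )
    ×
    ( (∑[ k < p ] ((- 1ℚ) ^ toℕ k * (+ franel (toℕ k) / 1) * H (toℕ k) 1))
    ≈ - (+ 2 / 1) * (legendre₃ p / 1) * fermatQuotient p {{prime⇒nonZero pr}} 3 [mod p ] )
theorem1p3 p pr 5≤p with odd-prime p pr 5≤p
... | h , refl , 2≤h = congruence-H₂ , congruence-H₁
  where open Reduction h pr 2≤h
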